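{- For every $\pi\in\mathbb D_r(d)$ and every marking $\Sigma$ of $\pi$, $$\mathcal G^{\pm,\mathrm{col}}_r(\pi,\Sigma)(\mathbf x;t^{ -1})=\tilde\chi^{\mathsf P}_r(\pi,\Sigma)(\mathbf x;t).$$
   Context: $\mathbb F=\mathbb Q(q,t)$; $\mathcal P(r)=\mathbb F[x_1,\dots,x_r]\otimes\Lambda_{\mathbb F}(x_{r+1},\dots)$ inside $\mathbb F[[x_1,x_2,\dots]]$. Box $(c,r)$ is the unit square with northeast corner $(c,r)$. $\mathbb D_r(d)$ is the set of north/east lattice paths from $(0,r)$ to $(d,d)$ weakly above the line from $(0,0)$ to $(d,d)$; $\mathrm{Area}(\pi)$ is the set of full boxes below $\pi$ (extended by $r$ north steps from $(0,0)$) and above that diagonal. A corner is a box above $\pi$ whose south and east neighbours are below $\pi$; a marking is a set of corners. Alphabet $\mathcal A$: $1<\bar1<2<\bar2<\cdots$, positive letters $v$, negative letters $\bar v$, $|v|=|\bar v|=v$. For $a,b\in\mathcal A$, $ab$ is column-decreasing if $a>b$ or $a=b$ is negative. A flagged $(\pi,\Sigma)$-column super word is $T:[d]\to\mathcal A$ with $T(j)T(i)$ column-decreasing for all $(i,j)\in\Sigma$ and $T(i)\le i$ for $i\le r$. $\widetilde{\mathrm{inv}}(T)$ is the number of $(i,j)\in\mathrm{Area}(\pi)$ with $T(j)T(i)$ column-decreasing; $m(T)$ the number of negative letters; $\mathbf x^{|T|}=\prod_i x_{|T(i)|}$. Then $\mathcal G^{\pm,\mathrm{col}}_r(\pi,\Sigma)(\mathbf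 x;t)=\sum_T t^{\widetilde{\mathrm{inv}}(T)}(-t)^{ -m(T)}\mathbf x^{|T|}$. Operators: $T_if=s_if+(1-t)x_i\frac{f-s_if}{x_i-x_{i+1}}$; $\mathcal B_nf(Z)=\langle u^0\rangle u^nf[Z-u]\Omega[(1-t)u^{ -1}Z]$ (plethystic notation, $\Omega[A]=\exp\sum_kp_k[A]/k$); $d_-^{\mathsf P}:\mathcal P(s)\to\mathcal P(s-1)$, $x_1^{\eta_1}\cdots x_s^{\eta_s}g(x_{s+1},\dots)\mapsto x_1^{\eta_1}\cdots x_{s-1}^{\eta_{s-1}}\mathcal B_{\eta_s}(g[x_s+x_{s+1}+\cdots])$; $d_+^{\mathsf P}:\mathcal P(s)\to\mathcal P(s+1)$, $f\mapsto -T_1\cdots T_s(x_{s+1}f)$. $\tilde\chi^{\mathsf P}_r(\pi,\Sigma)$ is obtained from $1\in\mathcal P(0)$ by traversing $\pi$ backwards from $(d,d)$ to $(0,r)$, where at each moment the current element lies in $\mathcal P(s)$ with $s=h-v$ ($h$, $v$ the numbers of horizontal and vertical steps traversed so far), applying: for each east step not in a marked corner, $-t^{ -s}d_+^{\mathsf P}$; for each north step not in a marked corner, $d_-^{\mathsf P}$; for each marked corner (its east-side north step and south-side east step), instead the operator $\frac{1}{t^{ -1}-1}\big(d_-^{\mathsf P}(-t^{ -s}d_+^{\mathsf P})-(-t^{ -s+1}d_+^{\mathsf P})d_-^{\mathsf P}\big)$. -}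

module Defs where

open import Data.Nat as ℕ using (ℕ; zero; suc; _≤_; _<_; _∸_; _≡ᵇ_; _≤ᵇ_; _<ᵇ_)
open import Data.Integer as ℤ using (ℤ)
open import Data.Rational as ℚ using (ℚ)
open import Data.Bool using (Bool; true; false; _∧_; _∨_; not; if_then_else_)
open import Data.List using (List; []; _∷_; _++_; map; concatMap; foldr; reverse; replicate; upTo; take; length)
open import Data.Product using (_×_; _,_)
open import Relation.Binary.PropositionalEquality using (_≡_)
open import Relation.Nullary.Decidable using (⌊_⌋)

-- Polynomials.  A monomial is  t^te · x_1^{xe_0} x_2^{xe_1} ⋯ · p_1^{pe_0} p_2^{pe_1} ⋯
-- where p_k are the power sums in the "symmetric" variables (Λ_F ≅ F[p_1,p_2,…]).
-- A polynomial is a finite formal ℚ-linear combination of monomials; two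
-- polynomials are equal when all their coefficients agree.

record Mono : Set where
  constructor mono
  field
    te : ℤ
    xe : List ℕ
    pe : List ℕ

Poly : Set
Poly = List (ℚ × Mono)

eqE : List ℕ → List ℕ → Bool
eqE [] [] = true
eqE [] (b ∷ bs) = (b ≡ᵇ 0) ∧ eqE [] bs
eqE (a ∷ as) [] = (a ≡ᵇ 0) ∧ eqE as []
eqE (a ∷ as) (b ∷ bs) = (a ≡ᵇ b) ∧ eqE as bs

eqM : Mono → Mono → Bool
eqM (mono a xe pe) (mono b ye qe) = ⌊ a ℤ.≟ b ⌋ ∧ eqE xe ye ∧ eqE pe qe

coeff : Poly → Mono → ℚ
coeff [] m = ℚ.0ℚ
coeff ((c , m') ∷ P) m = (if eqM m' m then c else ℚ.0ℚ) ℚ.+ coeff P m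

infix 4 _≈P_
_≈P_ : Poly → Poly → Set
P ≈P Q = ∀ (m : Mono) → coeff P m ≡ coeff Q m

getE : List ℕ → ℕ → ℕ
getE [] i = 0
getE (e ∷ es) zero = e
getE (e ∷ es) (suc i) = getE es i

setE : List ℕ → ℕ → ℕ → List ℕ
setE [] zero v = v ∷ []
setE [] (suc i) v = 0 ∷ setE [] i v
setE (e ∷ es) zero v = v ∷ es
setE (e ∷ es) (suc i) v = e ∷ setE es i v

addE : List ℕ → List ℕ → List ℕ
addE [] ys = ys
addE (x ∷ xs) [] = x ∷ xs
addE (x ∷ xs) (y ∷ ys) = (x ℕ.+ y) ∷ addE xs ys

mulM : Mono → Mono → Mono
mulM (mono a xe pe) (mono b ye qe) = mono (a ℤ.+ b) (addE xe ye) (addE pe qe)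

infixl 6 _+P_ _-P_
infixl 7 _*P_

_+P_ : Poly → Poly → Poly
P +P Q = P ++ Q

negP : Poly → Poly
negP = map (λ { (c , m) → (ℚ.- c , m) })

_-P_ : Poly → Poly → Poly
P -P Q = P +P negP Q

_*P_ : Poly → Poly → Poly
P *P Q = concatMap (λ { (c , m) → map (λ { (c' , m') → (c ℚ.* c' , mulM m m') }) Q }) P

scaleP : ℚ → Poly → Poly
scaleP q = map (λ { (c , m) → (q ℚ.* c , m) })

one : Poly
one = (ℚ.1ℚ , mono (ℤ.+ 0) [] []) ∷ []

tPow : ℤ → Poly
tPow a = (ℚ.1ℚ , mono a [] []) ∷ []

xVar : ℕ → Poly
xVar i = (ℚ.1ℚ , mono (ℤ.+ 0) (setE [] (i ∸ 1) 1) []) ∷ []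

pVar : ℕ → Poly
pVar k = (ℚ.1ℚ , mono (ℤ.+ 0) [] (setE [] (k ∸ 1) 1)) ∷ []

powP : Poly → ℕ → Poly
powP P zero = one
powP P (suc n) = P *P powP P n

sumP : List Poly → Poly
sumP = foldr _+P_ []

prodIdx : (ℕ → Poly) → ℕ → List ℕ → Poly
prodIdx f i [] = one
prodIdx f i (e ∷ es) = powP (f i) e *P prodIdx f (suc i) es

substP : (ℕ → Poly) → (ℕ → Poly) → Poly → Poly
substP X Pk = concatMap (λ { (c , mono a xe pe) →
  ((c , mono a [] []) ∷ []) *P (prodIdx X 1 xe *P prodIdx Pk 1 pe) })

invT : Poly → Poly
invT = map (λ { (c , mono a xe pe) → (c , mono (ℤ.- a) xe pe) })

swapM : ℕ → Mono → Mono
swapM i (mono a xe pe) =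
  mono a (setE (setE xe (i ∸ 1) (getE xe i)) i (getE xe (i ∸ 1))) pe

sP : ℕ → Poly → Poly
sP i = map (λ { (c , m) → (c , swapM i m) })

-- (m - s_i m)/(x_i - x_{i+1}) for a monomial m (exact polynomial division)
ddTerm : ℕ → ℚ × Mono → Poly
ddTerm i (c , mono a xe pe) =
  map (λ j → (c , mk (A ∸ 1 ∸ j) (B ℕ.+ j))) (upTo (A ∸ B)) ++
  map (λ j → (ℚ.- c , mk (B ∸ 1 ∸ j) (A ℕ.+ j))) (upTo (B ∸ A))
  where
  A = getE xe (i ∸ 1)
  B = getE xe i
  mk : ℕ → ℕ → Mono
  mk e₁ e₂ = mono a (setE (setE xe (i ∸ 1) e₁) i e₂) pe

ddP : ℕ → Poly → Poly
ddP i = concatMap (ddTerm i)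

Ti : ℕ → Poly → Poly
Ti i f = sP i f +P ((one -P tPow (ℤ.+ 1)) *P xVar i) *P ddP i f

Tchain : ℕ → Poly → Poly
Tchain zero f = f
Tchain (suc s) f = Tchain s (Ti (suc s) f)

-- d₊ : P(s) → P(s+1),  f ↦ - T_1 ⋯ T_s (x_{s+1} f),
-- where f ∈ P(s) is viewed in P(s+1) via p_k ↦ x_{s+1}^k + p_k.

liftP : ℕ → Poly → Poly
liftP s = substP xVar (λ k → powP (xVar (suc s)) k +P pVar k)

dPlus : ℕ → Poly → Poly
dPlus s f = negP (Tchain s (xVar (suc s) *P liftP s f))

-- B_n f = ⟨u^0⟩ u^n f[Z-u] Ω[(1-t)u⁻¹Z]
--       = Σ_j ⟨u^j⟩ f[Z-u] · h_{n+j}[(1-t)Z].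

-- Hlist m = [ H_m , H_{m-1} , … , H_0 ],  H_m = h_m[(1-t)Z], defined from
-- Ω[(1-t)uZ] = exp Σ_k p_k[(1-t)Z] u^k / k, i.e.
-- m H_m = Σ_{k=1}^m p_k[(1-t)Z] H_{m-k}, with p_k[(1-t)Z] = (1-t^k) p_k.
newtonSum : ℕ → List Poly → Poly
newtonSum k [] = []
newtonSum k (h ∷ hs) =
  ((one -P tPow (ℤ.+ k)) *P pVar k) *P h +P newtonSum (suc k) hs

Hlist : ℕ → List Poly
Hlist zero = one ∷ []
Hlist (suc m) = scaleP (ℤ.+ 1 ℚ./ suc m) (newtonSum 1 (Hlist m)) ∷ Hlist m

headP : List Poly → Poly
headP [] = []
headP (h ∷ _) = h

H : ℕ → Poly
H m = headP (Hlist m)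

-- polynomials in an auxiliary variable u with Poly coefficients
UPoly : Set
UPoly = List Poly

_+U_ : UPoly → UPoly → UPoly
[] +U q = q
(a ∷ p) +U [] = a ∷ p
(a ∷ p) +U (b ∷ q) = (a +P b) ∷ (p +U q)

_*U_ : UPoly → UPoly → UPoly
[] *U q = []
(a ∷ p) *U q = map (a *P_) q +U ([] ∷ (p *U q))

oneU : UPoly
oneU = one ∷ []

powU : UPoly → ℕ → UPoly
powU P zero = oneU
powU P (suc n) = P *U powU P n

-- p_k[Z-u] = p_k - u^k
pMinusU : ℕ → UPoly
pMinusU k = pVar k ∷ (replicate (k ∸ 1) [] ++ (negP one ∷ []))

plethMinusU : ℕ → List ℕ → UPoly
plethMinusU k [] = oneU
plethMinusU k (e ∷ es) = powU (pMinusU k) e *U plethMinusU (suc k) es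

sumU : ℕ → UPoly → Poly
sumU m [] = []
sumU m (c ∷ cs) = c *P H m +P sumU (suc m) cs

Bop : ℕ → List ℕ → Poly
Bop n pe = sumU n (plethMinusU 1 pe)

-- d₋ : P(s) → P(s-1),
-- x_1^{η_1}⋯x_s^{η_s} g ↦ x_1^{η_1}⋯x_{s-1}^{η_{s-1}} B_{η_s}(g[x_s + x_{s+1} + ⋯]).
dMinus : ℕ → Poly → Poly
dMinus zero f = []
dMinus (suc s) = concatMap (λ { (c , mono a xe pe) →
  ((c , mono a (setE xe s 0) []) ∷ []) *P Bop (getE xe s) pe })

data Step : Set where
  north east : Step

isE isN : Step → Bool
isE east = true
isE north = false
isN s = not (isE s)

countE countN : List Step → ℕ
countE [] = 0
countE (s ∷ ss) = (if isE s then 1 else 0) ℕ.+ countE ss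
countN [] = 0
countN (s ∷ ss) = (if isN s then 1 else 0) ℕ.+ countN ss

-- 𝔻_r(d): north/east paths from (0,r) to (d,d) weakly above the diagonal y = x.
record Dyck (r d : ℕ) : Set where
  field
    steps  : List Step
    endE   : countE steps ≡ d
    endN   : r ℕ.+ countN steps ≡ d
    weakly : ∀ (k : ℕ) → countE (take k steps) ≤ r ℕ.+ countN (take k steps)
open Dyck public

-- x-coordinate of the north step of the (r-extended) path in row j,
-- i.e. crossing the horizontal band between heights j-1 and j.
XrowGo : ℕ → ℕ → List Step → ℕ → ℕ
XrowGo x y [] j = 0
XrowGo x y (east ∷ s) j = XrowGo (suc x) y s j
XrowGo x y (north ∷ s) j = if suc y ≡ᵇ j then x else XrowGo x (suc y) s j

Xrow : (r : ℕ) → List Step → ℕ → ℕ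
Xrow r π j = if j ≤ᵇ r then 0 else XrowGo 0 r π j

-- Box (c,j) (north-east corner (c,j)) lies below π iff it is right of the
-- north step in row j.
BelowB : (r : ℕ) → List Step → ℕ → ℕ → Bool
BelowB r π c j = Xrow r π j <ᵇ c

AreaB : (r d : ℕ) → List Step → ℕ → ℕ → Bool
AreaB r d π i j = (1 ≤ᵇ i) ∧ (i <ᵇ j) ∧ (j ≤ᵇ d) ∧ BelowB r π i j

record IsCorner (r d : ℕ) (π : Dyck r d) (b : ℕ × ℕ) : Set where
  constructor corner
  field
    c-pos   : 1 ≤ Data.Product.proj₁ b
    c-le    : Data.Product.proj₁ b ≤ d
    j-pos   : 1 ≤ Data.Product.proj₂ b
    j-le    : Data.Product.proj₂ b ≤ d
    above   : Data.Product.proj₁ b ≤ Xrow r (steps π) (Data.Product.proj₂ b)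
    southB  : Xrow r (steps π) (Data.Product.proj₂ b ∸ 1) < Data.Product.proj₁ b
    eastB   : Xrow r (steps π) (Data.Product.proj₂ b) < suc (Data.Product.proj₁ b)

anyB : {A : Set} → (A → Bool) → List A → Bool
anyB f [] = false
anyB f (a ∷ as) = f a ∨ anyB f as

allB : {A : Set} → (A → Bool) → List A → Bool
allB f [] = true
allB f (a ∷ as) = f a ∧ allB f as

pairEq : ℕ × ℕ → ℕ × ℕ → Bool
pairEq (a , b) (c , d) = (a ≡ᵇ c) ∧ (b ≡ᵇ d)

memB : ℕ × ℕ → List (ℕ × ℕ) → Bool
memB p Σ = anyB (pairEq p) Σ

data Ev : Set where
  evE evN evM : Ev

-- forward walk from (x,y); an east step followed by a north step whose
-- corner box (x+1,y+1) is marked is merged into one event evM.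
events : List (ℕ × ℕ) → ℕ → ℕ → List Step → List Ev
events Σ x y [] = []
events Σ x y (east ∷ rest@(north ∷ rest')) =
  if memB (suc x , suc y) Σ then evM ∷ events Σ (suc x) (suc y) rest'
  else evE ∷ events Σ (suc x) y rest
events Σ x y (east ∷ rest) = evE ∷ events Σ (suc x) y rest
events Σ x y (north ∷ rest) = evN ∷ events Σ x (suc y) rest

ePlus : ℕ → Poly → Poly
ePlus s f = negP (tPow (ℤ.- (ℤ.+ s)) *P dPlus s f)

-- (t⁻¹ - 1) · (marked corner operator) on P(s):
--   d₋(-t^{-s} d₊) - (-t^{-s+1} d₊) d₋
markedNum : ℕ → Poly → Poly
markedNum s f =
  dMinus (suc s) (ePlus s f) -P negP (tPow (ℤ.+ 1 ℤ.- ℤ.+ s) *P dPlus (s ∸ 1) (dMinus s f))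

-- process events (already in backwards order) starting in P(s);
-- the factor 1/(t⁻¹-1) = t/(1-t) of each marked corner is split as
-- t (applied here) and 1/(1-t) (counted separately, see chiDen).
run : List Ev → ℕ → Poly → Poly
run [] s f = f
run (evE ∷ es) s f = run es (suc s) (ePlus s f)
run (evN ∷ es) s f = run es (s ∸ 1) (dMinus s f)
run (evM ∷ es) s f = run es s (tPow (ℤ.+ 1) *P markedNum s f)

countM : List Ev → ℕ
countM [] = 0
countM (evM ∷ es) = suc (countM es)
countM (_ ∷ es) = countM es

-- χ̃^P_r(π,Σ) = chiNum / (1-t)^chiDen
chiNum : (r d : ℕ) → Dyck r d → List (ℕ × ℕ) → Poly
chiNum r d π Σ = run (reverse (events Σ 0 r (steps π))) 0 one

chiDen : (r d : ℕ) → Dyck r d → List (ℕ × ℕ) → ℕ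
chiDen r d π Σ = countM (events Σ 0 r (steps π))

-- image of an element of P(r) in F[x_1,…,x_N] under x_i ↦ 0 (i > N)
truncP : (r N : ℕ) → Poly → Poly
truncP r N = substP (λ i → if i ≤ᵇ N then xVar i else [])
                    (λ k → sumP (map (λ i → powP (xVar (r ℕ.+ suc i)) k) (upTo (N ∸ r))))

-- Super letters: v ↦ code 2v, v̄ ↦ code 2v+1  (1 < 1̄ < 2 < 2̄ < ⋯)

record Letter : Set where
  constructor letter
  field
    val : ℕ      -- |a| ≥ 1
    neg : Bool

code : Letter → ℕ
code (letter v n) = 2 ℕ.* v ℕ.+ (if n then 1 else 0)

colDec : Letter → Letter → Bool
colDec a b = (code b <ᵇ code a) ∨ ((code a ≡ᵇ code b) ∧ Letter.neg a)

lookupL : List Letter → ℕ → Letter      -- 1-based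
lookupL [] i = letter 1 false
lookupL (a ∷ as) zero = a
lookupL (a ∷ as) (suc zero) = a
lookupL (a ∷ as) (suc (suc i)) = lookupL as (suc i)

lettersUpTo : ℕ → List Letter
lettersUpTo N = concatMap (λ v → letter (suc v) false ∷ letter (suc v) true ∷ []) (upTo N)

words : ℕ → ℕ → List (List Letter)
words N zero = [] ∷ []
words N (suc d) = concatMap (λ a → map (a ∷_) (words N d)) (lettersUpTo N)

countB : List Bool → ℕ
countB [] = 0
countB (b ∷ bs) = (if b then 1 else 0) ℕ.+ countB bs

isColWord : (r d : ℕ) → Dyck r d → List (ℕ × ℕ) → List Letter → Bool
isColWord r d π Σ T =
  allB (λ { (i , j) → colDec (lookupL T j) (lookupL T i) }) Σ ∧
  allB (λ i → code (lookupL T (suc i)) ≤ᵇ 2 ℕ.* suc i) (upTo r)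

invT̃ : (r d : ℕ) → Dyck r d → List Letter → ℕ
invT̃ r d π T = countB (concatMap (λ i → map (λ j →
   AreaB r d (steps π) (suc i) (suc j) ∧ colDec (lookupL T (suc j)) (lookupL T (suc i)))
   (upTo d)) (upTo d))

mT : List Letter → ℕ
mT T = countB (map Letter.neg T)

xWord : List Letter → List ℕ
xWord [] = []
xWord (a ∷ as) = addE (setE [] (Letter.val a ∸ 1) 1) (xWord as)

sign : ℕ → ℚ
sign zero = ℚ.1ℚ
sign (suc n) = ℚ.- sign n

-- G^{±,col}_r(π,Σ)(x;t) with x_i ↦ 0 for i > N:
-- Σ_T t^{inv(T)} (-t)^{-m(T)} x^{|T|},  (-t)^{-m} = (-1)^m t^{-m}.
GcolTrunc : (r d : ℕ) → Dyck r d → List (ℕ × ℕ) → ℕ → Poly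
GcolTrunc r d π Σ N = concatMap (λ T →
  if isColWord r d π Σ T
  then (sign (mT T) , mono (ℤ.+ invT̃ r d π T ℤ.- ℤ.+ mT T) (xWord T) []) ∷ []
  else []) (words N d)

{-# OPTIONS --safe #-}
module Submission where

open import Defs
open import Data.Nat using (ℕ)
open import Data.Integer using (+_)
open import Data.List using (List)
open import Data.List.Relation.Unary.All using (All)
open import Data.Product using (_×_)

open import Algebra.Bundles using (CommutativeRing)
import Algebra.Definitions.RawMonoid as RawMonoid
open import Algebra.Morphism.Structures using (module RingMorphisms)
import Algebra.Properties.Semiring.Exp
import Algebra.Solver.Ring
open import Algebra.Solver.Ring.AlmostCommutativeRing using (fromCommutativeRing; _-Raw-AlmostCommutative⟶_)
open import Data.Bool using (Bool; true; false; T; if_then_else_; _∧_; _∨_)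
import Data.Bool.Properties as BoolP
open import Data.Empty using (⊥; ⊥-elim)
open import Data.Integer as ℤ using (ℤ; -[1+_])
import Data.Integer.Properties as ℤP
open import Data.List using ([]; _∷_; _++_; map; concatMap; applyUpTo; upTo; replicate; reverse; length; drop; take)
import Data.List.Properties as ListP
open import Data.List.Relation.Unary.All using ([]; _∷_)
import Data.List.Relation.Unary.All.Properties as AllP
open import Data.Maybe using (Maybe; just; nothing)
open import Data.Nat as ℕ using (zero; suc; _≤_; _<_; _∸_; z≤n; s≤s; _≡ᵇ_; _≤ᵇ_; _<ᵇ_)
import Data.Nat.Properties as ℕP
open import Data.Product using (_,_; proj₁; proj₂)
open import Data.Rational as ℚ using (ℚ; 0ℚ; 1ℚ)
import Data.Rational.Properties as ℚP
import Data.Rational.Unnormalised as ℚᵘ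
import Data.Rational.Unnormalised.Properties as ℚᵘP
open import Data.Sum using (_⊎_; inj₁; inj₂)
open import Function using (_∘_)
open import Level using (0ℓ)
open import Relation.Binary.Definitions using (tri<; tri≈; tri>)
import Relation.Binary.PropositionalEquality as ≡
open ≡ using (_≡_; _≢_)
open import Relation.Nullary using (yes; no; ¬_)
open import Relation.Nullary.Decidable using (⌊_⌋)

-- Summing over the signs of the letters kills every word in which two attacking positions
-- carry the same absolute value, because such a letter contributes 1 - t t⁻¹ = 0.  So both
-- sides are about proper colourings, and the flags force the first r colours to be 1, …, r.
-- Reading π as a queue (a north step pushes a colour, an east step pops one) gives functions V
-- of the window w of active colours with T_k V(w) = V(σ_k w) whenever the last of k, k+1 in w
-- is k.  Hence T_1 ⋯ T_s in d₊ turns the window 1 … s into 2 … s+1, which is a pop.  For d₋,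
-- write F as a polynomial in x_s whose coefficients are symmetric in x_s, …, x_N =: Z; the sum
-- of the products t^{c-s} T_{c-1}⁻¹ ⋯ T_s⁻¹ applied to (1-t) x_s^m telescopes to h_m[(1-t)Z],
-- while applied to V it lets the last flagged colour run over all values, which is a push.
-- A marked corner is the difference of the two orders of pop and push, divided by t⁻¹ - 1.

-- The operators relate V on the windows 1 ... s only, but T_1 ⋯ T_s passes through windows with a
-- gap, and d₋ appends colours beyond s + 1. Hence V is defined on all windows by the combinatorics
-- alone, and the exchange relation is proved there, before any polynomial is mentioned. Three
-- obstacles shape the rest. T_k divides by x_k - x_{k+1}, so it is handled as a relation in a ring
-- where this difference can be cancelled. In finitely many variables the telescoping for d₋ fails
-- in degree zero by a power of t; this defect is removed by comparing N with N + 1 variables, so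
-- all large N are treated at once. And the theorem speaks of every N, even below d, so both sides
-- are computed with L ≥ N colours, and the variables beyond N are set to zero.

module IntegerSolver (R : CommutativeRing 0ℓ 0ℓ) where
  open CommutativeRing R
  open import Algebra.Properties.Ring ring
  open import Algebra.Properties.AbelianGroup +-abelianGroup
  open import Algebra.Properties.Semiring.Mult.TCOptimised semiring renaming (_×_ to _·_)
  open import Relation.Binary.Reasoning.Setoid setoid

  -- Equality in an arbitrary ring cannot be decided, so the solver takes its coefficients from the
  -- integers. The optimised multiple makes `fromℤ (+ 1)` reduce to `1#`, so that `con (+ 1)`
  -- denotes `1#` itself.
  fromℤ : ℤ → Carrier
  fromℤ (+ n) = n · 1#
  fromℤ -[1+ n ] = - (suc n · 1#)

  fromℤ-⊖ : ∀ m n → fromℤ (m ℤ.⊖ n) ≈ m · 1# - n · 1#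
  fromℤ-⊖ m zero = sym (trans (+-congˡ -0#≈0#) (+-identityʳ _))
  fromℤ-⊖ zero (suc n) = sym (+-identityˡ _)
  fromℤ-⊖ (suc m) (suc n) = begin
    fromℤ (suc m ℤ.⊖ suc n)  ≈⟨ reflexive (≡.cong fromℤ (ℤP.[1+m]⊖[1+n]≡m⊖n m n)) ⟩
    fromℤ (m ℤ.⊖ n)          ≈⟨ fromℤ-⊖ m n ⟩
    m · 1# - n · 1#                      ≈⟨ +-congʳ (sym (trans (+-congʳ (-‿inverseʳ 1#)) (+-identityˡ _))) ⟩
    (1# - 1# + m · 1#) - n · 1#          ≈⟨ +-congʳ (trans (+-assoc _ _ _) (trans (+-congˡ (+-comm _ _)) (sym (+-assoc _ _ _)))) ⟩
    (1# + m · 1# - 1#) - n · 1#          ≈⟨ +-assoc _ _ _ ⟩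
    1# + m · 1# + (- 1# - n · 1#)        ≈⟨ +-congˡ (⁻¹-∙-comm _ _) ⟩
    1# + m · 1# - (1# + n · 1#)          ≈⟨ sym (+-cong (1+× m 1#) (-‿cong (1+× n 1#))) ⟩
    suc m · 1# - suc n · 1#              ∎

  fromℤ-+ : ∀ i j → fromℤ (i ℤ.+ j) ≈ fromℤ i + fromℤ j
  fromℤ-+ (+ m) (+ n) = ×-homo-+ 1# m n
  fromℤ-+ (+ m) -[1+ n ] = fromℤ-⊖ m (suc n)
  fromℤ-+ -[1+ m ] (+ n) = trans (fromℤ-⊖ n (suc m)) (+-comm _ _)
  fromℤ-+ -[1+ m ] -[1+ n ] = begin
    - (suc (suc (m ℕ.+ n)) · 1#)        ≈⟨ -‿cong (reflexive (≡.cong (λ k → suc k · 1#) (≡.sym (ℕP.+-suc m n)))) ⟩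
    - ((suc m ℕ.+ suc n) · 1#)          ≈⟨ -‿cong (×-homo-+ 1# (suc m) (suc n)) ⟩
    - (suc m · 1# + suc n · 1#)         ≈⟨ sym (⁻¹-∙-comm _ _) ⟩
    - (suc m · 1#) - (suc n · 1#)       ∎

  fromℤ-neg : ∀ i → fromℤ (ℤ.- i) ≈ - fromℤ i
  fromℤ-neg (+ zero) = sym -0#≈0#
  fromℤ-neg (+ suc n) = refl
  fromℤ-neg -[1+ n ] = sym (⁻¹-involutive _)

  fromℤ-pos-* : ∀ m j → fromℤ (+ m ℤ.* j) ≈ m · 1# * fromℤ j
  fromℤ-pos-* zero j = trans (reflexive (≡.cong fromℤ (ℤP.*-zeroˡ j))) (sym (zeroˡ _))
  fromℤ-pos-* (suc m) j = begin
    fromℤ (+ suc m ℤ.* j)         ≈⟨ reflexive (≡.cong fromℤ (ℤP.suc-* (+ m) j)) ⟩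
    fromℤ (j ℤ.+ + m ℤ.* j)       ≈⟨ fromℤ-+ j (+ m ℤ.* j) ⟩
    fromℤ j + fromℤ (+ m ℤ.* j)   ≈⟨ +-cong (sym (*-identityˡ _)) (fromℤ-pos-* m j) ⟩
    1# * fromℤ j + m · 1# * fromℤ j ≈⟨ sym (distribʳ _ _ _) ⟩
    (1# + m · 1#) * fromℤ j       ≈⟨ *-congʳ (sym (1+× m 1#)) ⟩
    suc m · 1# * fromℤ j          ∎

  fromℤ-* : ∀ i j → fromℤ (i ℤ.* j) ≈ fromℤ i * fromℤ j
  fromℤ-* (+ m) j = fromℤ-pos-* m j
  fromℤ-* -[1+ m ] j = begin
    fromℤ (-[1+ m ] ℤ.* j)       ≈⟨ reflexive (≡.cong fromℤ (≡.sym (ℤP.neg-distribˡ-* (+ suc m) j))) ⟩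
    fromℤ (ℤ.- (+ suc m ℤ.* j))  ≈⟨ fromℤ-neg (+ suc m ℤ.* j) ⟩
    - fromℤ (+ suc m ℤ.* j)      ≈⟨ -‿cong (fromℤ-pos-* (suc m) j) ⟩
    - (suc m · 1# * fromℤ j)     ≈⟨ -‿distribˡ-* _ _ ⟩
    - (suc m · 1#) * fromℤ j     ∎

  homomorphism : CommutativeRing.rawRing ℤP.+-*-commutativeRing -Raw-AlmostCommutative⟶ fromCommutativeRing R
  homomorphism = record
    { ⟦_⟧    = fromℤ
    ; +-homo = fromℤ-+
    ; *-homo = fromℤ-*
    ; -‿homo = fromℤ-neg
    ; 0-homo = refl
    ; 1-homo = refl
    }

  fromℤ-≟ : ∀ i j → Maybe (fromℤ i ≈ fromℤ j)
  fromℤ-≟ i j with i ℤP.≟ j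
  ... | yes i≡j = just (reflexive (≡.cong fromℤ i≡j))
  ... | no _ = nothing

  open Algebra.Solver.Ring (CommutativeRing.rawRing ℤP.+-*-commutativeRing) (fromCommutativeRing R) homomorphism fromℤ-≟ public
    using (solve; _:=_; _:+_; _:*_; _:-_; :-_; con)

-- Windows of colours and their exchange relations

if-T : {A : Set} {b : Bool} {x y : A} → T b → (if b then x else y) ≡ x
if-T {b = true} _ = ≡.refl

if-¬T : {A : Set} {b : Bool} {x y : A} → ¬ T b → (if b then x else y) ≡ y
if-¬T {b = true} ¬p = ⊥-elim (¬p _)
if-¬T {b = false} _ = ≡.refl

below mult : ℕ → List ℕ → ℕ
below c [] = 0
below c (a ∷ w) = (if a <ᵇ c then 1 else 0) ℕ.+ below c w
mult c [] = 0
mult c (a ∷ w) = (if a ≡ᵇ c then 1 else 0) ℕ.+ mult c w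

Distinct : List ℕ → Set
Distinct w = ∀ c → mult c w ≤ 1

mult-++ : ∀ c u v → mult c (u ++ v) ≡ mult c u ℕ.+ mult c v
mult-++ c [] v = ≡.refl
mult-++ c (a ∷ u) v = ≡.trans (≡.cong ((if a ≡ᵇ c then 1 else 0) ℕ.+_) (mult-++ c u v)) (≡.sym (ℕP.+-assoc (if a ≡ᵇ c then 1 else 0) _ _))

indicator-≡ : ∀ a → (if a ≡ᵇ a then 1 else 0) ≡ 1
indicator-≡ a = if-T (ℕP.≡⇒≡ᵇ a a ≡.refl)

indicator-≢ : ∀ {a c} → a ≢ c → (if a ≡ᵇ c then 1 else 0) ≡ 0
indicator-≢ {a} {c} a≢c = if-¬T (λ p → a≢c (ℕP.≡ᵇ⇒≡ a c p))

indicator-< : ∀ {a c} → a < c → (if a <ᵇ c then 1 else 0) ≡ 1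
indicator-< a<c = if-T (ℕP.<⇒<ᵇ a<c)

indicator-≮ : ∀ {a c} → ¬ (a < c) → (if a <ᵇ c then 1 else 0) ≡ 0
indicator-≮ {a} {c} a≮c = if-¬T (λ p → a≮c (ℕP.<ᵇ⇒< a c p))

mult-self : ∀ c w → mult c (c ∷ w) ≡ suc (mult c w)
mult-self c w = ≡.cong (ℕ._+ mult c w) (indicator-≡ c)

mult-other : ∀ {a c} w → a ≢ c → mult c (a ∷ w) ≡ mult c w
mult-other {a} {c} w a≢c = ≡.cong (ℕ._+ mult c w) (indicator-≢ a≢c)

mult-snoc-≢ : ∀ {a c} w → a ≢ c → mult c (w ++ a ∷ []) ≡ mult c w
mult-snoc-≢ {a} {c} w a≢c = ≡.trans (mult-++ c w (a ∷ [])) (≡.trans (≡.cong (mult c w ℕ.+_) (mult-other [] a≢c)) (ℕP.+-identityʳ _))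

Distinct-snoc : ∀ {w c} → Distinct w → mult c w ≡ 0 → Distinct (w ++ c ∷ [])
Distinct-snoc {w} {c} dw c∉w e with c ℕP.≟ e
... | no c≢e = ≡.subst (_≤ 1) (≡.sym (mult-snoc-≢ w c≢e)) (dw e)
... | yes ≡.refl = ≡.subst (_≤ 1) (≡.sym (≡.trans (mult-++ c w (c ∷ [])) (≡.cong₂ ℕ._+_ c∉w (mult-self c [])))) ℕP.≤-refl

Distinct-tail : ∀ a w → Distinct (a ∷ w) → Distinct w
Distinct-tail a w dw e = ℕP.≤-trans (ℕP.m≤n+m _ _) (dw e)

mult-0-or-1 : ∀ {w} → Distinct w → ∀ c → mult c w ≡ 0 ⊎ mult c w ≡ 1
mult-0-or-1 {w} dw c with mult c w | dw c
... | 0 | _ = inj₁ ≡.refl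
... | 1 | _ = inj₂ ≡.refl
... | suc (suc _) | s≤s ()

below-suc : ∀ c w → below (suc c) w ≡ below c w ℕ.+ mult c w
below-suc c [] = ≡.refl
below-suc c (a ∷ w) = ≡.trans (≡.cong₂ ℕ._+_ head (below-suc c w)) (interchange (if a <ᵇ c then 1 else 0) (if a ≡ᵇ c then 1 else 0) (below c w) (mult c w))
  where
  open import Algebra.Properties.CommutativeSemigroup ℕP.+-commutativeSemigroup using (interchange)
  head : (if a <ᵇ suc c then 1 else 0) ≡ (if a <ᵇ c then 1 else 0) ℕ.+ (if a ≡ᵇ c then 1 else 0)
  head with ℕP.<-cmp a c
  ... | tri< a<c a≢c _ = ≡.trans (indicator-< (ℕP.m<n⇒m<1+n a<c)) (≡.sym (≡.cong₂ ℕ._+_ (indicator-< a<c) (indicator-≢ a≢c)))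
  ... | tri≈ _ ≡.refl _ = ≡.trans (indicator-< (ℕP.n<1+n a)) (≡.sym (≡.cong₂ ℕ._+_ (indicator-≮ (ℕP.n≮n a)) (indicator-≡ a)))
  ... | tri> a≮c a≢c c<a = ≡.trans (indicator-≮ {a} {suc c} (λ { (s≤s a≤c) → ℕP.<⇒≱ c<a a≤c })) (≡.sym (≡.cong₂ ℕ._+_ (indicator-≮ a≮c) (indicator-≢ a≢c)))

transposition : ℕ → ℕ → ℕ
transposition k c with c ℕP.≟ k
... | yes _ = suc k
... | no _ with c ℕP.≟ suc k
...   | yes _ = k
...   | no _ = c

module _ (k : ℕ) where
  private σ = transposition k

  σ-k : σ k ≡ suc k
  σ-k with k ℕP.≟ k
  ... | yes _ = ≡.refl
  ... | no k≢k = ⊥-elim (k≢k ≡.refl)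

  σ-suc : σ (suc k) ≡ k
  σ-suc with suc k ℕP.≟ k
  ... | yes p = ⊥-elim (ℕP.1+n≢n p)
  ... | no _ with suc k ℕP.≟ suc k
  ...   | yes _ = ≡.refl
  ...   | no q = ⊥-elim (q ≡.refl)

  σ-other : ∀ {c} → c ≢ k → c ≢ suc k → σ c ≡ c
  σ-other {c} c≢k c≢k+1 with c ℕP.≟ k
  ... | yes p = ⊥-elim (c≢k p)
  ... | no _ with c ℕP.≟ suc k
  ...   | yes q = ⊥-elim (c≢k+1 q)
  ...   | no _ = ≡.refl

  data Position : ℕ → Set where
    at-k      : Position k
    at-1+k    : Position (suc k)
    elsewhere : ∀ {c} → c ≢ k → c ≢ suc k → Position c

  position : ∀ c → Position c
  position c with c ℕP.≟ k
  ... | yes ≡.refl = at-k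
  ... | no p with c ℕP.≟ suc k
  ...   | yes ≡.refl = at-1+k
  ...   | no q = elsewhere p q

  σ-involutive : ∀ c → σ (σ c) ≡ c
  σ-involutive c with position c
  ... | at-k = ≡.trans (≡.cong σ σ-k) σ-suc
  ... | at-1+k = ≡.trans (≡.cong σ σ-suc) σ-k
  ... | elsewhere p q = ≡.trans (≡.cong σ (σ-other p q)) (σ-other p q)

  σσ-map : ∀ w → map σ (map σ w) ≡ w
  σσ-map w = ≡.trans (≡.sym (ListP.map-∘ w)) (≡.trans (ListP.map-cong σ-involutive w) (ListP.map-id w))

  σ-injective : ∀ {a c} → σ a ≡ σ c → a ≡ c
  σ-injective {a} {c} e = ≡.trans (≡.sym (σ-involutive a)) (≡.trans (≡.cong σ e) (σ-involutive c))

  mult-σ : ∀ c w → mult (σ c) (map σ w) ≡ mult c w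
  mult-σ c [] = ≡.refl
  mult-σ c (a ∷ w) with a ℕP.≟ c
  ... | yes ≡.refl = ≡.cong₂ ℕ._+_ (≡.trans (indicator-≡ (σ a)) (≡.sym (indicator-≡ a))) (mult-σ a w)
  ... | no a≢c = ≡.cong₂ ℕ._+_ (≡.trans (indicator-≢ {σ a} {σ c} (λ e → a≢c (σ-injective e))) (≡.sym (indicator-≢ {a} {c} a≢c))) (mult-σ c w)

  -- The exchanged colours `k` and `suc k` lie on the same side of every threshold other than
  -- `suc k`.
  σ-< : ∀ {c} → c ≢ suc k → ∀ a → (if σ a <ᵇ c then 1 else 0) ≡ (if a <ᵇ c then 1 else 0)
  σ-< {c} c≢ a with position a
  ... | elsewhere p q = ≡.cong (λ z → if z <ᵇ c then 1 else 0) (σ-other p q)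
  ... | at-k = ≡.trans (≡.cong (λ z → if z <ᵇ c then 1 else 0) σ-k) (lemma c≢)
    where
    lemma : ∀ {c} → c ≢ suc k → (if suc k <ᵇ c then 1 else 0) ≡ (if k <ᵇ c then 1 else 0)
    lemma {c} c≢ with k ℕP.<? c
    ... | yes k<c = ≡.trans (indicator-< (ℕP.≤∧≢⇒< k<c (≡.≢-sym c≢))) (≡.sym (indicator-< k<c))
    ... | no k≮c = ≡.trans (indicator-≮ (λ p → k≮c (ℕP.<⇒≤ p))) (≡.sym (indicator-≮ k≮c))
  ... | at-1+k = ≡.trans (≡.cong (λ z → if z <ᵇ c then 1 else 0) σ-suc) (lemma c≢)
    where
    lemma : ∀ {c} → c ≢ suc k → (if k <ᵇ c then 1 else 0) ≡ (if suc k <ᵇ c then 1 else 0)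
    lemma {c} c≢ with k ℕP.<? c
    ... | yes k<c = ≡.trans (indicator-< k<c) (≡.sym (indicator-< (ℕP.≤∧≢⇒< k<c (≡.≢-sym c≢))))
    ... | no k≮c = ≡.trans (indicator-≮ k≮c) (≡.sym (indicator-≮ (λ p → k≮c (ℕP.<⇒≤ p))))

  below-σ : ∀ {c} → c ≢ suc k → ∀ w → below c (map σ w) ≡ below c w
  below-σ c≢ [] = ≡.refl
  below-σ c≢ (a ∷ w) = ≡.cong₂ ℕ._+_ (σ-< c≢ a) (below-σ c≢ w)

  map-σ-fixed : ∀ w → mult k w ≡ 0 → mult (suc k) w ≡ 0 → map σ w ≡ w
  map-σ-fixed [] _ _ = ≡.refl
  map-σ-fixed (a ∷ w) k∉ k+1∉ with position a
  ... | at-k = ⊥-elim (ℕP.1+n≢0 (≡.trans (≡.sym (mult-self a w)) k∉))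
  ... | at-1+k = ⊥-elim (ℕP.1+n≢0 (≡.trans (≡.sym (mult-self a w)) k+1∉))
  ... | elsewhere p q = ≡.cong₂ _∷_ (σ-other p q) (map-σ-fixed w (≡.trans (≡.sym (mult-other w p)) k∉) (≡.trans (≡.sym (mult-other w q)) k+1∉))

  Distinct-σ : ∀ {w} → Distinct w → Distinct (map σ w)
  Distinct-σ {w} dw c = ≡.subst (_≤ 1) (≡.trans (≡.sym (mult-σ (σ c) w)) (≡.cong (λ z → mult z (map σ w)) (σ-involutive c))) (dw (σ c))

-- Hecke operators as relations, and their action on functions of windows

module OverRing (R : CommutativeRing 0ℓ 0ℓ) where
 open CommutativeRing R hiding (zero)
 open IntegerSolver R
 open import Algebra.Properties.Semiring.Exp semiring using (_^_)
 open import Relation.Binary.Reasoning.Setoid setoid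

 sumTo : ℕ → (ℕ → Carrier) → Carrier
 sumTo zero f = 0#
 sumTo (suc n) f = sumTo n f + f n

 module _ (_∼_ : Carrier → Carrier → Set) (∼-0 : 0# ∼ 0#)
          (∼-+ : ∀ {f g f' g'} → f ∼ g → f' ∼ g' → (f + f') ∼ (g + g'))
          (∼-cong : ∀ {f f' g g'} → f ≈ f' → g ≈ g' → f ∼ g → f' ∼ g') where
   sumTo-∼-small : ∀ n {f g} → (∀ c → c < n → f c ∼ g c) → sumTo n f ∼ sumTo n g
   sumTo-∼-small zero _ = ∼-0
   sumTo-∼-small (suc n) h = ∼-+ (sumTo-∼-small n (λ c c<n → h c (ℕP.m<n⇒m<1+n c<n))) (h n (ℕP.n<1+n n))

   -- The terms `k` and `suc k` are related only as a pair, all others singly. With the relation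
   -- left abstract, one induction serves for invariance under a swap, for `_↝_` and for the
   -- symmetry of power sums.
   sumTo-∼ : ∀ k {f g} → (∀ c → c ≢ k → c ≢ suc k → f c ∼ g c) →
             (f k + f (suc k)) ∼ (g k + g (suc k)) → ∀ n → suc k < n → sumTo n f ∼ sumTo n g
   sumTo-∼ k {f} {g} h hk (suc n) (s≤s k<n) with n ℕP.≟ suc k
   ... | yes ≡.refl = ∼-cong (sym (+-assoc _ _ _)) (sym (+-assoc _ _ _))
           (∼-+ (sumTo-∼-small k (λ c c<k → h c (ℕP.<⇒≢ c<k) (ℕP.<⇒≢ (ℕP.m<n⇒m<1+n c<k)))) hk)
   ... | no n≢ = ∼-+ (sumTo-∼ k h hk n (ℕP.≤∧≢⇒< k<n (≡.≢-sym n≢))) (h n (λ { ≡.refl → ℕP.n≮n n k<n }) n≢)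

 record IsTransposition (t t⁻¹ : Carrier) (x : ℕ → Carrier) (k : ℕ) (s : Carrier → Carrier) : Set where
   field
     isHom        : RingMorphisms.IsRingHomomorphism rawRing rawRing s
     s-involutive : ∀ f → s (s f) ≈ f
     s-t          : s t ≈ t
     s-t⁻¹        : s t⁻¹ ≈ t⁻¹
     s-xₖ         : s (x k) ≈ x (suc k)
     s-x          : ∀ {c} → c ≢ k → c ≢ suc k → s (x c) ≈ x c
     cancel       : ∀ {f g} → (x k - x (suc k)) * f ≈ (x k - x (suc k)) * g → f ≈ g
   open RingMorphisms.IsRingHomomorphism isHom public using (⟦⟧-cong; +-homo; *-homo; -‿homo; 0#-homo; 1#-homo)

 module Transposition {t t⁻¹ : Carrier} {x : ℕ → Carrier} {k : ℕ} {s : Carrier → Carrier} (isTransposition : IsTransposition t t⁻¹ x k s) where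
   open IsTransposition isTransposition public
   a = x k
   b = x (suc k)

   s-xₖ₊₁ : s b ≈ a
   s-xₖ₊₁ = trans (⟦⟧-cong (sym s-xₖ)) (s-involutive a)

   infix 4 _↝[_]_ _↝_ _⇝_
   -- This is T_k f = s f + (1 - t) a (f - s f) / (a - b) multiplied by a - b, since the ring has no
   -- division; `cancel` makes the relation single-valued. Passing to T_k - (1 - t) only replaces a
   -- by b in the coefficient of f, and this is the parameter `e`.
   _↝[_]_ : Carrier → Carrier → Carrier → Set
   f ↝[ e ] g = (a - b) * g ≈ (1# - t) * e * f + (t * a - b) * s f

   -- g = Tₖ f
   _↝_ : Carrier → Carrier → Set
   f ↝ g = f ↝[ a ] g

   -- g = (Tₖ - (1 - t)) f = t Tₖ⁻¹ f
   _⇝_ : Carrier → Carrier → Set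
   f ⇝ g = f ↝[ b ] g

   ↝-cong : ∀ {e f f' g g'} → f ≈ f' → g ≈ g' → f ↝[ e ] g → f' ↝[ e ] g'
   ↝-cong f≈f' g≈g' r = trans (*-congˡ (sym g≈g')) (trans r (+-cong (*-congˡ f≈f') (*-congˡ (⟦⟧-cong f≈f'))))

   ↝-functional : ∀ {e f f' g g'} → f ≈ f' → f ↝[ e ] g → f' ↝[ e ] g' → g ≈ g'
   ↝-functional f≈f' r r' = cancel (trans r (trans (+-cong (*-congˡ f≈f') (*-congˡ (⟦⟧-cong f≈f'))) (sym r')))

   ↝-0 : ∀ {e} → 0# ↝[ e ] 0#
   ↝-0 = trans (zeroʳ _) (sym (trans (+-cong (zeroʳ _) (trans (*-congˡ 0#-homo) (zeroʳ _))) (+-identityˡ 0#)))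

   ↝-+ : ∀ {e f g f' g'} → f ↝[ e ] g → f' ↝[ e ] g' → f + f' ↝[ e ] g + g'
   ↝-+ {e} {f} {g} {f'} {g'} r r' = begin
     (a - b) * (g + g')                     ≈⟨ distribˡ _ _ _ ⟩
     (a - b) * g + (a - b) * g'             ≈⟨ +-cong r r' ⟩
     (1# - t) * e * f + (t * a - b) * s f + ((1# - t) * e * f' + (t * a - b) * s f')
       ≈⟨ solve 6 (λ p q f f' sf sf' → p :* f :+ q :* sf :+ (p :* f' :+ q :* sf') := p :* (f :+ f') :+ q :* (sf :+ sf')) refl ((1# - t) * e) (t * a - b) f f' (s f) (s f') ⟩
     (1# - t) * e * (f + f') + (t * a - b) * (s f + s f') ≈⟨ +-congˡ (*-congˡ (sym (+-homo f f'))) ⟩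
     (1# - t) * e * (f + f') + (t * a - b) * s (f + f')   ∎

   ↝-* : ∀ {e c f g} → s c ≈ c → f ↝[ e ] g → c * f ↝[ e ] c * g
   ↝-* {e} {c} {f} {g} sc r = begin
     (a - b) * (c * g)  ≈⟨ solve 4 (λ a b c g → (a :- b) :* (c :* g) := c :* ((a :- b) :* g)) refl a b c g ⟩
     c * ((a - b) * g)  ≈⟨ *-congˡ r ⟩
     c * ((1# - t) * e * f + (t * a - b) * s f)
       ≈⟨ solve 5 (λ p q f sf c → c :* (p :* f :+ q :* sf) := p :* (c :* f) :+ q :* (c :* sf)) refl ((1# - t) * e) (t * a - b) f (s f) c ⟩
     (1# - t) * e * (c * f) + (t * a - b) * (c * s f)  ≈⟨ +-congˡ (*-congˡ (trans (*-congʳ (sym sc)) (sym (*-homo c f)))) ⟩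
     (1# - t) * e * (c * f) + (t * a - b) * s (c * f)  ∎

   ↝-symmetric : ∀ {f} → s f ≈ f → f ↝ f
   ↝-symmetric {f} sf = sym (trans (+-congˡ (*-congˡ sf))
     (solve 4 (λ a b t f → (con (+ 1) :- t) :* a :* f :+ (t :* a :- b) :* f := (a :- b) :* f) refl a b t f))

   s-^ : ∀ {c} → s c ≈ c → ∀ n → s (c ^ n) ≈ c ^ n
   s-^ sc zero = 1#-homo
   s-^ {c} sc (suc n) = trans (*-homo c (c ^ n)) (*-cong sc (s-^ sc n))

   s-1-t : s (1# - t) ≈ 1# - t
   s-1-t = trans (+-homo _ _) (+-cong 1#-homo (trans (-‿homo t) (-‿cong s-t)))

   -- (a - b)(a f + b Tf) is antisymmetric.
   ↝⇒symmetric : ∀ {f g} → f ↝ g → s (a * f + b * g) ≈ a * f + b * g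
   ↝⇒symmetric {f} {g} r = cancel (begin
     (a - b) * s h                    ≈⟨ solve 3 (λ a b h → (a :- b) :* h := :- ((b :- a) :* h)) refl a b (s h) ⟩
     - ((b - a) * s h)                ≈⟨ -‿cong (*-congʳ (sym s-a-b)) ⟩
     - (s (a - b) * s h)              ≈⟨ -‿cong (sym (*-homo _ _)) ⟩
     - s ((a - b) * h)                ≈⟨ -‿cong (⟦⟧-cong expand) ⟩
     - s (a * (a - t * b) * f - b * (b - t * a) * s f)  ≈⟨ -‿cong (trans (+-homo _ _) (+-cong s-first (trans (-‿homo _) (-‿cong s-second)))) ⟩
     - (b * (b - t * a) * s f - a * (a - t * b) * f)
       ≈⟨ solve 2 (λ p q → :- (p :- q) := q :- p) refl (b * (b - t * a) * s f) (a * (a - t * b) * f) ⟩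
     a * (a - t * b) * f - b * (b - t * a) * s f  ≈⟨ sym expand ⟩
     (a - b) * h                      ∎)
     where
     h = a * f + b * g
     s-a-b : s (a - b) ≈ b - a
     s-a-b = trans (+-homo _ _) (+-cong s-xₖ (trans (-‿homo b) (-‿cong s-xₖ₊₁)))
     expand : (a - b) * h ≈ a * (a - t * b) * f - b * (b - t * a) * s f
     expand = begin
       (a - b) * (a * f + b * g)
         ≈⟨ solve 4 (λ a b f g → (a :- b) :* (a :* f :+ b :* g) := a :* (a :- b) :* f :+ b :* ((a :- b) :* g)) refl a b f g ⟩
       a * (a - b) * f + b * ((a - b) * g)  ≈⟨ +-congˡ (*-congˡ r) ⟩
       a * (a - b) * f + b * ((1# - t) * a * f + (t * a - b) * s f)
         ≈⟨ solve 5 (λ a b t f sf → a :* (a :- b) :* f :+ b :* ((con (+ 1) :- t) :* a :* f :+ (t :* a :- b) :* sf)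
                   := a :* (a :- t :* b) :* f :- b :* (b :- t :* a) :* sf) refl a b t f (s f) ⟩
       a * (a - t * b) * f - b * (b - t * a) * s f  ∎
     s-first : s (a * (a - t * b) * f) ≈ b * (b - t * a) * s f
     s-first = trans (*-homo _ _) (*-congʳ (trans (*-homo _ _) (*-cong s-xₖ
       (trans (+-homo _ _) (+-cong s-xₖ (trans (-‿homo _) (-‿cong (trans (*-homo _ _) (*-cong s-t s-xₖ₊₁)))))))))
     s-second : s (b * (b - t * a) * s f) ≈ a * (a - t * b) * f
     s-second = trans (*-homo _ _) (*-cong (trans (*-homo _ _) (*-cong s-xₖ₊₁
       (trans (+-homo _ _) (+-cong s-xₖ₊₁ (trans (-‿homo _) (-‿cong (trans (*-homo _ _) (*-cong s-t s-xₖ)))))))) (s-involutive f))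

   -- The Hecke relation Tₖ xₖ₊₁ Tₖ = t xₖ.
   ↝-braid : ∀ {g h} → g ↝ h → b * h ↝ t * a * g
   ↝-braid {g} {h} r = cancel (begin
     (a - b) * ((a - b) * (t * a * g))
       ≈⟨ solve 5 (λ a b t g sg →
            (a :- b) :* ((a :- b) :* (t :* a :* g))
            := (con (+ 1) :- t) :* a :* b :* ((con (+ 1) :- t) :* a :* g :+ (t :* a :- b) :* sg)
               :- (t :* a :- b) :* a :* ((con (+ 1) :- t) :* b :* sg :+ (t :* b :- a) :* g)) refl a b t g (s g) ⟩
     (1# - t) * a * b * ((1# - t) * a * g + (t * a - b) * s g) - (t * a - b) * a * ((1# - t) * b * s g + (t * b - a) * g)
       ≈⟨ sym (+-cong (*-congˡ r) (-‿cong (*-congˡ sr))) ⟩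
     (1# - t) * a * b * ((a - b) * h) - (t * a - b) * a * ((b - a) * s h)
       ≈⟨ solve 5 (λ a b t h sh →
            (con (+ 1) :- t) :* a :* b :* ((a :- b) :* h) :- (t :* a :- b) :* a :* ((b :- a) :* sh)
            := (a :- b) :* ((con (+ 1) :- t) :* a :* (b :* h) :+ (t :* a :- b) :* (a :* sh))) refl a b t h (s h) ⟩
     (a - b) * ((1# - t) * a * (b * h) + (t * a - b) * (a * s h))
       ≈⟨ *-congˡ (+-congˡ (*-congˡ (sym (trans (*-homo b h) (*-congʳ s-xₖ₊₁))))) ⟩
     (a - b) * ((1# - t) * a * (b * h) + (t * a - b) * s (b * h))  ∎)
     where
     sr : (b - a) * s h ≈ (1# - t) * b * s g + (t * b - a) * g
     sr = begin
       (b - a) * s h    ≈⟨ *-congʳ (sym (trans (+-homo _ _) (+-cong s-xₖ (trans (-‿homo b) (-‿cong s-xₖ₊₁))))) ⟩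
       s (a - b) * s h  ≈⟨ sym (*-homo _ _) ⟩
       s ((a - b) * h)  ≈⟨ ⟦⟧-cong r ⟩
       s ((1# - t) * a * g + (t * a - b) * s g)
         ≈⟨ trans (+-homo _ _) (+-cong
              (trans (*-homo _ _) (*-congʳ (trans (*-homo _ _) (*-cong s-1-t s-xₖ))))
              (trans (*-homo _ _) (*-cong (trans (+-homo _ _) (+-cong (trans (*-homo _ _) (*-cong s-t s-xₖ)) (trans (-‿homo b) (-‿cong s-xₖ₊₁)))) (s-involutive g)))) ⟩
       (1# - t) * b * s g + (t * b - a) * g  ∎

   -- The Hecke relation solved for the inverse: t T_k⁻¹ x_k = x_{k+1} T_k. In this form it moves
   -- the last colour of a window together with its variable, as the summands of d₋ require.
   ↝⇒⇝ : ∀ {f g} → f ↝ g → a * f ⇝ b * g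
   ↝⇒⇝ {f} {g} r = begin
     (a - b) * (b * g)  ≈⟨ solve 3 (λ a b g → (a :- b) :* (b :* g) := b :* ((a :- b) :* g)) refl a b g ⟩
     b * ((a - b) * g)  ≈⟨ *-congˡ r ⟩
     b * ((1# - t) * a * f + (t * a - b) * s f)
       ≈⟨ solve 5 (λ a b t f sf → b :* ((con (+ 1) :- t) :* a :* f :+ (t :* a :- b) :* sf) := (con (+ 1) :- t) :* b :* (a :* f) :+ (t :* a :- b) :* (b :* sf)) refl a b t f (s f) ⟩
     (1# - t) * b * (a * f) + (t * a - b) * (b * s f)  ≈⟨ +-congˡ (*-congˡ (sym (trans (*-homo a f) (*-congʳ s-xₖ)))) ⟩
     (1# - t) * b * (a * f) + (t * a - b) * s (a * f)  ∎

 module Windows (t t⁻¹ : Carrier) (t*t⁻¹ : t * t⁻¹ ≈ 1#) (x : ℕ → Carrier) (N : ℕ) where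
   -- A window lists the colours of the positions attacked by the next position: a north step
   -- appends a colour, an east step removes the first one.  Colours are numbered from 0.
   -- The weight is the sum over the two signs of a new letter of absolute value c.
   weight : List ℕ → ℕ → Carrier
   weight w c = t⁻¹ ^ below c w * (1# - t * t⁻¹ ^ mult c w)

   Family : Set
   Family = List ℕ → Carrier

   opE opN opM : Family → Family
   opE V w = V (drop 1 w)
   opN V w = sumTo N (λ c → weight w c * x c * V (w ++ c ∷ []))
   opM V w = t * (opN (opE V) w - opE (opN V) w)

   family : List Ev → Family
   family [] w = 1#
   family (evE ∷ es) = opE (family es)
   family (evN ∷ es) = opN (family es)
   family (evM ∷ es) = opM (family es)

   module _ (y : ℕ → Carrier) {θ : Carrier → Carrier} (isHom : RingMorphisms.IsRingHomomorphism rawRing rawRing θ)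
            (θ-t : θ t ≈ t) (θ-t⁻¹ : θ t⁻¹ ≈ t⁻¹) (θ-x : ∀ c → c < N → θ (x c) ≈ y c) where
     open RingMorphisms.IsRingHomomorphism isHom

     θ-weight : ∀ w c → θ (weight w c) ≈ weight w c
     θ-weight w c = trans (*-homo _ _) (*-cong (θ-power (below c w)) (trans (+-homo _ _) (+-cong 1#-homo
       (trans (-‿homo _) (-‿cong (trans (*-homo _ _) (*-cong θ-t (θ-power (mult c w)))))))))
       where
       θ-power : ∀ n → θ (t⁻¹ ^ n) ≈ t⁻¹ ^ n
       θ-power zero = 1#-homo
       θ-power (suc n) = trans (*-homo _ _) (*-cong θ-t⁻¹ (θ-power n))

     opN-hom : ∀ {V V' : Family} → (∀ w → θ (V w) ≈ V' w) → ∀ w → θ (opN V w) ≈ sumTo N (λ c → weight w c * y c * V' (w ++ c ∷ []))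
     opN-hom {V} {V'} h w = go N (λ _ c<N → c<N)
       where
       go : ∀ n → (∀ c → c < n → c < N) → θ (sumTo n (λ c → weight w c * x c * V (w ++ c ∷ []))) ≈ sumTo n (λ c → weight w c * y c * V' (w ++ c ∷ []))
       go zero _ = 0#-homo
       go (suc n) n≤N = trans (+-homo _ _) (+-cong (go n (λ c c<n → n≤N c (ℕP.m<n⇒m<1+n c<n)))
         (trans (*-homo _ _) (*-cong (trans (*-homo _ _) (*-cong (θ-weight w n) (θ-x n (n≤N n (ℕP.n<1+n n))))) (h (w ++ n ∷ [])))))
   weight-old : ∀ w c → mult c w ≡ 1 → weight w c ≈ 0#
   weight-old w c eq = begin
     t⁻¹ ^ below c w * (1# - t * t⁻¹ ^ mult c w)  ≈⟨ *-congˡ (+-congˡ (-‿cong (*-congˡ (reflexive (≡.cong (t⁻¹ ^_) eq))))) ⟩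
     t⁻¹ ^ below c w * (1# - t * (t⁻¹ * 1#))      ≈⟨ *-congˡ (trans (+-congˡ (-‿cong (trans (*-congˡ (*-identityʳ _)) t*t⁻¹))) (-‿inverseʳ 1#)) ⟩
     t⁻¹ ^ below c w * 0#                         ≈⟨ zeroʳ _ ⟩
     0#                                           ∎

   weight-new : ∀ w c → mult c w ≡ 0 → weight w c ≈ t⁻¹ ^ below c w * (1# - t)
   weight-new w c eq = *-congˡ (+-congˡ (-‿cong (trans (*-congˡ (reflexive (≡.cong (t⁻¹ ^_) eq))) (*-identityʳ t))))

   module Exchange (k : ℕ) (1+k<N : suc k < N) (s : Carrier → Carrier) (isTransposition : IsTransposition t t⁻¹ x k s) where
     open Transposition isTransposition
     private σ = transposition k

     s-weight : ∀ w c → s (weight w c) ≈ weight w c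
     s-weight w c = trans (*-homo _ _) (*-cong (s-^ s-t⁻¹ (below c w))
       (trans (+-homo _ _) (+-cong 1#-homo (trans (-‿homo _) (-‿cong (trans (*-homo _ _) (*-cong s-t (s-^ s-t⁻¹ (mult c w)))))))))

     -- The two cases are closed under the steps only together: popping a `k` with no `suc k` behind
     -- it leads from a window of `last` to one of `free`, and appending `k` to a window with
     -- neither colour leads back. Repetitions are excluded because the weight of an old colour
     -- vanishes at multiplicity one.
     record Exchangeable (V : Family) : Set where
       field
         free : ∀ w → Distinct w → mult k w ≡ 0 → mult (suc k) w ≡ 0 → s (V w) ≈ V w
         last : ∀ w u v → w ≡ u ++ k ∷ v → Distinct w → mult (suc k) v ≡ 0 → V w ↝ V (map σ w)
     open Exchangeable public

     opE-exchangeable : ∀ {V} → Exchangeable V → Exchangeable (opE V)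
     free (opE-exchangeable ex) [] dw p q = free ex [] dw p q
     free (opE-exchangeable ex) (c ∷ w) dw p q =
       free ex w (Distinct-tail c w dw) (ℕP.m+n≡0⇒n≡0 (if c ≡ᵇ k then 1 else 0) p) (ℕP.m+n≡0⇒n≡0 (if c ≡ᵇ suc k then 1 else 0) q)
     -- The popped colour is `k` itself; what remains contains neither colour, so its value is
     -- symmetric and fixed by T_k.
     last (opE-exchangeable {V} ex) .(k ∷ v) [] v ≡.refl dw q =
       ↝-cong refl (reflexive (≡.cong V (≡.sym (map-σ-fixed k v k∉v q)))) (↝-symmetric (free ex v (Distinct-tail k v dw) k∉v q))
       where
       k∉v : mult k v ≡ 0
       k∉v = ℕP.n≤0⇒n≡0 (ℕP.≤-pred (≡.subst (_≤ 1) (mult-self k v) (dw k)))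
     last (opE-exchangeable ex) .(c ∷ u ++ k ∷ v) (c ∷ u) v ≡.refl dw q = last ex (u ++ k ∷ v) u v ≡.refl (Distinct-tail c (u ++ k ∷ v) dw) q

     opN-exchangeable : ∀ {V} → Exchangeable V → Exchangeable (opN V)
     free (opN-exchangeable {V} ex) w dw k∉ k+1∉ =
       sumTo-∼ (λ f g → s f ≈ g) 0#-homo (λ p q → trans (+-homo _ _) (+-cong p q)) (λ f≈f' g≈g' p → trans (⟦⟧-cong (sym f≈f')) (trans p g≈g'))
         k generic pair N 1+k<N
       where
       generic : ∀ c → c ≢ k → c ≢ suc k → s (weight w c * x c * V (w ++ c ∷ [])) ≈ weight w c * x c * V (w ++ c ∷ [])
       generic c c≢k c≢k+1 with mult-0-or-1 {w} dw c
       ... | inj₂ old = trans (⟦⟧-cong vanish) (trans 0#-homo (sym vanish))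
         where
         vanish : weight w c * x c * V (w ++ c ∷ []) ≈ 0#
         vanish = trans (*-congʳ (trans (*-congʳ (weight-old w c old)) (zeroˡ _))) (zeroˡ _)
       ... | inj₁ new = trans (*-homo _ _) (*-cong (trans (*-homo _ _) (*-cong (s-weight w c) (s-x c≢k c≢k+1)))
               (free ex (w ++ c ∷ []) (Distinct-snoc {w} dw new) (≡.trans (mult-snoc-≢ w c≢k) k∉) (≡.trans (mult-snoc-≢ w c≢k+1) k+1∉)))
       weights : weight w (suc k) ≈ weight w k
       weights = *-cong (reflexive (≡.cong (t⁻¹ ^_) (≡.trans (below-suc k w) (≡.trans (≡.cong (below k w ℕ.+_) k∉) (ℕP.+-identityʳ _)))))
                        (reflexive (≡.cong (λ m → 1# - t * t⁻¹ ^ m) (≡.trans k+1∉ (≡.sym k∉))))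
       exchange : V (w ++ k ∷ []) ↝ V (w ++ suc k ∷ [])
       exchange = ↝-cong refl (reflexive (≡.cong V (≡.trans (ListP.map-++ σ w (k ∷ [])) (≡.cong₂ _++_ (map-σ-fixed k w k∉ k+1∉) (≡.cong (_∷ []) (σ-k k))))))
                    (last ex (w ++ k ∷ []) w [] ≡.refl (Distinct-snoc {w} dw k∉) ≡.refl)
       factor : weight w k * a * V (w ++ k ∷ []) + weight w (suc k) * b * V (w ++ suc k ∷ []) ≈ weight w k * (a * V (w ++ k ∷ []) + b * V (w ++ suc k ∷ []))
       factor = trans (+-congˡ (*-congʳ (*-congʳ weights)))
         (solve 5 (λ p a f b g → p :* a :* f :+ p :* b :* g := p :* (a :* f :+ b :* g)) refl (weight w k) a (V (w ++ k ∷ [])) b (V (w ++ suc k ∷ [])))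
       -- The weights agree because w contains neither colour, which leaves x_k f + x_{k+1} T_k f up
       -- to a symmetric factor.
       pair : s (weight w k * a * V (w ++ k ∷ []) + weight w (suc k) * b * V (w ++ suc k ∷ [])) ≈ weight w k * a * V (w ++ k ∷ []) + weight w (suc k) * b * V (w ++ suc k ∷ [])
       pair = trans (⟦⟧-cong factor) (trans (*-homo _ _) (trans (*-cong (s-weight w k) (↝⇒symmetric exchange)) (sym factor)))
     last (opN-exchangeable {V} ex) w u v w≡ dw k+1∉v =
       sumTo-∼ _↝_ ↝-0 ↝-+ ↝-cong k generic pair N 1+k<N
       where
       term term' : ℕ → Carrier
       term c = weight w c * x c * V (w ++ c ∷ [])
       term' c = weight (map σ w) c * x c * V (map σ w ++ c ∷ [])
       dw' : Distinct (map σ w)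
       dw' = Distinct-σ k {w} dw
       vanish : ∀ w' c → mult c w' ≡ 1 → weight w' c * x c * V (w' ++ c ∷ []) ≈ 0#
       vanish w' c old = trans (*-congʳ (trans (*-congʳ (weight-old w' c old)) (zeroˡ _))) (zeroˡ _)
       mult-fixed : ∀ {c} → c ≢ k → c ≢ suc k → mult c (map σ w) ≡ mult c w
       mult-fixed {c} p q = ≡.trans (≡.cong (λ z → mult z (map σ w)) (≡.sym (σ-other k p q))) (mult-σ k c w)
       mult-k' : mult k (map σ w) ≡ mult (suc k) w
       mult-k' = ≡.trans (≡.cong (λ z → mult z (map σ w)) (≡.sym (σ-suc k))) (mult-σ k (suc k) w)
       mult-k+1' : mult (suc k) (map σ w) ≡ mult k w
       mult-k+1' = ≡.trans (≡.cong (λ z → mult z (map σ w)) (≡.sym (σ-k k))) (mult-σ k k w)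
       mult-k : mult k w ≡ 1
       mult-k with mult-0-or-1 {w} dw k
       ... | inj₂ p = p
       ... | inj₁ p = ⊥-elim (ℕP.1+n≢0 (≡.trans (≡.sym (≡.trans (≡.cong (mult k) w≡) (≡.trans (mult-++ k u (k ∷ v)) (≡.trans (≡.cong (mult k u ℕ.+_) (mult-self k v)) (ℕP.+-suc _ _))))) p))
       generic : ∀ c → c ≢ k → c ≢ suc k → term c ↝ term' c
       generic c c≢k c≢k+1 with mult-0-or-1 {w} dw c
       ... | inj₂ old = ↝-cong (sym (vanish w c old)) (sym (vanish (map σ w) c (≡.trans (mult-fixed c≢k c≢k+1) old))) ↝-0
       ... | inj₁ new = ↝-cong refl
               (*-cong (*-congʳ (reflexive (≡.sym (≡.cong₂ (λ m n → t⁻¹ ^ m * (1# - t * t⁻¹ ^ n)) (below-σ k c≢k+1 w) (mult-fixed c≢k c≢k+1)))))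
                       (reflexive (≡.cong V (≡.trans (ListP.map-++ σ w (c ∷ [])) (≡.cong (λ z → map σ w ++ z ∷ []) (σ-other k c≢k c≢k+1))))))
               (↝-* (trans (*-homo _ _) (*-cong (s-weight w c) (s-x c≢k c≢k+1)))
                 (last ex (w ++ c ∷ []) u (v ++ c ∷ []) (≡.trans (≡.cong (_++ c ∷ []) w≡) (ListP.++-assoc u (k ∷ v) (c ∷ [])))
                   (Distinct-snoc {w} dw new) (≡.trans (mult-snoc-≢ v c≢k+1) k+1∉v)))
       -- Colour `k` is old in w and `suc k` is old in its image, so one term survives on either
       -- side.
       pair : term k + term (suc k) ↝ term' k + term' (suc k)
       pair = ↝-cong (sym (trans (+-congʳ (vanish w k mult-k)) (+-identityˡ _)))
                     (sym (trans (+-congˡ (vanish (map σ w) (suc k) (≡.trans mult-k+1' mult-k))) (+-identityʳ _)))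
                     main
         where
         -- The appended `suc k` now comes last, the wrong way round for `last`. That field is
         -- applied to the mirror window `w'` instead, and `↝-braid` inverts the result at the cost
         -- of a factor t. The weights absorb it: one colour more of w lies below `suc k` than below
         -- `k`.
         main : term (suc k) ↝ term' k
         main with mult-0-or-1 {w} dw (suc k)
         ... | inj₂ old = ↝-cong (sym (vanish w (suc k) old)) (sym (vanish (map σ w) k (≡.trans mult-k' old))) ↝-0
         ... | inj₁ new = ↝-cong left right (↝-* {c = t⁻¹ ^ suc (below k w) * (1# - t)} (trans (*-homo _ _) (*-cong (s-^ s-t⁻¹ (suc (below k w))) s-1-t)) (↝-braid exchange))
           where
           w' = map σ w ++ k ∷ []
           σw' : map σ w' ≡ w ++ suc k ∷ []
           σw' = ≡.trans (ListP.map-++ σ (map σ w) (k ∷ [])) (≡.cong₂ _++_ (σσ-map k w) (≡.cong (_∷ []) (σ-k k)))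
           exchange : V w' ↝ V (w ++ suc k ∷ [])
           exchange = ↝-cong refl (reflexive (≡.cong V σw')) (last ex w' (map σ w) [] ≡.refl (Distinct-snoc {map σ w} dw' (≡.trans mult-k' new)) ≡.refl)
           left : t⁻¹ ^ suc (below k w) * (1# - t) * (b * V (w ++ suc k ∷ [])) ≈ term (suc k)
           left = trans (sym (*-assoc _ _ _)) (*-congʳ (*-congʳ (sym (trans (weight-new w (suc k) new)
             (*-congʳ (reflexive (≡.cong (t⁻¹ ^_) (≡.trans (below-suc k w) (≡.trans (≡.cong (below k w ℕ.+_) mult-k) (ℕP.+-comm _ 1))))))))))
           right : t⁻¹ ^ suc (below k w) * (1# - t) * (t * a * V w') ≈ term' k
           right = begin
             t⁻¹ * t⁻¹ ^ below k w * (1# - t) * (t * a * V w')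
               ≈⟨ solve 6 (λ i p o t a v → i :* p :* o :* (t :* a :* v) := (t :* i) :* (p :* o :* a :* v)) refl t⁻¹ (t⁻¹ ^ below k w) (1# - t) t a (V w') ⟩
             t * t⁻¹ * (t⁻¹ ^ below k w * (1# - t) * a * V w')  ≈⟨ trans (*-congʳ t*t⁻¹) (*-identityˡ _) ⟩
             t⁻¹ ^ below k w * (1# - t) * a * V w'
               ≈⟨ *-congʳ (*-congʳ (sym (trans (weight-new (map σ w) k (≡.trans mult-k' new)) (*-congʳ (reflexive (≡.cong (t⁻¹ ^_) (below-σ k (λ ()) w))))))) ⟩
             weight (map σ w) k * a * V w'  ∎

     opM-exchangeable : ∀ {V} → Exchangeable V → Exchangeable (opM V)
     free (opM-exchangeable ex) w dw p q = trans (*-homo _ _) (*-cong s-t (trans (+-homo _ _)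
       (+-cong (free (opN-exchangeable (opE-exchangeable ex)) w dw p q) (trans (-‿homo _) (-‿cong (free (opE-exchangeable (opN-exchangeable ex)) w dw p q))))))
     last (opM-exchangeable ex) w u v w≡ dw q = ↝-* s-t (↝-+ (last (opN-exchangeable (opE-exchangeable ex)) w u v w≡ dw q)
       (↝-cong (neg _) (neg _) (↝-* (trans (-‿homo 1#) (-‿cong 1#-homo)) (last (opE-exchangeable (opN-exchangeable ex)) w u v w≡ dw q))))
       where
       neg : ∀ f → - 1# * f ≈ - f
       neg f = solve 1 (λ f → :- con (+ 1) :* f := :- f) refl f

     family-exchangeable : ∀ es → Exchangeable (family es)
     family-exchangeable [] = record { free = λ _ _ _ _ → 1#-homo ; last = λ _ _ _ _ _ _ → ↝-symmetric 1#-homo }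
     family-exchangeable (evE ∷ es) = opE-exchangeable (family-exchangeable es)
     family-exchangeable (evN ∷ es) = opN-exchangeable (family-exchangeable es)
     family-exchangeable (evM ∷ es) = opM-exchangeable (family-exchangeable es)

 module _ {t t⁻¹ : Carrier} (t*t⁻¹ : t * t⁻¹ ≈ 1#) (x y : ℕ → Carrier) (N : ℕ) {θ : Carrier → Carrier}
          (isHom : RingMorphisms.IsRingHomomorphism rawRing rawRing θ)
          (θ-t : θ t ≈ t) (θ-t⁻¹ : θ t⁻¹ ≈ t⁻¹) (θ-x : ∀ c → c < N → θ (x c) ≈ y c) where
   open RingMorphisms.IsRingHomomorphism isHom
   private
     module X = Windows t t⁻¹ t*t⁻¹ x N
     module Y = Windows t t⁻¹ t*t⁻¹ y N
     opN-θ : ∀ {V V' : X.Family} → (∀ w → θ (V w) ≈ V' w) → ∀ w → θ (X.opN V w) ≈ Y.opN V' w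
     opN-θ = X.opN-hom y isHom θ-t θ-t⁻¹ θ-x

   family-hom : ∀ es w → θ (X.family es w) ≈ Y.family es w
   family-hom [] w = 1#-homo
   family-hom (evE ∷ es) w = family-hom es (drop 1 w)
   family-hom (evN ∷ es) w = opN-θ (family-hom es) w
   family-hom (evM ∷ es) w = trans (*-homo _ _) (*-cong θ-t (trans (+-homo _ _) (+-cong (opN-θ (λ w → family-hom es (drop 1 w)) w)
     (trans (-‿homo _) (-‿cong (opN-θ (family-hom es) (drop 1 w)))))))

-- The series Ω[(1 - t)uZ] in finitely many variables

module Sequences (R : CommutativeRing 0ℓ 0ℓ) where
 open CommutativeRing R hiding (zero)
 open IntegerSolver R
 open OverRing R
 open import Algebra.Properties.Semiring.Exp semiring using (_^_)
 open import Algebra.Properties.CommutativeSemiring.Exp commutativeSemiring using (^-distrib-*)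
 open import Algebra.Properties.Semiring.Mult semiring using () renaming (_×_ to _·_)
 open import Relation.Binary.Reasoning.Setoid setoid

 Seq : Set
 Seq = ℕ → Carrier

 -- The coefficient of u^m in the product of the series Σ a_j u^(j+1) and Σ q_j u^j. Index j of a
 -- sequence of power sums stands for degree j + 1, as in the recursion behind `Hlist`.
 conv : Seq → Seq → Seq
 conv a q zero = 0#
 conv a q (suc m) = a 0 * q m + conv (a ∘ suc) q m

 conv-cong : ∀ {a a' q q'} → (∀ j → a j ≈ a' j) → (∀ j → q j ≈ q' j) → ∀ m → conv a q m ≈ conv a' q' m
 conv-cong ha hq zero = refl
 conv-cong ha hq (suc m) = +-cong (*-cong (ha 0) (hq m)) (conv-cong (ha ∘ suc) hq m)

 conv-+ : ∀ a a' q m → conv (λ j → a j + a' j) q m ≈ conv a q m + conv a' q m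
 conv-+ a a' q zero = sym (+-identityʳ 0#)
 conv-+ a a' q (suc m) = trans (+-congˡ (conv-+ (a ∘ suc) (a' ∘ suc) q m))
   (solve 5 (λ a a' q c c' → (a :+ a') :* q :+ (c :+ c') := (a :* q :+ c) :+ (a' :* q :+ c')) refl (a 0) (a' 0) (q m) _ _)

 conv-* : ∀ c a q m → conv (λ j → c * a j) q m ≈ c * conv a q m
 conv-* c a q zero = sym (zeroʳ c)
 conv-* c a q (suc m) = trans (+-cong (*-assoc _ _ _) (conv-* c (a ∘ suc) q m)) (sym (distribˡ _ _ _))

 powers : Carrier → Seq
 powers z j = z ^ suc j

 conv-powers : ∀ z q m → conv (powers z) q (suc m) ≈ z * (q m + conv (powers z) q m)
 conv-powers z q m = trans (+-cong (*-congʳ (*-identityʳ z)) (conv-* z (powers z) q m)) (sym (distribˡ _ _ _))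

 dot : List Carrier → Seq → Carrier
 dot [] f = 0#
 dot (u ∷ us) f = u * f 0 + dot us (f ∘ suc)

 module WithParameter (t : Carrier) where

  -- Multiplication of the generating series of q by (1 - t z u) / (1 - z u).
  extend : Carrier → Seq → Seq
  extend z q zero = q zero
  extend z q (suc m) = z * extend z q m + (q (suc m) - t * z * q m)

  -- Multiplication by the series of a commutes with multiplication by (1 - tzu)/(1 - zu), so
  -- convolutions inherit the recursion of `extend`.
  conv-extend : ∀ z a q m → conv a (extend z q) (suc m) ≈ z * conv a (extend z q) m + (conv a q (suc m) - t * z * conv a q m)
  conv-extend z a q zero = solve 4 (λ z t a q → a :* q :+ con (+ 0) := z :* con (+ 0) :+ (a :* q :+ con (+ 0) :- t :* z :* con (+ 0))) refl z t (a 0) (q 0)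
  conv-extend z a q (suc m) = trans (+-congˡ (conv-extend z (a ∘ suc) q m))
    (solve 9 (λ z t a q' q₁ q₀ c' c₁ c₀ →
        a :* (z :* q' :+ (q₁ :- t :* z :* q₀)) :+ (z :* c' :+ (c₁ :- t :* z :* c₀))
        := z :* (a :* q' :+ c') :+ (a :* q₁ :+ c₁ :- t :* z :* (a :* q₀ :+ c₀)))
      refl z t (a 0) (extend z q m) (q (suc m)) (q m) (conv (a ∘ suc) (extend z q) m) (conv (a ∘ suc) q (suc m)) (conv (a ∘ suc) q m))

  -- The equation u dq/du = p q of generating series, whose solutions are the multiples of exp Σ p_k
  -- u^k / k.
  Newton : Seq → Seq → Set
  Newton p q = ∀ m → (m · 1#) * q m ≈ conv p q m

  Newton-cong : ∀ {p p' q} → (∀ j → p j ≈ p' j) → Newton p q → Newton p' q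
  Newton-cong h nw m = trans (nw m) (conv-cong h (λ _ → refl) m)

  -- The logarithmic derivative turns the new factor (1 - tzu)/(1 - zu) into the summand Σ (z^k -
  -- (tz)^k) u^k.
  Newton-extend : ∀ z {p q} → Newton p q → Newton (λ j → p j + (powers z j + - 1# * powers (t * z) j)) (extend z q)
  Newton-extend z {p} {q} nw m = trans (main m) (sym (split m))
    where
    q' = extend z q
    A B C : Seq
    A = conv p q'
    B = conv (powers z) q'
    C = conv (powers (t * z)) q'
    split : ∀ m → conv (λ j → p j + (powers z j + - 1# * powers (t * z) j)) q' m ≈ A m + (B m - C m)
    split m = trans (conv-+ p _ q' m) (+-congˡ (trans (conv-+ (powers z) _ q' m) (+-congˡ (trans (conv-* (- 1#) _ q' m)
      (solve 1 (λ c → :- con (+ 1) :* c := :- c) refl (C m))))))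
    -- The numerator 1 - tzu of the new factor cancels the geometric series of tz, which leaves a
    -- recursion with ratio z.
    C-suc : ∀ m → C (suc m) ≈ z * C m + t * z * q m
    C-suc m = trans (conv-extend z (powers (t * z)) q m) (+-congˡ (trans (+-congʳ (conv-powers (t * z) q m))
      (solve 3 (λ y q c → y :* (q :+ c) :- y :* c := y :* q) refl (t * z) (q m) (conv (powers (t * z)) q m))))
    main : ∀ m → (m · 1#) * q' m ≈ A m + (B m - C m)
    main zero = solve 1 (λ q → con (+ 0) :* q := con (+ 0) :+ (con (+ 0) :- con (+ 0))) refl (q' 0)
    main (suc m) = begin
      (1# + n) * (z * q' m + (q (suc m) - t * z * q m))
        ≈⟨ solve 6 (λ n z t q' q₁ q₀ → (con (+ 1) :+ n) :* (z :* q' :+ (q₁ :- t :* z :* q₀))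
             := z :* (n :* q') :+ ((con (+ 1) :+ n) :* q₁ :- t :* z :* (n :* q₀)) :+ z :* q' :- t :* z :* q₀) refl n z t (q' m) (q (suc m)) (q m) ⟩
      z * (n * q' m) + ((1# + n) * q (suc m) - t * z * (n * q m)) + z * q' m - t * z * q m
        ≈⟨ +-congʳ (+-congʳ (+-cong (*-congˡ (main m)) (+-cong (nw (suc m)) (-‿cong (*-congˡ (nw m)))))) ⟩
      z * (A m + (B m - C m)) + (conv p q (suc m) - t * z * conv p q m) + z * q' m - t * z * q m
        ≈⟨ solve 9 (λ z t A B C c₁ c₀ q' q₀ → z :* (A :+ (B :- C)) :+ (c₁ :- t :* z :* c₀) :+ z :* q' :- t :* z :* q₀
             := (z :* A :+ (c₁ :- t :* z :* c₀)) :+ (z :* (q' :+ B) :- (z :* C :+ t :* z :* q₀)))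
             refl z t (A m) (B m) (C m) (conv p q (suc m)) (conv p q m) (q' m) (q m) ⟩
      (z * A m + (conv p q (suc m) - t * z * conv p q m)) + (z * (q' m + B m) - (z * C m + t * z * q m))
        ≈⟨ sym (+-cong (conv-extend z p q m) (+-cong (conv-powers z q' m) (-‿cong (C-suc m)))) ⟩
      A (suc m) + (B (suc m) - C (suc m))  ∎
      where n = m · 1#

  module Alphabet (x : ℕ → Carrier) where

   δ : Seq
   δ zero = 1#
   δ (suc m) = 0#

   -- complete r n m is h_m[(1 - t)(x_r + ⋯ + x_{r+n-1})].
   complete : ℕ → ℕ → Seq
   complete r zero = δ
   complete r (suc n) = extend (x (r ℕ.+ n)) (complete r n)

   complete-0 : ∀ r n → complete r n 0 ≡ 1#
   complete-0 r zero = ≡.refl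
   complete-0 r (suc n) = complete-0 r n

   powerSum : ℕ → ℕ → Seq
   powerSum r n k = sumTo n (λ i → x (r ℕ.+ i) ^ k)

   complete-Newton : ∀ r n → Newton (λ j → (1# - t ^ suc j) * powerSum r n (suc j)) (complete r n)
   complete-Newton r zero m = trans (lemma m) (sym (trans (conv-cong (λ j → trans (zeroʳ _) (sym (zeroˡ 0#))) (λ _ → refl) m) (trans (conv-* 0# (λ _ → 0#) δ m) (zeroˡ _))))
     where
     lemma : ∀ m → (m · 1#) * δ m ≈ 0#
     lemma zero = zeroˡ _
     lemma (suc m) = zeroʳ _
   complete-Newton r (suc n) = Newton-cong
     (λ j → trans (+-congˡ (+-congˡ (*-congˡ (^-distrib-* t z (suc j)))))
       (solve 3 (λ T p Z → (con (+ 1) :- T) :* p :+ (Z :+ :- con (+ 1) :* (T :* Z)) := (con (+ 1) :- T) :* (p :+ Z)) refl (t ^ suc j) (powerSum r n (suc j)) (z ^ suc j)))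
     (Newton-extend z (complete-Newton r n))
     where z = x (r ℕ.+ n)

   -- The image of (1 - t) x_r^m under n successive operators t T⁻¹. In positive degree it is a
   -- difference of consecutive `complete` functions. In degree zero that difference would vanish,
   -- whereas t T⁻¹ multiplies constants by t; hence the geometric value there.
   increment : ℕ → ℕ → Seq
   increment r n zero = (1# - t) * t ^ n
   increment r n (suc m) = complete r (suc n) (suc m) - complete r n (suc m)

   increment-first : ∀ r m → increment r 0 m ≈ (1# - t) * x (r ℕ.+ 0) ^ m
   increment-first r zero = refl
   increment-first r (suc zero) = solve 2 (λ z t → z :* con (+ 1) :+ (con (+ 0) :- t :* z :* con (+ 1)) :- con (+ 0) := (con (+ 1) :- t) :* (z :* con (+ 1))) refl (x (r ℕ.+ 0)) t
   increment-first r (suc (suc m)) = begin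
     z * e + (0# - t * z * 0#) - 0#  ≈⟨ solve 3 (λ z t e → z :* e :+ (con (+ 0) :- t :* z :* con (+ 0)) :- con (+ 0) := z :* (e :- con (+ 0))) refl z t e ⟩
     z * (e - 0#)                    ≈⟨ *-congˡ (increment-first r (suc m)) ⟩
     z * ((1# - t) * z ^ suc m)      ≈⟨ solve 3 (λ z t p → z :* ((con (+ 1) :- t) :* p) := (con (+ 1) :- t) :* (z :* p)) refl z t (z ^ suc m) ⟩
     (1# - t) * z ^ suc (suc m)      ∎
     where
     z = x (r ℕ.+ 0)
     e = complete r 1 (suc m)

   -- Positive degrees telescope. In degree zero the geometric sum is 1 - t^n, which falls short of
   -- h_0 = 1 by the term with `δ`.
   increment-sum : ∀ r n m → sumTo n (λ i → increment r i m) + t ^ n * δ m ≈ complete r n m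
   increment-sum r zero zero = trans (+-identityˡ _) (*-identityˡ _)
   increment-sum r zero (suc m) = trans (+-identityˡ _) (*-identityˡ _)
   increment-sum r (suc n) zero = trans
     (solve 3 (λ s t p → s :+ (con (+ 1) :- t) :* p :+ t :* p :* con (+ 1) := s :+ p :* con (+ 1)) refl (sumTo n (λ i → increment r i 0)) t (t ^ n))
     (increment-sum r n zero)
   increment-sum r (suc n) (suc m) = trans
     (solve 5 (λ s u v t p → s :+ (u :- v) :+ t :* p :* con (+ 0) := s :+ p :* con (+ 0) :+ (u :- v)) refl
        (sumTo n (λ i → increment r i (suc m))) (complete r (suc n) (suc m)) (complete r n (suc m)) t (t ^ n))
     (trans (+-congʳ (increment-sum r n (suc m)))
       (solve 2 (λ u v → v :+ (u :- v) := u) refl (complete r (suc n) (suc m)) (complete r n (suc m))))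

   module Symmetry {t⁻¹ : Carrier} {k : ℕ} {s : Carrier → Carrier} (isTransposition : IsTransposition t t⁻¹ x k s) where
    open Transposition isTransposition

    s-extend : ∀ {z q} → s z ≈ z → (∀ m → s (q m) ≈ q m) → ∀ m → s (extend z q m) ≈ extend z q m
    s-extend sz sq zero = sq 0
    s-extend sz sq (suc m) = trans (+-homo _ _) (+-cong (trans (*-homo _ _) (*-cong sz (s-extend sz sq m)))
      (trans (+-homo _ _) (+-cong (sq (suc m)) (trans (-‿homo _) (-‿cong (trans (*-homo _ _) (*-cong (trans (*-homo _ _) (*-cong s-t sz)) (sq m))))))))

    s-complete : ∀ r n → r ℕ.+ n ≤ k → ∀ m → s (complete r n m) ≈ complete r n m
    s-complete r zero _ zero = 1#-homo
    s-complete r zero _ (suc m) = 0#-homo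
    s-complete r (suc n) r+n<k = s-extend (s-x (ℕP.<⇒≢ r+n<k') (ℕP.<⇒≢ (ℕP.m<n⇒m<1+n r+n<k'))) (s-complete r n (ℕP.<⇒≤ r+n<k'))
      where
      r+n<k' : r ℕ.+ n < k
      r+n<k' = ≡.subst (_≤ k) (ℕP.+-suc r n) r+n<k

    module _ (q : Seq) (sq : ∀ m → s (q m) ≈ q m) where
     private
      q' q'' : Seq
      q' = extend a q
      q'' = extend b q'

     -- As series, q' - q is q times (1 - t)au/(1 - au), and q'' - q' is q times (1 - t)bu/(1 - bu)
     -- times (1 - tau)/(1 - au). Since s fixes q and exchanges a and b, the claim is an identity of
     -- rational functions, which the induction verifies degree by degree.
     extend-⇝ : ∀ m → q' m - q m ⇝ q'' m - q' m
     extend-⇝ zero = trans (trans (*-congˡ (-‿inverseʳ _)) ↝-0) (sym (+-cong (*-congˡ (-‿inverseʳ _)) (*-congˡ (⟦⟧-cong (-‿inverseʳ _)))))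
     extend-⇝ (suc m) = begin
       (a - b) * (b * q'' m + (q' (suc m) - t * b * q' m) - q' (suc m))
         ≈⟨ solve 7 (λ a b t Q₀ Q₁ Q₂ u → (a :- b) :* (b :* Q₂ :+ (u :- t :* b :* Q₁) :- u)
              := b :* ((a :- b) :* (Q₂ :- Q₁)) :+ (a :- b) :* (con (+ 1) :- t) :* b :* Q₁) refl a b t (q m) (q' m) (q'' m) (q' (suc m)) ⟩
       b * ((a - b) * (q'' m - q' m)) + (a - b) * (1# - t) * b * q' m
         ≈⟨ +-congʳ (*-congˡ (extend-⇝ m)) ⟩
       b * ((1# - t) * b * (q' m - q m) + (t * a - b) * s (q' m - q m)) + (a - b) * (1# - t) * b * q' m
         ≈⟨ +-congʳ (*-congˡ (+-congˡ (*-congˡ (trans (+-homo _ _) (+-congˡ (trans (-‿homo _) (-‿cong (sq m)))))))) ⟩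
       b * ((1# - t) * b * (q' m - q m) + (t * a - b) * (s (q' m) - q m)) + (a - b) * (1# - t) * b * q' m
         ≈⟨ solve 7 (λ a b t Q₀ Q₁ S u → b :* ((con (+ 1) :- t) :* b :* (Q₁ :- Q₀) :+ (t :* a :- b) :* (S :- Q₀)) :+ (a :- b) :* (con (+ 1) :- t) :* b :* Q₁
              := (con (+ 1) :- t) :* b :* (a :* Q₁ :+ (u :- t :* a :* Q₀) :- u) :+ (t :* a :- b) :* (b :* S :+ (u :- t :* b :* Q₀) :- u))
              refl a b t (q m) (q' m) (s (q' m)) (q (suc m)) ⟩
       (1# - t) * b * (q' (suc m) - q (suc m)) + (t * a - b) * (b * s (q' m) + (q (suc m) - t * b * q m) - q (suc m))
         ≈⟨ +-congˡ (*-congˡ (sym (trans (+-homo _ _) (+-cong (trans (+-homo _ _)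
              (+-cong (trans (*-homo _ _) (*-congʳ s-xₖ)) (trans (+-homo _ _) (+-cong (sq (suc m)) (trans (-‿homo _) (-‿cong (trans (*-homo _ _) (*-cong (trans (*-homo _ _) (*-cong s-t s-xₖ)) (sq m)))))))))
              (trans (-‿homo _) (-‿cong (sq (suc m)))))))) ⟩
       (1# - t) * b * (q' (suc m) - q (suc m)) + (t * a - b) * s (q' (suc m) - q (suc m))  ∎

    increment-⇝ : ∀ r n → r ℕ.+ n ≡ k → ∀ m → increment r n m ⇝ increment r (suc n) m
    increment-⇝ r n ≡.refl zero = begin
      (a - b) * ((1# - t) * (t * t ^ n))
        ≈⟨ solve 4 (λ a b t p → (a :- b) :* ((con (+ 1) :- t) :* (t :* p)) := (con (+ 1) :- t) :* b :* ((con (+ 1) :- t) :* p) :+ (t :* a :- b) :* ((con (+ 1) :- t) :* p)) refl a b t (t ^ n) ⟩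
      (1# - t) * b * ((1# - t) * t ^ n) + (t * a - b) * ((1# - t) * t ^ n)
        ≈⟨ +-congˡ (*-congˡ (sym (trans (*-homo _ _) (*-cong s-1-t (s-^ s-t n))))) ⟩
      (1# - t) * b * ((1# - t) * t ^ n) + (t * a - b) * s ((1# - t) * t ^ n)  ∎
    increment-⇝ r n ≡.refl (suc m) = ≡.subst (λ c → complete r (suc n) (suc m) - complete r n (suc m) ⇝ extend (x c) (complete r (suc n)) (suc m) - complete r (suc n) (suc m))
      (≡.sym (ℕP.+-suc r n)) (extend-⇝ (complete r n) (s-complete r n ℕP.≤-refl) (suc m))

    dot-⇝ : ∀ us {f g} → All (λ u → s u ≈ u) us → (∀ j → f j ⇝ g j) → dot us f ⇝ dot us g
    dot-⇝ [] [] h = ↝-0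
    dot-⇝ (u ∷ us) (su ∷ sus) h = ↝-+ (↝-* su (h 0)) (dot-⇝ us sus (h ∘ suc))

-- Evaluation of polynomials and of the operators d₊ and d₋

getE-setE : ∀ xs i v → getE (setE xs i v) i ≡ v
getE-setE [] zero v = ≡.refl
getE-setE [] (suc i) v = getE-setE [] i v
getE-setE (e ∷ xs) zero v = ≡.refl
getE-setE (e ∷ xs) (suc i) v = getE-setE xs i v

getE-setE-≢ : ∀ xs {i j} v → i ≢ j → getE (setE xs i v) j ≡ getE xs j
getE-setE-≢ [] {zero} {zero} v i≢j = ⊥-elim (i≢j ≡.refl)
getE-setE-≢ [] {zero} {suc j} v i≢j = ≡.refl
getE-setE-≢ [] {suc i} {zero} v i≢j = ≡.refl
getE-setE-≢ [] {suc i} {suc j} v i≢j = getE-setE-≢ [] v (i≢j ∘ ≡.cong suc)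
getE-setE-≢ (e ∷ xs) {zero} {zero} v i≢j = ⊥-elim (i≢j ≡.refl)
getE-setE-≢ (e ∷ xs) {zero} {suc j} v i≢j = ≡.refl
getE-setE-≢ (e ∷ xs) {suc i} {zero} v i≢j = ≡.refl
getE-setE-≢ (e ∷ xs) {suc i} {suc j} v i≢j = getE-setE-≢ xs v (i≢j ∘ ≡.cong suc)

setE-comm : ∀ xs k u v → setE (setE xs k u) (suc k) v ≡ setE (setE xs (suc k) v) k u
setE-comm [] zero u v = ≡.refl
setE-comm [] (suc k) u v = ≡.cong (0 ∷_) (setE-comm [] k u v)
setE-comm (e ∷ xs) zero u v = ≡.refl
setE-comm (e ∷ xs) (suc k) u v = ≡.cong (e ∷_) (setE-comm xs k u v)

infix 4 _~_
_~_ : List ℕ → List ℕ → Set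
xs ~ ys = ∀ i → getE xs i ≡ getE ys i

-- `κ c n` stands for the scalar c t^n. The field `κ-reciprocal` answers the division by m in
-- `Hlist`.
record Scalars : Set₁ where
  field
    ring : CommutativeRing 0ℓ 0ℓ
  open CommutativeRing ring public hiding (ring; zero)
  field
    κ : ℚ → ℤ → Carrier
    κ-1 : κ 1ℚ (+ 0) ≈ 1#
    κ-* : ∀ c c' m n → κ (c ℚ.* c') (m ℤ.+ n) ≈ κ c m * κ c' n
    κ-neg : ∀ c n → κ (ℚ.- c) n ≈ - κ c n
    κ-reciprocal : ∀ m → κ (+ 1 ℚ./ suc m) (+ 0) * RawMonoid._×_ +-rawMonoid (suc m) 1# ≈ 1#

  τ : ℤ → Carrier
  τ = κ 1ℚ

  t t⁻¹ : Carrier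
  t = τ (+ 1)
  t⁻¹ = τ -[1+ 0 ]

-- What the argument uses of a polynomial ring: variables exchanged by adjacent swaps, and
-- homomorphisms that give them prescribed values. Polynomials are evaluated into such a ring, so
-- that the computations concern ring elements instead of lists; `polyTarget` supplies the
-- polynomials themselves as values.
record Target : Set₁ where
  field
    scalars : Scalars
  open Scalars scalars public
  field
    var : ℕ → Carrier
    swap : ℕ → Carrier → Carrier
    swap-κ : ∀ k c n → swap k (κ c n) ≈ κ c n
    swap-isTransposition : ∀ k → OverRing.IsTransposition ring t t⁻¹ var k (swap k)
    subst : (ℕ → Carrier) → Carrier → Carrier
    subst-isHom : ∀ y → RingMorphisms.IsRingHomomorphism rawRing rawRing (subst y)
    subst-κ : ∀ y c n → subst y (κ c n) ≈ κ c n
    subst-var : ∀ y i → subst y (var i) ≈ y i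

module Evaluation (𝕊 : Scalars) where
 open Scalars 𝕊
 open IntegerSolver ring
 open OverRing ring
 open Sequences ring
 open import Algebra.Properties.Semiring.Exp semiring using (_^_; ^-homo-*; ^-congˡ)
 open import Algebra.Properties.CommutativeSemigroup *-commutativeSemigroup using () renaming (interchange to *-interchange)
 open import Algebra.Properties.Ring (CommutativeRing.ring ring) using (-0#≈0#)
 open import Relation.Binary.Reasoning.Setoid setoid

 τ-+ : ∀ m n → τ (m ℤ.+ n) ≈ τ m * τ n
 τ-+ m n = trans (reflexive (≡.cong (λ c → κ c (m ℤ.+ n)) (≡.sym (ℚP.*-identityˡ 1ℚ)))) (κ-* 1ℚ 1ℚ m n)

 t*t⁻¹ : t * t⁻¹ ≈ 1#
 t*t⁻¹ = trans (sym (τ-+ (+ 1) -[1+ 0 ])) κ-1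

 τ-+^ : ∀ n → τ (+ n) ≈ t ^ n
 τ-+^ zero = κ-1
 τ-+^ (suc n) = trans (τ-+ (+ 1) (+ n)) (*-congˡ (τ-+^ n))

 τ-^ : ∀ n → τ (ℤ.- + n) ≈ t⁻¹ ^ n
 τ-^ zero = κ-1
 τ-^ (suc zero) = sym (*-identityʳ t⁻¹)
 τ-^ (suc (suc n)) = trans (τ-+ -[1+ 0 ] -[1+ n ]) (*-congˡ (τ-^ (suc n)))

 prodE : (ℕ → Carrier) → List ℕ → Carrier
 prodE f [] = 1#
 prodE f (e ∷ es) = f 0 ^ e * prodE (f ∘ suc) es

 prodE-addE : ∀ f xs ys → prodE f (addE xs ys) ≈ prodE f xs * prodE f ys
 prodE-addE f [] ys = sym (*-identityˡ _)
 prodE-addE f (x ∷ xs) [] = sym (*-identityʳ _)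
 prodE-addE f (x ∷ xs) (y ∷ ys) = trans (*-cong (^-homo-* (f 0) x y) (prodE-addE (f ∘ suc) xs ys)) (*-interchange _ _ _ _)

 prodE-cong : ∀ {f g} es → (∀ i → f i ^ getE es i ≈ g i ^ getE es i) → prodE f es ≈ prodE g es
 prodE-cong [] h = refl
 prodE-cong (e ∷ es) h = *-cong (h 0) (prodE-cong es (h ∘ suc))

 prodE-~ : ∀ f xs ys → xs ~ ys → prodE f xs ≈ prodE f ys
 prodE-~ f [] [] h = refl
 prodE-~ f [] (y ∷ ys) h = trans (prodE-~ (f ∘ suc) [] ys (h ∘ suc)) (trans (sym (*-identityˡ _)) (*-congʳ (reflexive (≡.cong (f 0 ^_) (h 0)))))
 prodE-~ f (x ∷ xs) [] h = trans (*-cong (reflexive (≡.cong (f 0 ^_) (h 0))) (prodE-~ (f ∘ suc) xs [] (h ∘ suc))) (*-identityˡ _)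
 prodE-~ f (x ∷ xs) (y ∷ ys) h = *-cong (reflexive (≡.cong (f 0 ^_) (h 0))) (prodE-~ (f ∘ suc) xs ys (h ∘ suc))

 prodE-setE : ∀ f es i v → prodE f (setE es i v) ≈ f i ^ v * prodE f (setE es i 0)
 prodE-setE f [] zero v = *-congˡ (sym (*-identityˡ 1#))
 prodE-setE f [] (suc i) v = trans (*-identityˡ _) (trans (prodE-setE (f ∘ suc) [] i v) (*-congˡ (sym (*-identityˡ _))))
 prodE-setE f (e ∷ es) zero v = *-congˡ (sym (*-identityˡ _))
 prodE-setE f (e ∷ es) (suc i) v = trans (*-congˡ (prodE-setE (f ∘ suc) es i v))
   (solve 3 (λ p q r → p :* (q :* r) := q :* (p :* r)) refl (f 0 ^ e) (f (suc i) ^ v) (prodE (f ∘ suc) (setE es i 0)))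

 prodE-getE : ∀ f es i → prodE f es ≈ f i ^ getE es i * prodE f (setE es i 0)
 prodE-getE f [] zero = solve 0 (con (+ 1) := con (+ 1) :* (con (+ 1) :* con (+ 1))) refl
 prodE-getE f [] (suc i) = trans (prodE-getE (f ∘ suc) [] i) (*-congˡ (sym (*-identityˡ _)))
 prodE-getE f (e ∷ es) zero = *-congˡ (sym (*-identityˡ _))
 prodE-getE f (e ∷ es) (suc i) = trans (*-congˡ (prodE-getE (f ∘ suc) es i))
   (solve 3 (λ p q r → p :* (q :* r) := q :* (p :* r)) refl (f 0 ^ e) (f (suc i) ^ getE es i) (prodE (f ∘ suc) (setE es i 0)))

 without : ℕ → List ℕ → List ℕ
 without k xe = setE (setE xe k 0) (suc k) 0

 prodE-split : ∀ f k xe → prodE f xe ≈ f k ^ getE xe k * f (suc k) ^ getE xe (suc k) * prodE f (without k xe)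
 prodE-split f k xe = trans (prodE-getE f xe k) (trans (*-congˡ (trans (prodE-getE f (setE xe k 0) (suc k))
   (*-congʳ (reflexive (≡.cong (f (suc k) ^_) (getE-setE-≢ xe 0 (λ ()))))))) (sym (*-assoc _ _ _)))

 prodE-setE₂ : ∀ f k xe u v → prodE f (setE (setE xe k u) (suc k) v) ≈ f k ^ u * f (suc k) ^ v * prodE f (without k xe)
 prodE-setE₂ f k xe u v = begin
   prodE f (setE (setE xe k u) (suc k) v)                    ≈⟨ prodE-setE f (setE xe k u) (suc k) v ⟩
   f (suc k) ^ v * prodE f (setE (setE xe k u) (suc k) 0)    ≈⟨ *-congˡ (reflexive (≡.cong (prodE f) (setE-comm xe k u 0))) ⟩
   f (suc k) ^ v * prodE f (setE (setE xe (suc k) 0) k u)    ≈⟨ *-congˡ (prodE-setE f (setE xe (suc k) 0) k u) ⟩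
   f (suc k) ^ v * (f k ^ u * prodE f (setE (setE xe (suc k) 0) k 0))  ≈⟨ *-congˡ (*-congˡ (reflexive (≡.cong (prodE f) (≡.sym (setE-comm xe k 0 0))))) ⟩
   f (suc k) ^ v * (f k ^ u * prodE f (without k xe))        ≈⟨ solve 3 (λ p q r → p :* (q :* r) := q :* p :* r) refl (f (suc k) ^ v) (f k ^ u) (prodE f (without k xe)) ⟩
   f k ^ u * f (suc k) ^ v * prodE f (without k xe)          ∎

 prodE-var : ∀ f i → prodE f (setE [] i 1) ≈ f i
 prodE-var f zero = trans (*-identityʳ _) (*-identityʳ _)
 prodE-var f (suc i) = trans (*-identityˡ _) (prodE-var (f ∘ suc) i)

 module Eval (X P : ℕ → Carrier) where

  term : ℚ → Mono → Carrier
  term c (mono a xe pe) = κ c a * (prodE X xe * prodE P pe)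

  eval : Poly → Carrier
  eval [] = 0#
  eval ((c , m) ∷ F) = term c m + eval F

  eval-++ : ∀ F G → eval (F ++ G) ≈ eval F + eval G
  eval-++ [] G = sym (+-identityˡ _)
  eval-++ ((c , m) ∷ F) G = trans (+-congˡ (eval-++ F G)) (sym (+-assoc _ _ _))

  eval-neg : ∀ F → eval (negP F) ≈ - eval F
  eval-neg [] = sym -0#≈0#
  eval-neg ((c , mono a xe pe) ∷ F) = trans (+-cong (*-congʳ (κ-neg c a)) (eval-neg F))
    (solve 3 (λ k m e → :- k :* m :+ :- e := :- (k :* m :+ e)) refl (κ c a) (prodE X xe * prodE P pe) (eval F))

  term-mulM : ∀ c m c' m' → term (c ℚ.* c') (mulM m m') ≈ term c m * term c' m'
  term-mulM c (mono a xe pe) c' (mono b ye qe) = begin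
    κ (c ℚ.* c') (a ℤ.+ b) * (prodE X (addE xe ye) * prodE P (addE pe qe))
      ≈⟨ *-cong (κ-* c c' a b) (*-cong (prodE-addE X xe ye) (prodE-addE P pe qe)) ⟩
    κ c a * κ c' b * (prodE X xe * prodE X ye * (prodE P pe * prodE P qe))
      ≈⟨ solve 6 (λ k l x y p q → k :* l :* (x :* y :* (p :* q)) := k :* (x :* p) :* (l :* (y :* q))) refl (κ c a) (κ c' b) (prodE X xe) (prodE X ye) (prodE P pe) (prodE P qe) ⟩
    κ c a * (prodE X xe * prodE P pe) * (κ c' b * (prodE X ye * prodE P qe))  ∎

  eval-monomial* : ∀ c m G → eval (map (λ { (c' , m') → (c ℚ.* c' , mulM m m') }) G) ≈ term c m * eval G
  eval-monomial* c m [] = sym (zeroʳ _)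
  eval-monomial* c m ((c' , m') ∷ G) = trans (+-cong (term-mulM c m c' m') (eval-monomial* c m G)) (sym (distribˡ _ _ _))

  eval-* : ∀ F G → eval (F *P G) ≈ eval F * eval G
  eval-* [] G = sym (zeroˡ _)
  eval-* ((c , m) ∷ F) G = trans (eval-++ (map (λ { (c' , m') → (c ℚ.* c' , mulM m m') }) G) (F *P G))
    (trans (+-cong (eval-monomial* c m G) (eval-* F G)) (sym (distribʳ _ _ _)))

  eval-scalar : ∀ c n → eval ((c , mono n [] []) ∷ []) ≈ κ c n
  eval-scalar c n = solve 1 (λ k → k :* (con (+ 1) :* con (+ 1)) :+ con (+ 0) := k) refl (κ c n)

  eval-one : eval one ≈ 1#
  eval-one = trans (eval-scalar 1ℚ (+ 0)) κ-1

  eval-scale : ∀ q F → eval (scaleP q F) ≈ κ q (+ 0) * eval F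
  eval-scale q [] = sym (zeroʳ _)
  eval-scale q ((c , mono a xe pe) ∷ F) = trans (+-cong (*-congʳ (trans (reflexive (≡.cong (κ (q ℚ.* c)) (≡.sym (ℤP.+-identityˡ a)))) (κ-* q c (+ 0) a))) (eval-scale q F))
    (solve 4 (λ q k m e → q :* k :* m :+ q :* e := q :* (k :* m :+ e)) refl (κ q (+ 0)) (κ c a) (prodE X xe * prodE P pe) (eval F))

  eval-xVar : ∀ i → eval (xVar (suc i)) ≈ X i
  eval-xVar i = trans (+-identityʳ _) (trans (*-cong κ-1 (trans (*-identityʳ _) (prodE-var X i))) (*-identityˡ _))

  eval-pVar : ∀ i → eval (pVar (suc i)) ≈ P i
  eval-pVar i = trans (+-identityʳ _) (trans (*-cong κ-1 (trans (*-identityˡ _) (prodE-var P i))) (*-identityˡ _))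

  eval-pow : ∀ F n → eval (powP F n) ≈ eval F ^ n
  eval-pow F zero = eval-one
  eval-pow F (suc n) = trans (eval-* F (powP F n)) (*-congˡ (eval-pow F n))

  eval-1-t : eval (one -P tPow (+ 1)) ≈ 1# - t
  eval-1-t = trans (eval-++ one (negP (tPow (+ 1)))) (+-cong eval-one (trans (eval-neg (tPow (+ 1))) (-‿cong (eval-scalar 1ℚ (+ 1)))))

  eval-prodIdx : ∀ f i es → eval (prodIdx f (suc i) es) ≈ prodE (λ j → eval (f (suc (i ℕ.+ j)))) es
  eval-prodIdx f i [] = eval-one
  eval-prodIdx f i (e ∷ es) = trans (eval-* (powP (f (suc i)) e) (prodIdx f (suc (suc i)) es))
    (*-cong (trans (eval-pow (f (suc i)) e) (^-congˡ e (reflexive (≡.cong (λ j → eval (f (suc j))) (≡.sym (ℕP.+-identityʳ i))))))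
            (trans (eval-prodIdx f (suc i) es) (prodE-cong es (λ j → ^-congˡ (getE es j) (reflexive (≡.cong (λ l → eval (f (suc l))) (≡.sym (ℕP.+-suc i j))))))))

 open Eval

 eval-cong : ∀ {X X' P P'} → (∀ i → X i ≈ X' i) → (∀ i → P i ≈ P' i) → ∀ F → eval X P F ≈ eval X' P' F
 eval-cong hX hP [] = refl
 eval-cong hX hP ((c , mono a xe pe) ∷ F) = +-cong
   (*-congˡ (*-cong (prodE-cong xe (λ i → ^-congˡ (getE xe i) (hX i))) (prodE-cong pe (λ i → ^-congˡ (getE pe i) (hP i))))) (eval-cong hX hP F)

 eval-substP : ∀ X P X' P' F → eval X P (substP X' P' F) ≈ eval (λ i → eval X P (X' (suc i))) (λ i → eval X P (P' (suc i))) F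
 eval-substP X P X' P' [] = refl
 eval-substP X P X' P' ((c , mono a xe pe) ∷ F) = trans
   (eval-++ X P (((c , mono a [] []) ∷ []) *P (prodIdx X' 1 xe *P prodIdx P' 1 pe)) (substP X' P' F))
   (+-cong (trans (eval-* X P ((c , mono a [] []) ∷ []) (prodIdx X' 1 xe *P prodIdx P' 1 pe))
     (*-cong (eval-scalar X P c a) (trans (eval-* X P (prodIdx X' 1 xe) (prodIdx P' 1 pe))
       (*-cong (eval-prodIdx X P X' 0 xe) (eval-prodIdx X P P' 0 pe))))) (eval-substP X P X' P' F))

 module Hom {θ : Carrier → Carrier} (isHom : RingMorphisms.IsRingHomomorphism rawRing rawRing θ) (θ-κ : ∀ c n → θ (κ c n) ≈ κ c n) where
  open RingMorphisms.IsRingHomomorphism isHom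

  hom-^ : ∀ f n → θ (f ^ n) ≈ θ f ^ n
  hom-^ f zero = 1#-homo
  hom-^ f (suc n) = trans (*-homo f (f ^ n)) (*-congˡ (hom-^ f n))

  hom-prodE : ∀ f es → θ (prodE f es) ≈ prodE (θ ∘ f) es
  hom-prodE f [] = 1#-homo
  hom-prodE f (e ∷ es) = trans (*-homo _ _) (*-cong (hom-^ (f 0) e) (hom-prodE (f ∘ suc) es))

  hom-eval : ∀ X P F → θ (eval X P F) ≈ eval (θ ∘ X) (θ ∘ P) F
  hom-eval X P [] = 0#-homo
  hom-eval X P ((c , mono a xe pe) ∷ F) = trans (+-homo _ _) (+-cong (trans (*-homo _ _) (*-cong (θ-κ c a)
    (trans (*-homo _ _) (*-cong (hom-prodE X xe) (hom-prodE P pe))))) (hom-eval X P F))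

  hom-sumTo : ∀ n f → θ (sumTo n f) ≈ sumTo n (θ ∘ f)
  hom-sumTo zero f = 0#-homo
  hom-sumTo (suc n) f = trans (+-homo _ _) (+-congʳ (hom-sumTo n f))

 sumTo-cong : ∀ n {f g} → (∀ i → i < n → f i ≈ g i) → sumTo n f ≈ sumTo n g
 sumTo-cong = sumTo-∼-small _≈_ refl +-cong (λ p q r → trans (sym p) (trans r q))

 sumTo-* : ∀ c n f → sumTo n (λ i → c * f i) ≈ c * sumTo n f
 sumTo-* c zero f = sym (zeroʳ c)
 sumTo-* c (suc n) f = trans (+-congʳ (sumTo-* c n f)) (sym (distribˡ _ _ _))

 sumTo-front : ∀ n f → sumTo (suc n) f ≈ f 0 + sumTo n (f ∘ suc)
 sumTo-front zero f = +-comm _ _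
 sumTo-front (suc n) f = trans (+-congʳ (sumTo-front n f)) (+-assoc _ _ _)

 eval-applyUpTo : ∀ X P (f : ℕ → ℚ × Mono) g n → eval X P (map f (applyUpTo g n)) ≈ sumTo n (λ j → eval X P (f (g j) ∷ []))
 eval-applyUpTo X P f g zero = refl
 eval-applyUpTo X P f g (suc n) = trans (+-cong (sym (+-identityʳ _)) (eval-applyUpTo X P f (g ∘ suc) n)) (sym (sumTo-front n _))

 geometric : ∀ u v n → (u - v) * sumTo n (λ j → u ^ (n ∸ 1 ∸ j) * v ^ j) ≈ u ^ n - v ^ n
 geometric u v zero = trans (zeroʳ _) (sym (-‿inverseʳ 1#))
 geometric u v (suc n) = begin
   (u - v) * sumTo (suc n) (λ j → u ^ (n ∸ j) * v ^ j)  ≈⟨ *-congˡ (sumTo-front n _) ⟩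
   (u - v) * (u ^ n * 1# + sumTo n (λ j → u ^ (n ∸ suc j) * (v * v ^ j)))
     ≈⟨ *-congˡ (+-congˡ (trans (sumTo-cong n (λ j _ → trans (*-congʳ (reflexive (≡.cong (u ^_) (≡.sym (ℕP.∸-+-assoc n 1 j)))))
          (solve 3 (λ p v q → p :* (v :* q) := v :* (p :* q)) refl (u ^ (n ∸ 1 ∸ j)) v (v ^ j)))) (sumTo-* v n _))) ⟩
   (u - v) * (u ^ n * 1# + v * S)
     ≈⟨ solve 4 (λ u v p S → (u :- v) :* (p :* con (+ 1) :+ v :* S) := (u :- v) :* p :+ v :* ((u :- v) :* S)) refl u v (u ^ n) S ⟩
   (u - v) * u ^ n + v * ((u - v) * S)         ≈⟨ +-congˡ (*-congˡ (geometric u v n)) ⟩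
   (u - v) * u ^ n + v * (u ^ n - v ^ n)       ≈⟨ solve 4 (λ u v p q → (u :- v) :* p :+ v :* (p :- q) := u :* p :- v :* q) refl u v (u ^ n) (v ^ n) ⟩
   u ^ suc n - v ^ suc n                       ∎
   where S = sumTo n (λ j → u ^ (n ∸ 1 ∸ j) * v ^ j)

 -- The common factor (uv)^B splits off and leaves the geometric sum.
 divided-difference : ∀ u v B n → (u - v) * sumTo n (λ j → u ^ (B ℕ.+ n ∸ 1 ∸ j) * v ^ (B ℕ.+ j)) ≈ u ^ (B ℕ.+ n) * v ^ B - u ^ B * v ^ (B ℕ.+ n)
 divided-difference u v B n = begin
   (u - v) * sumTo n (λ j → u ^ (B ℕ.+ n ∸ 1 ∸ j) * v ^ (B ℕ.+ j))
     ≈⟨ *-congˡ (trans (sumTo-cong n shift) (sumTo-* (u ^ B * v ^ B) n _)) ⟩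
   (u - v) * (u ^ B * v ^ B * S)
     ≈⟨ solve 5 (λ u v p q S → (u :- v) :* (p :* q :* S) := p :* q :* ((u :- v) :* S)) refl u v (u ^ B) (v ^ B) S ⟩
   u ^ B * v ^ B * ((u - v) * S)   ≈⟨ *-congˡ (geometric u v n) ⟩
   u ^ B * v ^ B * (u ^ n - v ^ n)
     ≈⟨ solve 4 (λ p q r s → p :* q :* (r :- s) := p :* r :* q :- p :* (q :* s)) refl (u ^ B) (v ^ B) (u ^ n) (v ^ n) ⟩
   u ^ B * u ^ n * v ^ B - u ^ B * (v ^ B * v ^ n)  ≈⟨ sym (+-cong (*-congʳ (^-homo-* u B n)) (-‿cong (*-congˡ (^-homo-* v B n)))) ⟩
   u ^ (B ℕ.+ n) * v ^ B - u ^ B * v ^ (B ℕ.+ n)  ∎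
   where
   S = sumTo n (λ j → u ^ (n ∸ 1 ∸ j) * v ^ j)
   -- The bound on j ensures that no subtraction is truncated here.
   exponent : ∀ j → j < n → B ℕ.+ n ∸ 1 ∸ j ≡ B ℕ.+ (n ∸ 1 ∸ j)
   exponent j j<n = ≡.trans (ℕP.∸-+-assoc (B ℕ.+ n) 1 j) (≡.trans (ℕP.+-∸-assoc B j<n) (≡.cong (B ℕ.+_) (≡.sym (ℕP.∸-+-assoc n 1 j))))
   shift : ∀ j → j < n → u ^ (B ℕ.+ n ∸ 1 ∸ j) * v ^ (B ℕ.+ j) ≈ u ^ B * v ^ B * (u ^ (n ∸ 1 ∸ j) * v ^ j)
   shift j j<n = trans (*-cong (trans (reflexive (≡.cong (u ^_) (exponent j j<n))) (^-homo-* u B _)) (^-homo-* v B j)) (*-interchange _ _ _ _)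

-- The operators T_i on evaluated polynomials

module Hecke (𝕋 : Target) where
 open Target 𝕋
 open IntegerSolver ring
 open OverRing ring
 open Evaluation scalars
 open Eval
 open import Algebra.Properties.Semiring.Exp semiring using (_^_; ^-congˡ)
 open import Algebra.Properties.Ring (CommutativeRing.ring ring) using (-0#≈0#)
 open import Relation.Binary.Reasoning.Setoid setoid

 module HeckeAction (X P : ℕ → Carrier) (k : ℕ) (X-k : X k ≈ var k) (X-1+k : X (suc k) ≈ var (suc k))
     (X-other : ∀ i → i ≢ k → i ≢ suc k → swap k (X i) ≈ X i) (P-fixed : ∀ i → swap k (P i) ≈ P i) where
  open Transposition (swap-isTransposition k)
  open Hom isHom (swap-κ k)

  private
   ev = eval X P

   swap-rest : ∀ xe → swap k (prodE X (without k xe)) ≈ prodE X (without k xe)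
   swap-rest xe = trans (hom-prodE X (without k xe)) (prodE-cong (without k xe) pointwise)
     where
     absent : ∀ i → getE (without k xe) i ≡ 0 → swap k (X i) ^ getE (without k xe) i ≈ X i ^ getE (without k xe) i
     absent i e = trans (reflexive (≡.cong (swap k (X i) ^_) e)) (reflexive (≡.cong (X i ^_) (≡.sym e)))
     pointwise : ∀ i → swap k (X i) ^ getE (without k xe) i ≈ X i ^ getE (without k xe) i
     pointwise i with position k i
     ... | at-k = absent k (≡.trans (getE-setE-≢ (setE xe k 0) 0 (λ ())) (getE-setE xe k 0))
     ... | at-1+k = absent (suc k) (getE-setE (setE xe k 0) (suc k) 0)
     ... | elsewhere p q = ^-congˡ (getE (without k xe) i) (X-other i p q)

   swap-P : ∀ pe → swap k (prodE P pe) ≈ prodE P pe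
   swap-P pe = trans (hom-prodE P pe) (prodE-cong pe (λ i → ^-congˡ (getE pe i) (P-fixed i)))

   X^ : ∀ u v → X k ^ u * X (suc k) ^ v ≈ a ^ u * b ^ v
   X^ u v = *-cong (^-congˡ u X-k) (^-congˡ v X-1+k)

   factored : ∀ c n xe pe u v → term X P c (mono n (setE (setE xe k u) (suc k) v) pe) ≈ κ c n * (prodE X (without k xe) * prodE P pe) * (a ^ u * b ^ v)
   factored c n xe pe u v = trans (*-congˡ (*-congʳ (trans (prodE-setE₂ X k xe u v) (*-congʳ (X^ u v)))))
     (solve 4 (λ k m p r → k :* (m :* r :* p) := k :* (r :* p) :* m) refl (κ c n) (a ^ u * b ^ v) (prodE P pe) (prodE X (without k xe)))

   factored₀ : ∀ c n xe pe → term X P c (mono n xe pe) ≈ κ c n * (prodE X (without k xe) * prodE P pe) * (a ^ getE xe k * b ^ getE xe (suc k))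
   factored₀ c n xe pe = trans (*-congˡ (*-congʳ (trans (prodE-split X k xe) (*-congʳ (X^ (getE xe k) (getE xe (suc k)))))))
     (solve 4 (λ k m p r → k :* (m :* r :* p) := k :* (r :* p) :* m) refl (κ c n) (a ^ getE xe k * b ^ getE xe (suc k)) (prodE P pe) (prodE X (without k xe)))

  eval-sP : ∀ F → swap k (ev F) ≈ ev (sP (suc k) F)
  eval-sP [] = 0#-homo
  eval-sP ((c , mono n xe pe) ∷ F) = trans (+-homo _ _) (+-cong (begin
    swap k (term X P c (mono n xe pe))            ≈⟨ ⟦⟧-cong (factored₀ c n xe pe) ⟩
    swap k (κ c n * (prodE X (without k xe) * prodE P pe) * (a ^ A * b ^ B))
      ≈⟨ trans (*-homo _ _) (*-cong (trans (*-homo _ _) (*-cong (swap-κ k c n) (trans (*-homo _ _) (*-cong (swap-rest xe) (swap-P pe)))))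
           (trans (*-homo _ _) (*-cong (trans (hom-^ a A) (^-congˡ A s-xₖ)) (trans (hom-^ b B) (^-congˡ B s-xₖ₊₁))))) ⟩
    κ c n * (prodE X (without k xe) * prodE P pe) * (b ^ A * a ^ B)  ≈⟨ *-congˡ (*-comm _ _) ⟩
    κ c n * (prodE X (without k xe) * prodE P pe) * (a ^ B * b ^ A)  ≈⟨ sym (factored c n xe pe B A) ⟩
    term X P c (swapM (suc k) (mono n xe pe))     ∎) (eval-sP F))
    where
    A = getE xe k
    B = getE xe (suc k)

  eval-ddTerm : ∀ c m → (a - b) * ev (ddTerm (suc k) (c , m)) ≈ term X P c m - term X P c (swapM (suc k) m)
  eval-ddTerm c (mono n xe pe) = begin
    (a - b) * ev (ddTerm (suc k) (c , mono n xe pe))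
      ≈⟨ *-congˡ (trans (eval-++ X P (map f₁ (upTo (A ∸ B))) (map f₂ (upTo (B ∸ A)))) (+-cong (block c A B) (block (ℚ.- c) B A))) ⟩
    (a - b) * (K c * S A B + K (ℚ.- c) * S B A)
      ≈⟨ *-congˡ (+-congˡ (*-congʳ (trans (*-congʳ (κ-neg c n)) (solve 2 (λ k m → :- k :* m := :- (k :* m)) refl (κ c n) M)))) ⟩
    (a - b) * (K c * S A B + - K c * S B A)
      ≈⟨ solve 5 (λ a b K S S' → (a :- b) :* (K :* S :+ :- K :* S') := K :* ((a :- b) :* S :- (a :- b) :* S')) refl a b (K c) (S A B) (S B A) ⟩
    K c * ((a - b) * S A B - (a - b) * S B A)   ≈⟨ *-congˡ (telescoped (ℕP.≤-total B A)) ⟩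
    K c * (a ^ A * b ^ B - a ^ B * b ^ A)
      ≈⟨ solve 3 (λ K p q → K :* (p :- q) := K :* p :- K :* q) refl (K c) (a ^ A * b ^ B) (a ^ B * b ^ A) ⟩
    K c * (a ^ A * b ^ B) - K c * (a ^ B * b ^ A)  ≈⟨ sym (+-cong (factored₀ c n xe pe) (-‿cong (factored c n xe pe B A))) ⟩
    term X P c (mono n xe pe) - term X P c (swapM (suc k) (mono n xe pe))  ∎
    where
    A = getE xe k
    B = getE xe (suc k)
    M = prodE X (without k xe) * prodE P pe
    K : ℚ → Carrier
    K c = κ c n * M
    S : ℕ → ℕ → Carrier
    S A B = sumTo (A ∸ B) (λ j → a ^ (A ∸ 1 ∸ j) * b ^ (B ℕ.+ j))
    f₁ f₂ : ℕ → ℚ × Mono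
    f₁ j = c , mono n (setE (setE xe k (A ∸ 1 ∸ j)) (suc k) (B ℕ.+ j)) pe
    f₂ j = ℚ.- c , mono n (setE (setE xe k (B ∸ 1 ∸ j)) (suc k) (A ℕ.+ j)) pe
    block : ∀ c A B → ev (map (λ j → c , mono n (setE (setE xe k (A ∸ 1 ∸ j)) (suc k) (B ℕ.+ j)) pe) (upTo (A ∸ B))) ≈ K c * S A B
    block c A B = trans (eval-applyUpTo X P (λ j → c , mono n (setE (setE xe k (A ∸ 1 ∸ j)) (suc k) (B ℕ.+ j)) pe) (λ j → j) (A ∸ B))
      (trans (sumTo-cong (A ∸ B) (λ j _ → trans (+-identityʳ _) (factored c n xe pe (A ∸ 1 ∸ j) (B ℕ.+ j)))) (sumTo-* (K c) (A ∸ B) _))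
    empty : ∀ {A B} → A ≤ B → (a - b) * S A B ≈ 0#
    empty {A} {B} A≤B = trans (*-congˡ (reflexive (≡.cong (λ m → sumTo m (λ j → a ^ (A ∸ 1 ∸ j) * b ^ (B ℕ.+ j))) (ℕP.m≤n⇒m∸n≡0 A≤B)))) (zeroʳ _)
    full : ∀ {A B} → B ≤ A → (a - b) * S A B ≈ a ^ A * b ^ B - a ^ B * b ^ A
    full {A} {B} B≤A = ≡.subst (λ A' → (a - b) * sumTo (A ∸ B) (λ j → a ^ (A' ∸ 1 ∸ j) * b ^ (B ℕ.+ j)) ≈ a ^ A' * b ^ B - a ^ B * b ^ A')
      (ℕP.m+[n∸m]≡n B≤A) (divided-difference a b B (A ∸ B))
    -- Truncated subtraction empties one of the two sums of `ddTerm`; the other supplies the whole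
    -- difference with the right sign.
    telescoped : B ≤ A ⊎ A ≤ B → (a - b) * S A B - (a - b) * S B A ≈ a ^ A * b ^ B - a ^ B * b ^ A
    telescoped (inj₁ B≤A) = trans (+-cong (full B≤A) (trans (-‿cong (empty B≤A)) -0#≈0#)) (+-identityʳ _)
    telescoped (inj₂ A≤B) = trans (+-cong (empty A≤B) (-‿cong (full A≤B)))
      (solve 2 (λ p q → con (+ 0) :+ :- (p :- q) := q :- p) refl (a ^ B * b ^ A) (a ^ A * b ^ B))

  eval-ddP : ∀ F → (a - b) * ev (ddP (suc k) F) ≈ ev F - ev (sP (suc k) F)
  eval-ddP [] = trans (zeroʳ _) (sym (-‿inverseʳ 0#))
  eval-ddP ((c , m) ∷ F) = begin
    (a - b) * ev (ddTerm (suc k) (c , m) ++ ddP (suc k) F)  ≈⟨ *-congˡ (eval-++ X P (ddTerm (suc k) (c , m)) (ddP (suc k) F)) ⟩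
    (a - b) * (ev (ddTerm (suc k) (c , m)) + ev (ddP (suc k) F))  ≈⟨ trans (distribˡ _ _ _) (+-cong (eval-ddTerm c m) (eval-ddP F)) ⟩
    (u - v) + (ev F - ev (sP (suc k) F))  ≈⟨ solve 4 (λ u v p q → (u :- v) :+ (p :- q) := (u :+ p) :- (v :+ q)) refl u v (ev F) (ev (sP (suc k) F)) ⟩
    (u + ev F) - (v + ev (sP (suc k) F))  ∎
    where
    u = term X P c m
    v = term X P c (swapM (suc k) m)

  -- Evaluation intertwines the list operator with T_k because `swap k` exchanges the values of x_k
  -- and x_{k+1} and fixes all other values, including the power sums.
  eval-Ti : ∀ F → ev F ↝ ev (Ti (suc k) F)
  eval-Ti F = begin
    (a - b) * ev (Ti (suc k) F)
      ≈⟨ *-congˡ (trans (eval-++ X P (sP (suc k) F) _) (+-congˡ (trans (eval-* X P ((one -P tPow (+ 1)) *P xVar (suc k)) (ddP (suc k) F))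
           (*-congʳ (trans (eval-* X P (one -P tPow (+ 1)) (xVar (suc k))) (*-cong (eval-1-t X P) (trans (eval-xVar X P k) X-k))))))) ⟩
    (a - b) * (S + (1# - t) * a * D)
      ≈⟨ solve 5 (λ a b t S D → (a :- b) :* (S :+ (con (+ 1) :- t) :* a :* D) := (a :- b) :* S :+ (con (+ 1) :- t) :* a :* ((a :- b) :* D)) refl a b t S D ⟩
    (a - b) * S + (1# - t) * a * ((a - b) * D)  ≈⟨ +-congˡ (*-congˡ (eval-ddP F)) ⟩
    (a - b) * S + (1# - t) * a * (ev F - S)
      ≈⟨ solve 5 (λ a b t S f → (a :- b) :* S :+ (con (+ 1) :- t) :* a :* (f :- S) := (con (+ 1) :- t) :* a :* f :+ (t :* a :- b) :* S) refl a b t S (ev F) ⟩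
    (1# - t) * a * ev F + (t * a - b) * S       ≈⟨ +-congˡ (*-congˡ (sym (eval-sP F))) ⟩
    (1# - t) * a * ev F + (t * a - b) * swap k (ev F)  ∎
    where
    S = ev (sP (suc k) F)
    D = ev (ddP (suc k) F)

-- Windows of consecutive colours

interval : ℕ → ℕ → List ℕ
interval a zero = []
interval a (suc n) = a ∷ interval (suc a) n

interval-snoc : ∀ a n → interval a (suc n) ≡ interval a n ++ a ℕ.+ n ∷ []
interval-snoc a zero = ≡.cong (_∷ []) (≡.sym (ℕP.+-identityʳ a))
interval-snoc a (suc n) = ≡.cong (a ∷_) (≡.trans (interval-snoc (suc a) n) (≡.cong (λ c → interval (suc a) n ++ c ∷ []) (≡.sym (ℕP.+-suc a n))))

mult-interval-< : ∀ {c a} n → c < a → mult c (interval a n) ≡ 0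
mult-interval-< zero c<a = ≡.refl
mult-interval-< {c} {a} (suc n) c<a = ≡.trans (mult-other (interval (suc a) n) (≡.≢-sym (ℕP.<⇒≢ c<a))) (mult-interval-< n (ℕP.m<n⇒m<1+n c<a))

mult-interval-≥ : ∀ {c} a n → a ℕ.+ n ≤ c → mult c (interval a n) ≡ 0
mult-interval-≥ a zero _ = ≡.refl
mult-interval-≥ {c} a (suc n) a+n<c = ≡.trans (mult-other (interval (suc a) n) (ℕP.<⇒≢ (ℕP.≤-trans (s≤s (ℕP.m≤m+n a n)) le))) (mult-interval-≥ (suc a) n le)
  where
  le : suc a ℕ.+ n ≤ c
  le = ≡.subst (_≤ c) (ℕP.+-suc a n) a+n<c

Distinct-interval : ∀ a n → Distinct (interval a n)
Distinct-interval a zero c = z≤n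
Distinct-interval a (suc n) c with a ℕP.≟ c
... | yes ≡.refl = ≡.subst (_≤ 1) (≡.sym (≡.trans (mult-self a (interval (suc a) n)) (≡.cong suc (mult-interval-< n (ℕP.n<1+n a))))) ℕP.≤-refl
... | no a≢c = ≡.subst (_≤ 1) (≡.sym (mult-other (interval (suc a) n) a≢c)) (Distinct-interval (suc a) n c)

mult-interval : ∀ {c} n → c < n → mult c (interval 0 n) ≡ 1
mult-interval {c} (suc n) c<1+n = ≡.trans (≡.cong (mult c) (interval-snoc 0 n)) (≡.trans (mult-++ c (interval 0 n) (n ∷ [])) lemma)
  where
  lemma : mult c (interval 0 n) ℕ.+ mult c (n ∷ []) ≡ 1
  lemma with n ℕP.≟ c
  ... | yes ≡.refl = ≡.cong₂ ℕ._+_ (mult-interval-≥ 0 n ℕP.≤-refl) (mult-self n [])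
  ... | no n≢c = ≡.cong₂ ℕ._+_ (mult-interval n (ℕP.≤∧≢⇒< (ℕP.≤-pred c<1+n) (≡.≢-sym n≢c))) (mult-other [] n≢c)

below-interval : ∀ c n → n ≤ c → below c (interval 0 n) ≡ n
below-interval c zero _ = ≡.refl
below-interval c (suc n) n<c = ≡.trans (≡.cong (below c) (interval-snoc 0 n)) (≡.trans (below-++ (interval 0 n)) (≡.trans (≡.cong₂ ℕ._+_ (below-interval c n (ℕP.<⇒≤ n<c)) (≡.cong (ℕ._+ 0) (indicator-< n<c))) (ℕP.+-comm n 1)))
  where
  below-++ : ∀ u → below c (u ++ n ∷ []) ≡ below c u ℕ.+ below c (n ∷ [])
  below-++ [] = ≡.refl
  below-++ (a ∷ u) = ≡.trans (≡.cong ((if a <ᵇ c then 1 else 0) ℕ.+_) (below-++ u)) (≡.sym (ℕP.+-assoc (if a <ᵇ c then 1 else 0) _ _))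

-- Valid s es: the events es lead from height s above the diagonal back to the diagonal.
data Valid : ℕ → List Ev → Set where
 done   : Valid 0 []
 eastV  : ∀ {s es} → Valid s es → Valid (suc s) (evE ∷ es)
 northV : ∀ {s es} → Valid (suc s) es → Valid s (evN ∷ es)
 marked : ∀ {s es} → Valid (suc s) es → Valid (suc s) (evM ∷ es)

norths : List Ev → ℕ
norths [] = 0
norths (evE ∷ es) = norths es
norths (_ ∷ es) = suc (norths es)

-- Polynomials represented by functions of windows

module Representation (𝕋 : Target) where
 open Target 𝕋
 open IntegerSolver ring
 open OverRing ring
 open Sequences ring
 open Evaluation scalars
 open Hecke 𝕋
 open Eval
 open WithParameter t
 open Alphabet var
 open import Algebra.Properties.Semiring.Exp semiring using (_^_; ^-homo-*; ^-congˡ)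
 open import Algebra.Properties.Semiring.Mult semiring using () renaming (_×_ to _·_)
 open import Algebra.Properties.CommutativeSemigroup *-commutativeSemigroup using () renaming (interchange to *-interchange)
 open import Relation.Binary.Reasoning.Setoid setoid

 module W (N : ℕ) = Windows t t⁻¹ t*t⁻¹ var N
 module Swap (k : ℕ) = Transposition (swap-isTransposition k)

 -- The list representing an element of P(s) may contain cancelling monomials in x_i, i > s.
 -- They are evaluated at fresh variables, which the exchanges of the first N variables fix.
 generic : ℕ → ℕ → ℕ → Carrier
 generic s N i = if i <ᵇ s then var i else var (N ℕ.+ i)

 generic-< : ∀ {s N i} → i < s → generic s N i ≡ var i
 generic-< i<s = if-T (ℕP.<⇒<ᵇ i<s)

 generic-≥ : ∀ {s N i} → s ≤ i → generic s N i ≡ var (N ℕ.+ i)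
 generic-≥ {s} {N} {i} s≤i = if-¬T (λ p → ℕP.<⇒≱ (ℕP.<ᵇ⇒< i s p) s≤i)

 tail-power : ℕ → ℕ → ℕ → Carrier
 tail-power s N k = powerSum s (N ∸ s) (suc k)

 monomial : ℕ → Carrier
 monomial zero = 1#
 monomial (suc r) = monomial r * var r

 triangular : ℕ → Carrier
 triangular zero = 1#
 triangular (suc r) = triangular r * t⁻¹ ^ r

 -- The joint weight of the forced flagged letters: with colours numbered from 0, colour i follows
 -- exactly i smaller ones and contributes x_i t^(-i).
 prefix : ℕ → Carrier
 prefix r = monomial r * triangular r

 exchangeable : ∀ N es k (k<N : suc k < N) → W.Exchange.Exchangeable N k k<N (swap k) (swap-isTransposition k) (W.family N es)
 exchangeable N es k k<N = W.Exchange.family-exchangeable N k k<N (swap k) (swap-isTransposition k) es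

 -- Independence of the values `X` beyond s expresses that F lies in P(s), whatever monomials its
 -- list contains. The bound `B` guarantees that the variables needed along the path exist. All N ≥
 -- B occur together because the step for d₋ at N uses the statement at N + 1.
 record Represents (s B : ℕ) (es : List Ev) (F : Poly) : Set where
  constructor represents
  field
   eval-≈ : ∀ N → B ≤ N → ∀ X → (∀ i → i < s → X i ≈ var i) → eval X (tail-power s N) F ≈ prefix s * W.family N es (interval 0 s)
 open Represents

 monomial-small : ∀ k n → n ≤ k → swap k (monomial n) ≈ monomial n
 monomial-small k zero _ = Swap.1#-homo k
 monomial-small k (suc n) n<k = trans (Swap.*-homo k _ _) (*-cong (monomial-small k n (ℕP.<⇒≤ n<k)) (Swap.s-x k (ℕP.<⇒≢ n<k) (ℕP.<⇒≢ (ℕP.m<n⇒m<1+n n<k))))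

 monomial-symmetric : ∀ k n → suc k < n → swap k (monomial n) ≈ monomial n
 monomial-symmetric k (suc n) (s≤s k<n) with n ℕP.≟ suc k
 ... | yes ≡.refl = trans (Swap.*-homo k _ _) (trans (*-cong (trans (Swap.*-homo k _ _) (*-cong (monomial-small k k ℕP.≤-refl) (Swap.s-xₖ k))) (Swap.s-xₖ₊₁ k))
         (solve 3 (λ m a b → m :* b :* a := m :* a :* b) refl (monomial k) (var k) (var (suc k))))
 ... | no n≢ = trans (Swap.*-homo k _ _) (*-cong (monomial-symmetric k n (ℕP.≤∧≢⇒< k<n (≡.≢-sym n≢)))
         (Swap.s-x k (λ { ≡.refl → ℕP.n≮n n k<n }) n≢))

 swap-t⁻¹^ : ∀ k n → swap k (t⁻¹ ^ n) ≈ t⁻¹ ^ n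
 swap-t⁻¹^ k = Swap.s-^ k (Swap.s-t⁻¹ k)

 triangular-symmetric : ∀ k n → swap k (triangular n) ≈ triangular n
 triangular-symmetric k zero = Swap.1#-homo k
 triangular-symmetric k (suc n) = trans (Swap.*-homo k _ _) (*-cong (triangular-symmetric k n) (swap-t⁻¹^ k n))

 prefix-small : ∀ k n → n ≤ k → swap k (prefix n) ≈ prefix n
 prefix-small k n n≤k = trans (Swap.*-homo k _ _) (*-cong (monomial-small k n n≤k) (triangular-symmetric k n))

 swap-generic : ∀ k s N → suc k < N → ∀ i → i ≢ k → i ≢ suc k → swap k (generic s N i) ≈ generic s N i
 swap-generic k s N k<N i i≢k i≢1+k with i <ᵇ s
 ... | true = Swap.s-x k i≢k i≢1+k
 ... | false = Swap.s-x k (≡.≢-sym (ℕP.<⇒≢ (ℕP.<-≤-trans (ℕP.<-trans (ℕP.n<1+n k) k<N) (ℕP.m≤m+n N i)))) (≡.≢-sym (ℕP.<⇒≢ (ℕP.<-≤-trans k<N (ℕP.m≤m+n N i))))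

 swap-var^ : ∀ k i m → i ≢ k → i ≢ suc k → swap k (var i ^ m) ≈ var i ^ m
 swap-var^ k i m i≢k i≢1+k = Swap.s-^ k (Swap.s-x k i≢k i≢1+k) m

 powerSum-above : ∀ k s n m → suc k < s → swap k (powerSum s n m) ≈ powerSum s n m
 powerSum-above k s zero m k<s = Swap.0#-homo k
 powerSum-above k s (suc n) m k<s = trans (Swap.+-homo k _ _) (+-cong (powerSum-above k s n m k<s)
   (swap-var^ k (s ℕ.+ n) m (≡.≢-sym (ℕP.<⇒≢ (ℕP.<-≤-trans (ℕP.<-trans (ℕP.n<1+n k) k<s) (ℕP.m≤m+n s n)))) (≡.≢-sym (ℕP.<⇒≢ (ℕP.<-≤-trans k<s (ℕP.m≤m+n s n))))))

 powerSum-within : ∀ k s n m → suc k < n → swap (s ℕ.+ k) (powerSum s n m) ≈ powerSum s n m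
 powerSum-within k s n m k<n = trans (Hom.hom-sumTo (Swap.isHom (s ℕ.+ k)) (swap-κ (s ℕ.+ k)) n _)
   (sumTo-∼ _≈_ refl +-cong (λ p q r → trans (sym p) (trans r q)) k otherwise pair n k<n)
   where
   sw = swap (s ℕ.+ k)
   otherwise : ∀ i → i ≢ k → i ≢ suc k → sw (var (s ℕ.+ i) ^ m) ≈ var (s ℕ.+ i) ^ m
   otherwise i i≢k i≢1+k = swap-var^ (s ℕ.+ k) (s ℕ.+ i) m (i≢k ∘ ℕP.+-cancelˡ-≡ s i k) (λ e → i≢1+k (ℕP.+-cancelˡ-≡ s i (suc k) (≡.trans e (≡.sym (ℕP.+-suc s k)))))
   x₁ = var (s ℕ.+ k)
   next : var (s ℕ.+ suc k) ≡ var (suc (s ℕ.+ k))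
   next = ≡.cong var (ℕP.+-suc s k)
   hom : ∀ f → sw (f ^ m) ≈ sw f ^ m
   hom f = Hom.hom-^ (Swap.isHom (s ℕ.+ k)) (swap-κ (s ℕ.+ k)) f m
   pair : sw (var (s ℕ.+ k) ^ m) + sw (var (s ℕ.+ suc k) ^ m) ≈ var (s ℕ.+ k) ^ m + var (s ℕ.+ suc k) ^ m
   pair = trans (+-cong (trans (hom _) (^-congˡ m (trans (Swap.s-xₖ (s ℕ.+ k)) (reflexive (≡.sym next)))))
                        (trans (hom _) (^-congˡ m (trans (Swap.⟦⟧-cong (s ℕ.+ k) (reflexive next)) (Swap.s-xₖ₊₁ (s ℕ.+ k))))))
          (+-comm _ _)

 powerSum-split : ∀ r n m → powerSum r (suc n) m ≈ var r ^ m + powerSum (suc r) n m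
 powerSum-split r n m = trans (sumTo-front n _) (+-cong (reflexive (≡.cong (λ i → var i ^ m) (ℕP.+-identityʳ r)))
   (sumTo-cong n (λ i _ → reflexive (≡.cong (λ j → var j ^ m) (ℕP.+-suc r i)))))

 ∸-suc : ∀ {r N} → r < N → N ∸ r ≡ suc (N ∸ suc r)
 ∸-suc {r} {N} r<N = ℕP.+-∸-assoc 1 r<N

 tail-power-split : ∀ {r N} → r < N → ∀ k → tail-power r N k ≈ var r ^ suc k + tail-power (suc r) N k
 tail-power-split {r} {N} r<N k = trans (reflexive (≡.cong (λ n → powerSum r n (suc k)) (∸-suc r<N))) (powerSum-split r _ (suc k))

 module Substitution (y : ℕ → Carrier) where
  open RingMorphisms.IsRingHomomorphism (subst-isHom y) public
  open Hom (subst-isHom y) (subst-κ y) public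

  subst-powerSum : ∀ s n m → (∀ i → i < s ℕ.+ n → y i ≈ var i) → subst y (powerSum s n m) ≈ powerSum s n m
  subst-powerSum s n m h = trans (hom-sumTo n _) (sumTo-cong n (λ i i<n → trans (hom-^ _ m) (^-congˡ m (trans (subst-var y _) (h (s ℕ.+ i) (ℕP.+-monoʳ-< s i<n))))))

  subst-monomial : ∀ n → (∀ i → i < n → y i ≈ var i) → subst y (monomial n) ≈ monomial n
  subst-monomial zero h = 1#-homo
  subst-monomial (suc n) h = trans (*-homo _ _) (*-cong (subst-monomial n (λ i i<n → h i (ℕP.m<n⇒m<1+n i<n))) (trans (subst-var y n) (h n (ℕP.n<1+n n))))

  subst-triangular : ∀ n → subst y (triangular n) ≈ triangular n
  subst-triangular zero = 1#-homo
  subst-triangular (suc n) = trans (*-homo _ _) (*-cong (subst-triangular n) (trans (hom-^ _ n) (^-congˡ n (subst-κ y _ _))))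

 family-subst : ∀ y z N → (∀ c → c < N → y c ≈ z c) → ∀ es w → subst y (W.family N es w) ≈ Windows.family t t⁻¹ t*t⁻¹ z N es w
 family-subst y z N h = family-hom t*t⁻¹ var z N (subst-isHom y) (subst-κ y _ _) (subst-κ y _ _) (λ c c<N → trans (subst-var y c) (h c c<N))

 -- Fresh variables are universal: the homomorphism that fixes the first N variables and sends the
 -- later ones to the values of `X` carries the generic equation to any other.
 represents-generic : ∀ {s B es F} → s ≤ B → (∀ N → B ≤ N → eval (generic s N) (tail-power s N) F ≈ prefix s * W.family N es (interval 0 s)) → Represents s B es F
 represents-generic {s} {B} {es} {F} s≤B h = represents λ N B≤N X hX →
   let s≤N = ℕP.≤-trans s≤B B≤N
       y : ℕ → Carrier
       y j = if j <ᵇ N then var j else X (j ∸ N)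
       y-< : ∀ j → j < N → y j ≈ var j
       y-< j j<N = reflexive (if-T (ℕP.<⇒<ᵇ j<N))
       open Substitution y
   in begin
     eval X (tail-power s N) F
       ≈⟨ eval-cong (λ i → sym (images N X hX s≤N i)) (λ k → sym (subst-powerSum s (N ∸ s) (suc k) (λ i i<N → y-< i (≡.subst (i <_) (ℕP.m+[n∸m]≡n s≤N) i<N)))) F ⟩
     eval (subst y ∘ generic s N) (subst y ∘ tail-power s N) F  ≈⟨ sym (hom-eval (generic s N) (tail-power s N) F) ⟩
     subst y (eval (generic s N) (tail-power s N) F)            ≈⟨ ⟦⟧-cong (h N B≤N) ⟩
     subst y (prefix s * W.family N es (interval 0 s))
       ≈⟨ trans (*-homo _ _) (*-cong (trans (*-homo _ _) (*-cong (subst-monomial s (λ i i<s → y-< i (ℕP.≤-trans i<s s≤N))) (subst-triangular s)))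
            (family-subst y var N y-< es (interval 0 s))) ⟩
     prefix s * W.family N es (interval 0 s)                    ∎
   where
   images : ∀ N X → (∀ i → i < s → X i ≈ var i) → s ≤ N → ∀ i → subst (λ j → if j <ᵇ N then var j else X (j ∸ N)) (generic s N i) ≈ X i
   images N X hX s≤N i with i ℕP.<? s
   ... | yes i<s = trans (RingMorphisms.IsRingHomomorphism.⟦⟧-cong (subst-isHom _) (reflexive (generic-< i<s)))
           (trans (subst-var _ i) (trans (reflexive (if-T (ℕP.<⇒<ᵇ (ℕP.≤-trans i<s s≤N)))) (sym (hX i i<s))))
   ... | no i≮s = trans (RingMorphisms.IsRingHomomorphism.⟦⟧-cong (subst-isHom _) (reflexive (generic-≥ (ℕP.≮⇒≥ i≮s))))
           (trans (subst-var _ (N ℕ.+ i)) (trans (reflexive (if-¬T (λ p → ℕP.m+n≮m N i (ℕP.<ᵇ⇒< (N ℕ.+ i) N p)))) (reflexive (≡.cong X (ℕP.m+n∸m≡n N i)))))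

 module EastStep {s B : ℕ} {es : List Ev} {F : Poly} (s<B : s < B) (rep : Represents s B es F) where

  module _ (N : ℕ) (B≤N : B ≤ N) where
   private
    s<N : s < N
    s<N = ℕP.≤-trans s<B B≤N
    X = generic (suc s) N
    V = W.family N es
    ev = eval X (tail-power (suc s) N)

   ev-lift : ev (liftP s F) ≈ eval X (tail-power s N) F
   ev-lift = trans (eval-substP _ _ _ _ F) (eval-cong (eval-xVar X (tail-power (suc s) N))
     (λ k → trans (eval-++ _ _ (powP (xVar (suc s)) (suc k)) (pVar (suc k))) (trans (+-cong
       (trans (eval-pow _ _ (xVar (suc s)) (suc k)) (^-congˡ (suc k) (trans (eval-xVar X (tail-power (suc s) N) s) (reflexive (generic-< {suc s} {N} (ℕP.n<1+n s))))))
       (eval-pVar X (tail-power (suc s) N) k)) (sym (tail-power-split s<N k)))) F)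

   ev-Ti : ∀ k → k < s → ∀ G → Swap._↝_ k (ev G) (ev (Ti (suc k) G))
   ev-Ti k k<s = HeckeAction.eval-Ti X (tail-power (suc s) N) k
     (reflexive (generic-< {suc s} {N} (ℕP.m<n⇒m<1+n k<s))) (reflexive (generic-< {suc s} {N} (s≤s k<s))) (swap-generic k (suc s) N (ℕP.≤-<-trans k<s s<N))
     (λ i → powerSum-above k (suc s) (N ∸ suc s) (suc i) (s≤s k<s))

   -- The window misses exactly one of the colours 0, ..., s. Every T in the chain exchanges the
   -- missing colour with the next smaller one, so the gap moves down from s to 0. The factor c goes
   -- through because it is symmetric in the variables concerned.
   ev-Tchain : ∀ j m → j ℕ.+ m ≡ s → ∀ {c} → (∀ k → k < s → swap k c ≈ c) → ∀ G → ev G ≈ c * V (interval 0 j ++ interval (suc j) m) →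
               ev (Tchain j G) ≈ c * V (interval 1 s)
   ev-Tchain zero m ≡.refl sc G h = h
   ev-Tchain (suc j) m j+m≡s {c} sc G h = ev-Tchain j (suc m) (≡.trans (ℕP.+-suc j m) j+m≡s) sc (Ti (suc j) G)
     (Swap.↝-functional j refl (ev-Ti j j<s G) (Swap.↝-cong j (sym h) (*-congˡ (reflexive (≡.cong V moved))) (Swap.↝-* j (sc j j<s) exchange)))
     where
     j<s : j < s
     j<s = ≡.subst (suc j ≤_) j+m≡s (ℕP.m≤m+n (suc j) m)
     w = interval 0 (suc j) ++ interval (suc (suc j)) m
     split : w ≡ interval 0 j ++ j ∷ interval (suc (suc j)) m
     split = ≡.trans (≡.cong (_++ interval (suc (suc j)) m) (interval-snoc 0 j)) (ListP.++-assoc (interval 0 j) (j ∷ []) _)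
     distinct : Distinct w
     distinct c with c ℕP.≤? j
     ... | yes c≤j = ≡.subst (_≤ 1) (≡.sym (≡.trans (mult-++ c (interval 0 (suc j)) _) (≡.trans (≡.cong (mult c (interval 0 (suc j)) ℕ.+_) (mult-interval-< m (ℕP.m<n⇒m<1+n (s≤s c≤j)))) (ℕP.+-identityʳ _)))) (Distinct-interval 0 (suc j) c)
     ... | no c≰j = ≡.subst (_≤ 1) (≡.sym (≡.trans (mult-++ c (interval 0 (suc j)) _) (≡.cong (ℕ._+ mult c (interval (suc (suc j)) m)) (mult-interval-≥ 0 (suc j) (ℕP.≰⇒> c≰j))))) (Distinct-interval (suc (suc j)) m c)
     exchange : Swap._↝_ j (V w) (V (map (transposition j) w))
     exchange = W.Exchange.Exchangeable.last (exchangeable N es j (ℕP.≤-<-trans j<s s<N)) w (interval 0 j) (interval (suc (suc j)) m) split distinct (mult-interval-< m (ℕP.n<1+n (suc j)))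
     moved : map (transposition j) w ≡ interval 0 j ++ suc j ∷ interval (suc (suc j)) m
     moved = ≡.trans (≡.cong (map (transposition j)) split) (≡.trans (ListP.map-++ (transposition j) (interval 0 j) _)
       (≡.cong₂ _++_ (map-σ-fixed j (interval 0 j) (mult-interval-≥ 0 j ℕP.≤-refl) (mult-interval-≥ 0 j (ℕP.n≤1+n j)))
         (≡.cong₂ _∷_ (σ-k j) (map-σ-fixed j (interval (suc (suc j)) m) (mult-interval-< m (ℕP.m<n⇒m<1+n (ℕP.n<1+n j))) (mult-interval-< m (ℕP.n<1+n (suc j)))))))

   ev-dPlus : ev (dPlus s F) ≈ - (monomial (suc s) * triangular s * V (interval 1 s))
   ev-dPlus = trans (eval-neg _ _ (Tchain s (xVar (suc s) *P liftP s F))) (-‿cong (ev-Tchain s 0 (ℕP.+-identityʳ s)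
     (λ k k<s → trans (Swap.*-homo k _ _) (*-cong (monomial-symmetric k (suc s) (s≤s k<s)) (triangular-symmetric k s)))
     (xVar (suc s) *P liftP s F) (begin
       ev (xVar (suc s) *P liftP s F)  ≈⟨ eval-* _ _ (xVar (suc s)) (liftP s F) ⟩
       ev (xVar (suc s)) * ev (liftP s F)
         ≈⟨ *-cong (trans (eval-xVar X (tail-power (suc s) N) s) (reflexive (generic-< {suc s} {N} (ℕP.n<1+n s)))) (trans ev-lift (eval-≈ rep N B≤N X (λ i i<s → reflexive (generic-< {suc s} {N} (ℕP.m<n⇒m<1+n i<s))))) ⟩
       var s * (monomial s * triangular s * V (interval 0 s))
         ≈⟨ solve 4 (λ x m u v → x :* (m :* u :* v) := m :* x :* u :* v) refl (var s) (monomial s) (triangular s) (V (interval 0 s)) ⟩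
       monomial (suc s) * triangular s * V (interval 0 s)
         ≈⟨ *-congˡ (reflexive (≡.cong V (≡.sym (ListP.++-identityʳ (interval 0 s))))) ⟩
       monomial (suc s) * triangular s * V (interval 0 s ++ [])  ∎)))

   -- The two signs cancel, and t^(-s) is the factor that `triangular (suc s)` has beyond
   -- `triangular s`.
   ev-ePlus : ev (ePlus s F) ≈ prefix (suc s) * W.family N (evE ∷ es) (interval 0 (suc s))
   ev-ePlus = begin
     ev (ePlus s F)                 ≈⟨ trans (eval-neg _ _ (tPow (ℤ.- (+ s)) *P dPlus s F)) (-‿cong (eval-* _ _ (tPow (ℤ.- (+ s))) (dPlus s F))) ⟩
     - (ev (tPow (ℤ.- (+ s))) * ev (dPlus s F))
       ≈⟨ -‿cong (*-cong (trans (eval-scalar X (tail-power (suc s) N) 1ℚ (ℤ.- (+ s))) (τ-^ s)) ev-dPlus) ⟩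
     - (t⁻¹ ^ s * - (monomial (suc s) * triangular s * V (interval 1 s)))
       ≈⟨ solve 4 (λ i m u v → :- (i :* :- (m :* u :* v)) := m :* (u :* i) :* v) refl (t⁻¹ ^ s) (monomial (suc s)) (triangular s) (V (interval 1 s)) ⟩
     prefix (suc s) * V (interval 1 s)  ∎

  represents-ePlus : Represents (suc s) B (evE ∷ es) (ePlus s F)
  represents-ePlus = represents-generic s<B ev-ePlus

 dot-cong : ∀ us {f g} → (∀ j → f j ≈ g j) → dot us f ≈ dot us g
 dot-cong [] h = refl
 dot-cong (u ∷ us) h = +-cong (*-congˡ (h 0)) (dot-cong us (h ∘ suc))

 dot-* : ∀ us c f → dot us (λ j → c * f j) ≈ c * dot us f
 dot-* [] c f = sym (zeroʳ c)
 dot-* (u ∷ us) c f = trans (+-congˡ (dot-* us c (f ∘ suc)))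
   (solve 4 (λ u c f d → u :* (c :* f) :+ c :* d := c :* (u :* f :+ d)) refl u c (f 0) (dot us (f ∘ suc)))

 dot-+ : ∀ us f g → dot us (λ j → f j + g j) ≈ dot us f + dot us g
 dot-+ [] f g = sym (+-identityˡ 0#)
 dot-+ (u ∷ us) f g = trans (+-congˡ (dot-+ us (f ∘ suc) (g ∘ suc)))
   (solve 5 (λ u f g d e → u :* (f :+ g) :+ (d :+ e) := u :* f :+ d :+ (u :* g :+ e)) refl u (f 0) (g 0) (dot us (f ∘ suc)) (dot us (g ∘ suc)))

 sumTo-+ : ∀ n f g → sumTo n (λ i → f i + g i) ≈ sumTo n f + sumTo n g
 sumTo-+ zero f g = sym (+-identityˡ 0#)
 sumTo-+ (suc n) f g = trans (+-congʳ (sumTo-+ n f g)) (solve 4 (λ p q r s → p :+ q :+ (r :+ s) := p :+ r :+ (q :+ s)) refl _ _ _ _)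

 sumTo-split : ∀ r n f → sumTo (r ℕ.+ n) f ≈ sumTo r f + sumTo n (λ i → f (r ℕ.+ i))
 sumTo-split r zero f = trans (reflexive (≡.cong (λ m → sumTo m f) (ℕP.+-identityʳ r))) (sym (+-identityʳ _))
 sumTo-split r (suc n) f = trans (reflexive (≡.cong (λ m → sumTo m f) (ℕP.+-suc r n))) (trans (+-congʳ (sumTo-split r n f)) (+-assoc _ _ _))

 sumTo-0 : ∀ n {f} → (∀ i → i < n → f i ≈ 0#) → sumTo n f ≈ 0#
 sumTo-0 zero h = refl
 sumTo-0 (suc n) h = trans (+-cong (sumTo-0 n (λ i i<n → h i (ℕP.m<n⇒m<1+n i<n))) (h n (ℕP.n<1+n n))) (+-identityˡ 0#)

 module UEval (X P : ℕ → Carrier) where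
  ev = eval X P

  coefficients : UPoly → List Carrier
  coefficients = map ev

  at : UPoly → Carrier → Carrier
  at U z = dot (coefficients U) (z ^_)

  at-+U : ∀ p q z → at (p +U q) z ≈ at p z + at q z
  at-+U p q z = go p q (z ^_)
   where
   go : ∀ p q f → dot (coefficients (p +U q)) f ≈ dot (coefficients p) f + dot (coefficients q) f
   go [] q f = sym (+-identityˡ _)
   go (a ∷ p) [] f = sym (+-identityʳ _)
   go (a ∷ p) (b ∷ q) f = trans (+-cong (*-congʳ (eval-++ X P a b)) (go p q (f ∘ suc)))
     (solve 5 (λ a b f d e → (a :+ b) :* f :+ (d :+ e) := a :* f :+ d :+ (b :* f :+ e)) refl (ev a) (ev b) (f 0) _ _)

  at-scale : ∀ a q z → at (map (a *P_) q) z ≈ ev a * at q z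
  at-scale a q z = go q (z ^_)
   where
   go : ∀ q f → dot (coefficients (map (a *P_) q)) f ≈ ev a * dot (coefficients q) f
   go [] f = sym (zeroʳ _)
   go (b ∷ q) f = trans (+-cong (*-congʳ (eval-* X P a b)) (go q (f ∘ suc)))
     (solve 4 (λ a b f d → a :* b :* f :+ a :* d := a :* (b :* f :+ d)) refl (ev a) (ev b) (f 0) _)

  at-∷ : ∀ a p z → at (a ∷ p) z ≈ ev a + z * at p z
  at-∷ a p z = +-cong (*-identityʳ _) (dot-* (coefficients p) z (z ^_))

  at-*U : ∀ p q z → at (p *U q) z ≈ at p z * at q z
  at-*U [] q z = sym (zeroˡ _)
  at-*U (a ∷ p) q z = begin
    at (map (a *P_) q +U ([] ∷ (p *U q))) z             ≈⟨ at-+U (map (a *P_) q) ([] ∷ (p *U q)) z ⟩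
    at (map (a *P_) q) z + at ([] ∷ (p *U q)) z         ≈⟨ +-cong (at-scale a q z) (trans (at-∷ [] (p *U q) z) (+-congˡ (*-congˡ (at-*U p q z)))) ⟩
    ev a * at q z + (0# + z * (at p z * at q z))
      ≈⟨ solve 4 (λ a q z p → a :* q :+ (con (+ 0) :+ z :* (p :* q)) := (a :+ z :* p) :* q) refl (ev a) (at q z) z (at p z) ⟩
    (ev a + z * at p z) * at q z                        ≈⟨ *-congʳ (sym (at-∷ a p z)) ⟩
    at (a ∷ p) z * at q z                               ∎

  at-oneU : ∀ z → at oneU z ≈ 1#
  at-oneU z = trans (+-identityʳ _) (trans (*-identityʳ _) (eval-one X P))

  at-powU : ∀ p n z → at (powU p n) z ≈ at p z ^ n
  at-powU p zero z = at-oneU z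
  at-powU p (suc n) z = trans (at-*U p (powU p n) z) (*-congˡ (at-powU p n z))

  at-pMinusU : ∀ k z → at (pMinusU (suc k)) z ≈ P k - z ^ suc k
  at-pMinusU k z = trans (at-∷ (pVar (suc k)) (replicate k [] ++ (negP one ∷ [])) z)
    (+-cong (eval-pVar X P k) (trans (*-congˡ (shifted k)) (solve 2 (λ z p → z :* (:- p) := :- (z :* p)) refl z (z ^ k))))
   where
   shifted : ∀ k → at (replicate k [] ++ (negP one ∷ [])) z ≈ - z ^ k
   shifted zero = trans (+-identityʳ _) (trans (*-identityʳ _) (trans (eval-neg X P one) (-‿cong (eval-one X P))))
   shifted (suc k) = trans (at-∷ [] (replicate k [] ++ (negP one ∷ [])) z) (trans (+-identityˡ _) (trans (*-congˡ (shifted k))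
     (solve 2 (λ z p → z :* (:- p) := :- (z :* p)) refl z (z ^ k))))

  at-plethMinusU : ∀ k es z → at (plethMinusU (suc k) es) z ≈ prodE (λ j → P (k ℕ.+ j) - z ^ suc (k ℕ.+ j)) es
  at-plethMinusU k [] z = at-oneU z
  at-plethMinusU k (e ∷ es) z = trans (at-*U (powU (pMinusU (suc k)) e) (plethMinusU (suc (suc k)) es) z)
    (*-cong (trans (at-powU (pMinusU (suc k)) e z) (^-congˡ e (trans (at-pMinusU k z) (reflexive (≡.cong (λ j → P j - z ^ suc j) (≡.sym (ℕP.+-identityʳ k)))))))
            (trans (at-plethMinusU (suc k) es z) (prodE-cong es (λ j → ^-congˡ (getE es j) (reflexive (≡.cong (λ l → P l - z ^ suc l) (≡.sym (ℕP.+-suc k j))))))))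

  module Fixed {k : ℕ} (P-fixed : ∀ i → swap k (P i) ≈ P i) where
   open Swap k

   SymmetricU : UPoly → Set
   SymmetricU U = All (λ u → swap k u ≈ u) (coefficients U)

   +U-symmetric : ∀ {p q} → SymmetricU p → SymmetricU q → SymmetricU (p +U q)
   +U-symmetric {[]} _ sq = sq
   +U-symmetric {a ∷ p} {[]} sp _ = sp
   +U-symmetric {a ∷ p} {b ∷ q} (sa ∷ sp) (sb ∷ sq) =
     trans (⟦⟧-cong (eval-++ X P a b)) (trans (+-homo _ _) (trans (+-cong sa sb) (sym (eval-++ X P a b)))) ∷ +U-symmetric {p} {q} sp sq

   scale-symmetric : ∀ {a q} → swap k (ev a) ≈ ev a → SymmetricU q → SymmetricU (map (a *P_) q)
   scale-symmetric {a} {[]} sa [] = []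
   scale-symmetric {a} {b ∷ q} sa (sb ∷ sq) =
     trans (⟦⟧-cong (eval-* X P a b)) (trans (*-homo _ _) (trans (*-cong sa sb) (sym (eval-* X P a b)))) ∷ scale-symmetric {a} {q} sa sq

   *U-symmetric : ∀ {p q} → SymmetricU p → SymmetricU q → SymmetricU (p *U q)
   *U-symmetric {[]} _ _ = []
   *U-symmetric {a ∷ p} {q} (sa ∷ sp) sq = +U-symmetric {map (a *P_) q} (scale-symmetric {a} {q} sa sq) (0#-homo ∷ *U-symmetric {p} {q} sp sq)

   swap-one : swap k (ev one) ≈ ev one
   swap-one = trans (⟦⟧-cong (eval-one X P)) (trans 1#-homo (sym (eval-one X P)))

   oneU-symmetric : SymmetricU oneU
   oneU-symmetric = swap-one ∷ []

   powU-symmetric : ∀ {p} n → SymmetricU p → SymmetricU (powU p n)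
   powU-symmetric zero _ = oneU-symmetric
   powU-symmetric {p} (suc n) sp = *U-symmetric {p} sp (powU-symmetric n sp)

   pMinusU-symmetric : ∀ i → SymmetricU (pMinusU (suc i))
   pMinusU-symmetric i = trans (⟦⟧-cong (eval-pVar X P i)) (trans (P-fixed i) (sym (eval-pVar X P i))) ∷ rest i
    where
    rest : ∀ n → SymmetricU (replicate n [] ++ (negP one ∷ []))
    rest zero = trans (⟦⟧-cong (eval-neg X P one)) (trans (-‿homo _) (trans (-‿cong swap-one) (sym (eval-neg X P one)))) ∷ []
    rest (suc n) = 0#-homo ∷ rest n

   plethMinusU-symmetric : ∀ i es → SymmetricU (plethMinusU (suc i) es)
   plethMinusU-symmetric i [] = oneU-symmetric
   plethMinusU-symmetric i (e ∷ es) = *U-symmetric {powU (pMinusU (suc i)) e} (powU-symmetric {pMinusU (suc i)} e (pMinusU-symmetric i)) (plethMinusU-symmetric (suc i) es)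

 module Lowering (r N : ℕ) (r<N : r < N) where
  private
   n = N ∸ r
   X = generic r N
   P = tail-power r N
  open UEval X P

  mutual
   -- Both sides satisfy Newton's recursion, and the reciprocal of m makes its solution unique.
   ev-H : ∀ m → ev (H m) ≈ complete r n m
   ev-H zero = trans (eval-one X P) (reflexive (≡.sym (complete-0 r n)))
   ev-H (suc m) = begin
     ev (scaleP (+ 1 ℚ./ suc m) (newtonSum 1 (Hlist m)))      ≈⟨ eval-scale X P (+ 1 ℚ./ suc m) (newtonSum 1 (Hlist m)) ⟩
     c * ev (newtonSum 1 (Hlist m))                           ≈⟨ *-congˡ (trans (ev-newtonSum m 0) (sym (complete-Newton r n (suc m)))) ⟩
     c * ((suc m · 1#) * complete r n (suc m))                ≈⟨ sym (*-assoc _ _ _) ⟩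
     c * (suc m · 1#) * complete r n (suc m)                  ≈⟨ trans (*-congʳ (κ-reciprocal m)) (*-identityˡ _) ⟩
     complete r n (suc m)                                     ∎
     where c = κ (+ 1 ℚ./ suc m) (+ 0)

   ev-newtonSum : ∀ m k → ev (newtonSum (suc k) (Hlist m)) ≈ conv (λ j → (1# - t ^ suc (k ℕ.+ j)) * powerSum r n (suc (k ℕ.+ j))) (complete r n) (suc m)
   ev-newtonSum zero k = trans (eval-++ X P (((one -P tPow (+ suc k)) *P pVar (suc k)) *P one) []) (+-congʳ (trans (eval-* X P ((one -P tPow (+ suc k)) *P pVar (suc k)) one)
     (*-cong (trans (ev-power k) (reflexive (≡.cong (λ l → (1# - t ^ suc l) * powerSum r n (suc l)) (≡.sym (ℕP.+-identityʳ k))))) (ev-H 0))))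
   ev-newtonSum (suc m) k = trans (eval-++ X P (((one -P tPow (+ suc k)) *P pVar (suc k)) *P H (suc m)) (newtonSum (suc (suc k)) (Hlist m)))
     (+-cong (trans (eval-* X P ((one -P tPow (+ suc k)) *P pVar (suc k)) (H (suc m)))
       (*-cong (trans (ev-power k) (reflexive (≡.cong (λ l → (1# - t ^ suc l) * powerSum r n (suc l)) (≡.sym (ℕP.+-identityʳ k))))) (ev-H (suc m))))
       (trans (ev-newtonSum m (suc k)) (conv-cong (λ j → reflexive (≡.cong (λ l → (1# - t ^ suc l) * powerSum r n (suc l)) (≡.sym (ℕP.+-suc k j)))) (λ _ → refl) (suc m))))

   ev-power : ∀ k → ev ((one -P tPow (+ suc k)) *P pVar (suc k)) ≈ (1# - t ^ suc k) * powerSum r n (suc k)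
   ev-power k = trans (eval-* X P (one -P tPow (+ suc k)) (pVar (suc k))) (*-cong
     (trans (eval-++ X P one (negP (tPow (+ suc k)))) (+-cong (eval-one X P) (trans (eval-neg X P (tPow (+ suc k))) (-‿cong (trans (eval-scalar X P 1ℚ (+ suc k)) (τ-+^ (suc k)))))))
     (eval-pVar X P k))

  ev-sumU : ∀ m U → ev (sumU m U) ≈ dot (coefficients U) (λ j → complete r n (m ℕ.+ j))
  ev-sumU m [] = refl
  ev-sumU m (c ∷ U) = trans (eval-++ X P (c *P H m) (sumU (suc m) U)) (+-cong (trans (eval-* X P c (H m))
    (*-congˡ (trans (ev-H m) (reflexive (≡.cong (complete r n) (≡.sym (ℕP.+-identityʳ m)))))))
    (trans (ev-sumU (suc m) U) (dot-cong (coefficients U) (λ j → reflexive (≡.cong (complete r n) (≡.sym (ℕP.+-suc m j)))))))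

  coefficient : ℚ → ℤ → List ℕ → Carrier
  coefficient c a xe = κ c a * prodE X (setE xe r 0)

  -- Substituting p_k - u^k for p_k, and u for x_{r+1}, expands F in powers of u with coefficients
  -- symmetric in x_{r+1}, ..., x_N; here u^m is replaced by `f m`. The value of F, the value of d₋
  -- F and all summands in between thereby become instances of one map that is linear in f.
  spread : (ℕ → Carrier) → Poly → Carrier
  spread f [] = 0#
  spread f ((c , mono a xe pe) ∷ F) = coefficient c a xe * dot (coefficients (plethMinusU 1 pe)) (λ j → f (getE xe r ℕ.+ j)) + spread f F

  spread-cong : ∀ {f g} → (∀ m → f m ≈ g m) → ∀ F → spread f F ≈ spread g F
  spread-cong h [] = refl
  spread-cong h ((c , mono a xe pe) ∷ F) = +-cong (*-congˡ (dot-cong (coefficients (plethMinusU 1 pe)) (λ j → h (getE xe r ℕ.+ j)))) (spread-cong h F)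

  spread-* : ∀ c f F → spread (λ m → c * f m) F ≈ c * spread f F
  spread-* c f [] = sym (zeroʳ c)
  spread-* c f ((d , mono a xe pe) ∷ F) = trans (+-cong (*-congˡ (dot-* (coefficients (plethMinusU 1 pe)) c _)) (spread-* c f F))
    (solve 4 (λ k c d s → k :* (c :* d) :+ c :* s := c :* (k :* d :+ s)) refl _ c _ _)

  spread-+ : ∀ f g F → spread (λ m → f m + g m) F ≈ spread f F + spread g F
  spread-+ f g [] = sym (+-identityˡ 0#)
  spread-+ f g ((d , mono a xe pe) ∷ F) = trans (+-cong (*-congˡ (dot-+ (coefficients (plethMinusU 1 pe)) _ _)) (spread-+ f g F))
    (solve 5 (λ k d e s u → k :* (d :+ e) :+ (s :+ u) := k :* d :+ s :+ (k :* e :+ u)) refl _ _ _ _ _)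

  spread-0 : ∀ F → spread (λ _ → 0#) F ≈ 0#
  spread-0 F = trans (spread-cong (λ _ → sym (zeroˡ 0#)) F) (trans (spread-* 0# (λ _ → 0#) F) (zeroˡ _))

  spread-sumTo : ∀ l (f : ℕ → Seq) F → spread (λ m → sumTo l (λ i → f i m)) F ≈ sumTo l (λ i → spread (f i) F)
  spread-sumTo zero f F = spread-0 F
  spread-sumTo (suc l) f F = trans (spread-+ _ _ F) (+-congʳ (spread-sumTo l f F))

  spread-complete : ∀ F → spread (complete r n) F ≈ ev (dMinus (suc r) F)
  spread-complete [] = refl
  spread-complete ((c , mono a xe pe) ∷ F) = sym (trans (eval-++ X P (((c , mono a (setE xe r 0) []) ∷ []) *P Bop (getE xe r) pe) (dMinus (suc r) F))
    (+-cong (trans (eval-* X P ((c , mono a (setE xe r 0) []) ∷ []) (Bop (getE xe r) pe))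
      (*-cong (trans (+-identityʳ _) (*-congˡ (*-identityʳ _))) (ev-sumU (getE xe r) (plethMinusU 1 pe)))) (sym (spread-complete F))))

  -- Writing p_k(x_{r+2}, …) as p_k(x_{r+1}, …) - x_{r+1}^k turns F into a polynomial in x_{r+1}.
  spread-powers : ∀ z {X' P'} → (∀ i → i ≢ r → X' i ≈ X i) → X' r ≈ z → (∀ k → P k ≈ z ^ suc k + P' k) →
                  ∀ F → spread (z ^_) F ≈ eval X' P' F
  spread-powers z hX hz hP [] = refl
  spread-powers z {X'} {P'} hX hz hP ((c , mono a xe pe) ∷ F) = +-cong (begin
    coefficient c a xe * dot (coefficients (plethMinusU 1 pe)) (λ j → z ^ (getE xe r ℕ.+ j))
      ≈⟨ *-congˡ (trans (dot-cong (coefficients (plethMinusU 1 pe)) (^-homo-* z (getE xe r))) (dot-* (coefficients (plethMinusU 1 pe)) (z ^ getE xe r) (z ^_))) ⟩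
    κ c a * prodE X (setE xe r 0) * (z ^ getE xe r * at (plethMinusU 1 pe) z)
      ≈⟨ *-congˡ (*-congˡ (trans (at-plethMinusU 0 pe z) (prodE-cong pe (λ k → ^-congˡ (getE pe k) (trans (+-congʳ (hP k))
           (solve 2 (λ u v → u :+ v :- u := v) refl (z ^ suc k) (P' k))))))) ⟩
    κ c a * prodE X (setE xe r 0) * (z ^ getE xe r * prodE P' pe)
      ≈⟨ solve 4 (λ k x z p → k :* x :* (z :* p) := k :* (z :* x :* p)) refl (κ c a) (prodE X (setE xe r 0)) (z ^ getE xe r) (prodE P' pe) ⟩
    κ c a * (z ^ getE xe r * prodE X (setE xe r 0) * prodE P' pe)
      ≈⟨ *-congˡ (*-congʳ (sym (trans (prodE-getE X' xe r) (*-cong (^-congˡ (getE xe r) hz) (prodE-cong (setE xe r 0) pointwise))))) ⟩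
    κ c a * (prodE X' xe * prodE P' pe)  ∎) (spread-powers z hX hz hP F)
    where
    pointwise : ∀ i → X' i ^ getE (setE xe r 0) i ≈ X i ^ getE (setE xe r 0) i
    pointwise i with r ℕP.≟ i
    ... | no r≢i = ^-congˡ (getE (setE xe r 0) i) (hX i (≡.≢-sym r≢i))
    ... | yes ≡.refl = trans (reflexive (≡.cong (X' r ^_) (getE-setE xe r 0))) (reflexive (≡.cong (X r ^_) (≡.sym (getE-setE xe r 0))))

  -- Setting x_{r+1} = 0 while keeping the power sums of x_{r+1}, ..., x_N extracts the constant
  -- term of the expansion behind `spread`: at u = 0 the substituted p_k - u^k is p_k.
  vanishing-part : Poly → Carrier
  vanishing-part = eval (λ i → if i ℕ.≡ᵇ r then 0# else X i) P

  spread-δ : ∀ F → spread δ F ≈ vanishing-part F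
  spread-δ F = trans (spread-cong δ-powers F) (spread-powers 0# {P' = P}
    (λ i i≢r → reflexive (if-¬T (i≢r ∘ ℕP.≡ᵇ⇒≡ i r))) (reflexive (if-T (ℕP.≡⇒≡ᵇ r r ≡.refl)))
    (λ k → sym (trans (+-congʳ (zeroˡ _)) (+-identityˡ _))) F)
   where
   δ-powers : ∀ m → δ m ≈ 0# ^ m
   δ-powers zero = refl
   δ-powers (suc m) = sym (zeroˡ _)

  spread-first : ∀ F → spread (increment r 0) F ≈ (1# - t) * eval (generic (suc r) N) (tail-power (suc r) N) F
  spread-first F = trans (spread-cong (λ m → trans (increment-first r m) (*-congˡ (^-congˡ m (reflexive (≡.cong var (ℕP.+-identityʳ r)))))) F)
    (trans (spread-* (1# - t) (var r ^_) F) (*-congˡ (spread-powers (var r) {X' = generic (suc r) N} {P' = tail-power (suc r) N} agree (reflexive (generic-< {suc r} {N} (ℕP.n<1+n r))) (tail-power-split r<N) F)))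

   where
   agree : ∀ i → i ≢ r → generic (suc r) N i ≈ generic r N i
   agree i i≢r with ℕP.<-cmp i r
   ... | tri< i<r _ _ = reflexive (≡.trans (generic-< {suc r} {N} (ℕP.m<n⇒m<1+n i<r)) (≡.sym (generic-< {r} {N} i<r)))
   ... | tri≈ _ i≡r _ = ⊥-elim (i≢r i≡r)
   ... | tri> _ _ r<i = reflexive (≡.trans (generic-≥ {suc r} {N} r<i) (≡.sym (generic-≥ {r} {N} (ℕP.<⇒≤ r<i))))

  spread-total : ∀ F → sumTo n (λ i → spread (increment r i) F) + t ^ n * vanishing-part F ≈ ev (dMinus (suc r) F)
  spread-total F = trans (+-cong (sym (spread-sumTo n (increment r) F)) (trans (*-congˡ (sym (spread-δ F))) (sym (spread-* (t ^ n) δ F))))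
    (trans (sym (spread-+ _ _ F)) (trans (spread-cong (increment-sum r n) F) (spread-complete F)))

  swap-P : ∀ i → suc i < n → ∀ k → swap (r ℕ.+ i) (P k) ≈ P k
  swap-P i i<n k = powerSum-within i r n (suc k) i<n

  -- The coefficients of the expansion are fixed by the swap, so t T⁻¹ acts on the increments alone.
  spread-⇝ : ∀ i → suc i < n → ∀ F → Swap._⇝_ (r ℕ.+ i) (spread (increment r i) F) (spread (increment r (suc i)) F)
  spread-⇝ i i<n [] = Swap.↝-0 (r ℕ.+ i)
  spread-⇝ i i<n ((c , mono a xe pe) ∷ F) = Swap.↝-+ (r ℕ.+ i) (Swap.↝-* (r ℕ.+ i) fixed
     (Symmetry.dot-⇝ (swap-isTransposition (r ℕ.+ i)) (coefficients (plethMinusU 1 pe)) (Fixed.plethMinusU-symmetric {r ℕ.+ i} (swap-P i i<n) 0 pe)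
       (λ j → Symmetry.increment-⇝ (swap-isTransposition (r ℕ.+ i)) r i ≡.refl (getE xe r ℕ.+ j)))) (spread-⇝ i i<n F)
   where
   bound : suc (r ℕ.+ i) < N
   bound = ≡.subst₂ _<_ (ℕP.+-suc r i) (ℕP.m+[n∸m]≡n (ℕP.<⇒≤ r<N)) (ℕP.+-monoʳ-< r i<n)
   fixed : swap (r ℕ.+ i) (coefficient c a xe) ≈ coefficient c a xe
   fixed = trans (*-homo _ _) (*-cong (swap-κ (r ℕ.+ i) c a) (trans (hom-prodE X (setE xe r 0)) (prodE-cong (setE xe r 0) pointwise)))
    where
    open Swap (r ℕ.+ i) using (*-homo; isHom)
    open Hom isHom (swap-κ (r ℕ.+ i))
    pointwise : ∀ j → swap (r ℕ.+ i) (X j) ^ getE (setE xe r 0) j ≈ X j ^ getE (setE xe r 0) j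
    pointwise j with ℕP.<-cmp j r
    ... | tri≈ _ ≡.refl _ = trans (reflexive (≡.cong (swap (r ℕ.+ i) (X r) ^_) (getE-setE xe r 0))) (reflexive (≡.cong (X r ^_) (≡.sym (getE-setE xe r 0))))
    ... | tri< j<r _ _ = ^-congˡ (getE (setE xe r 0) j) (swap-generic (r ℕ.+ i) r N bound j
            (ℕP.<⇒≢ (ℕP.<-≤-trans j<r (ℕP.m≤m+n r i))) (ℕP.<⇒≢ (ℕP.m<n⇒m<1+n (ℕP.<-≤-trans j<r (ℕP.m≤m+n r i)))))
    ... | tri> _ _ r<j = ^-congˡ (getE (setE xe r 0) j) (trans (Swap.⟦⟧-cong (r ℕ.+ i) (reflexive (generic-≥ {r} {N} (ℕP.<⇒≤ r<j))))
            (trans (Swap.s-x (r ℕ.+ i) (≡.≢-sym (ℕP.<⇒≢ (ℕP.<-≤-trans (ℕP.<-trans (ℕP.n<1+n _) bound) (ℕP.m≤m+n N j)))) (≡.≢-sym (ℕP.<⇒≢ (ℕP.<-≤-trans bound (ℕP.m≤m+n N j)))))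
              (reflexive (≡.sym (generic-≥ {r} {N} (ℕP.<⇒≤ r<j))))))

 module NorthStep {r B : ℕ} {es : List Ev} {F : Poly} (r<B : r < B) (rep : Represents (suc r) B es F) where

  module _ (N : ℕ) (B≤N : B ≤ N) where
   private
    r<N : r < N
    r<N = ℕP.≤-trans r<B B≤N
    n = N ∸ r
    V = W.family N es
    w = interval 0 r
   open Lowering r N r<N

   -- In N variables d₋ F differs from its stable form by t^n F|_{x_{r+1} = 0}, and the
   -- divisibility of F by x_{r+1} in N + 1 variables shows that this term is zero.
   vanishing-part-0 : vanishing-part F ≈ 0#
   vanishing-part-0 = begin
     vanishing-part F   ≈⟨ eval-cong (λ i → sym (images i)) (λ k → sym (tails k)) F ⟩
     eval (subst y ∘ generic (suc r) N) (subst y ∘ tail-power (suc r) (suc N)) F  ≈⟨ sym (hom-eval (generic (suc r) N) (tail-power (suc r) (suc N)) F) ⟩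
     subst y (eval (generic (suc r) N) (tail-power (suc r) (suc N)) F)
       ≈⟨ ⟦⟧-cong (eval-≈ rep (suc N) (ℕP.m≤n⇒m≤1+n B≤N) (generic (suc r) N) (λ i i<1+r → reflexive (generic-< {suc r} {N} i<1+r))) ⟩
     subst y (monomial r * var r * triangular (suc r) * V₊)
       ≈⟨ ⟦⟧-cong (solve 4 (λ m x u v → m :* x :* u :* v := x :* (m :* u :* v)) refl (monomial r) (var r) (triangular (suc r)) V₊) ⟩
     subst y (var r * (monomial r * triangular (suc r) * V₊))
       ≈⟨ trans (*-homo _ _) (*-congʳ (trans (subst-var y r) (reflexive (if-T (ℕP.≡⇒≡ᵇ r r ≡.refl))))) ⟩
     0# * subst y (monomial r * triangular (suc r) * V₊)   ≈⟨ zeroˡ _ ⟩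
     0#                                                    ∎
    where
    V₊ = W.family (suc N) es (interval 0 (suc r))
    y : ℕ → Carrier
    -- The substitution deletes x_{r+1} and puts it in the place of the additional last variable, so
    -- that the power sums of x_{r+2}, ..., x_{N+1} become those of x_{r+1}, ..., x_N, as
    -- `vanishing-part` requires.
    y j = if j ℕ.≡ᵇ r then 0# else if j ℕ.≡ᵇ N then var r else var j
    open Substitution y
    y-other : ∀ {j} → j ≢ r → j ≢ N → subst y (var j) ≈ var j
    y-other {j} j≢r j≢N = trans (subst-var y j) (reflexive (≡.trans (if-¬T (j≢r ∘ ℕP.≡ᵇ⇒≡ j r)) (if-¬T (j≢N ∘ ℕP.≡ᵇ⇒≡ j N))))
    y-N : subst y (var N) ≈ var r
    y-N = trans (subst-var y N) (reflexive (≡.trans (if-¬T (λ p → ℕP.<⇒≢ r<N (≡.sym (ℕP.≡ᵇ⇒≡ N r p)))) (if-T (ℕP.≡⇒≡ᵇ N N ≡.refl))))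
    images : ∀ i → subst y (generic (suc r) N i) ≈ (if i ℕ.≡ᵇ r then 0# else generic r N i)
    images i with ℕP.<-cmp i r
    ... | tri< i<r i≢r _ = trans (⟦⟧-cong (reflexive (generic-< {suc r} {N} (ℕP.m<n⇒m<1+n i<r))))
            (trans (y-other i≢r (ℕP.<⇒≢ (ℕP.<-trans i<r r<N))) (reflexive (≡.sym (≡.trans (if-¬T (i≢r ∘ ℕP.≡ᵇ⇒≡ i r)) (generic-< {r} {N} i<r)))))
    ... | tri≈ _ ≡.refl _ = trans (⟦⟧-cong (reflexive (generic-< {suc r} {N} (ℕP.n<1+n r)))) (trans (subst-var y r) (reflexive (≡.trans (if-T (ℕP.≡⇒≡ᵇ r r ≡.refl)) (≡.sym (if-T (ℕP.≡⇒≡ᵇ r r ≡.refl))))))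
    ... | tri> _ i≢r r<i = trans (⟦⟧-cong (reflexive (generic-≥ {suc r} {N} r<i)))
            (trans (y-other (≡.≢-sym (ℕP.<⇒≢ (ℕP.<-≤-trans r<N (ℕP.m≤m+n N i)))) (≡.≢-sym (ℕP.<⇒≢ (ℕP.m<m+n N (ℕP.≤-<-trans z≤n r<i)))))
              (reflexive (≡.sym (≡.trans (if-¬T (i≢r ∘ ℕP.≡ᵇ⇒≡ i r)) (generic-≥ {r} {N} (ℕP.<⇒≤ r<i))))))
    tails : ∀ k → subst y (tail-power (suc r) (suc N) k) ≈ tail-power r N k
    tails k = begin
      subst y (powerSum (suc r) (N ∸ r) (suc k))  ≈⟨ ⟦⟧-cong (reflexive (≡.cong (λ m → powerSum (suc r) m (suc k)) (∸-suc r<N))) ⟩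
      subst y (powerSum (suc r) m (suc k) + var (suc r ℕ.+ m) ^ suc k)
        ≈⟨ trans (+-homo _ _) (+-cong
             (trans (hom-sumTo m _) (sumTo-cong m (λ i i<m → trans (hom-^ _ (suc k)) (^-congˡ (suc k) (y-other (≡.≢-sym (ℕP.<⇒≢ (ℕP.m≤m+n (suc r) i))) (ℕP.<⇒≢ (≡.subst (suc r ℕ.+ i <_) top (ℕP.+-monoʳ-< (suc r) i<m))))))))
             (trans (hom-^ _ (suc k)) (^-congˡ (suc k) (trans (⟦⟧-cong (reflexive (≡.cong var top))) y-N)))) ⟩
      powerSum (suc r) m (suc k) + var r ^ suc k  ≈⟨ +-comm _ _ ⟩
      var r ^ suc k + tail-power (suc r) N k      ≈⟨ sym (tail-power-split r<N k) ⟩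
      tail-power r N k                            ∎
      where
      m = N ∸ suc r
      top : suc r ℕ.+ m ≡ N
      top = ℕP.m+[n∸m]≡n r<N

   summand : ℕ → Carrier
   summand i = prefix r * ((1# - t) * t⁻¹ ^ r * (var (r ℕ.+ i) * V (w ++ r ℕ.+ i ∷ [])))

   summand-⇝ : ∀ i → suc i < n → Swap._⇝_ (r ℕ.+ i) (summand i) (summand (suc i))
   summand-⇝ i i<n = Swap.↝-* k (prefix-small k r (ℕP.m≤m+n r i)) (Swap.↝-* k (trans (Swap.*-homo k _ _) (*-cong (Swap.s-1-t k) (swap-t⁻¹^ k r)))
     (≡.subst (λ c → Swap._⇝_ k (var k * V (w ++ k ∷ [])) (var c * V (w ++ c ∷ []))) (≡.sym (ℕP.+-suc r i)) (Swap.↝⇒⇝ k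
       (Swap.↝-cong k refl (reflexive (≡.cong V moved)) (W.Exchange.Exchangeable.last (exchangeable N es k bound) (w ++ k ∷ []) w [] ≡.refl (Distinct-snoc {w} (Distinct-interval 0 r) fresh) ≡.refl)))))
    where
    k = r ℕ.+ i
    bound : suc k < N
    bound = ≡.subst₂ _<_ (ℕP.+-suc r i) (ℕP.m+[n∸m]≡n (ℕP.<⇒≤ r<N)) (ℕP.+-monoʳ-< r i<n)
    fresh : mult k w ≡ 0
    fresh = mult-interval-≥ 0 r (ℕP.m≤m+n r i)
    moved : map (transposition k) (w ++ k ∷ []) ≡ w ++ suc k ∷ []
    moved = ≡.trans (ListP.map-++ (transposition k) w (k ∷ []))
      (≡.cong₂ _++_ (map-σ-fixed k w fresh (mult-interval-≥ 0 r (ℕP.m≤n⇒m≤1+n (ℕP.m≤m+n r i)))) (≡.cong (_∷ []) (σ-k k)))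

   -- Both sequences start with 1 - t times the value of F and are continued by the same operators t
   -- T⁻¹, which are single-valued by cancellation.
   spread-summand : ∀ i → i < n → spread (increment r i) F ≈ summand i
   spread-summand zero _ = trans (spread-first F) (trans (*-congˡ (eval-≈ rep N B≤N (generic (suc r) N) (λ i i<1+r → reflexive (generic-< {suc r} {N} i<1+r))))
     (trans (*-congˡ (*-congˡ (reflexive (≡.cong V (interval-snoc 0 r)))))
     (trans (solve 6 (λ o m x u p v → o :* (m :* x :* (u :* p) :* v) := m :* u :* (o :* p :* (x :* v))) refl (1# - t) (monomial r) (var r) (triangular r) (t⁻¹ ^ r) (V (w ++ r ∷ [])))
       (reflexive (≡.cong (λ c → prefix r * ((1# - t) * t⁻¹ ^ r * (var c * V (w ++ c ∷ [])))) (≡.sym (ℕP.+-identityʳ r)))))))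
   spread-summand (suc i) i<n = Swap.↝-functional (r ℕ.+ i) (spread-summand i (ℕP.<-trans (ℕP.n<1+n i) i<n)) (spread-⇝ i i<n F) (summand-⇝ i i<n)

   -- Colours below r are old and have weight zero; every other colour exceeds the whole window,
   -- whence the uniform factor t^(-r).
   sum-summand : sumTo n summand ≈ prefix r * W.opN N V w
   sum-summand = trans (sumTo-* (prefix r) n _) (*-congˡ (sym (begin
     sumTo N full                                     ≈⟨ reflexive (≡.cong (λ m → sumTo m full) (≡.sym (ℕP.m+[n∸m]≡n (ℕP.<⇒≤ r<N)))) ⟩
     sumTo (r ℕ.+ n) full                             ≈⟨ sumTo-split r n full ⟩
     sumTo r full + sumTo n (λ i → full (r ℕ.+ i))    ≈⟨ +-cong (sumTo-0 r (λ c c<r → trans (*-congʳ (trans (*-congʳ (W.weight-old N w c (mult-interval r c<r))) (zeroˡ _))) (zeroˡ _))) (sumTo-cong n (λ i _ → new i)) ⟩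
     0# + sumTo n (λ i → (1# - t) * t⁻¹ ^ r * (var (r ℕ.+ i) * V (w ++ r ℕ.+ i ∷ [])))  ≈⟨ +-identityˡ _ ⟩
     sumTo n (λ i → (1# - t) * t⁻¹ ^ r * (var (r ℕ.+ i) * V (w ++ r ℕ.+ i ∷ [])))       ∎)))
    where
    full : ℕ → Carrier
    full c = W.weight N w c * var c * V (w ++ c ∷ [])
    new : ∀ i → full (r ℕ.+ i) ≈ (1# - t) * t⁻¹ ^ r * (var (r ℕ.+ i) * V (w ++ r ℕ.+ i ∷ []))
    new i = trans (*-congʳ (*-congʳ (trans (W.weight-new N w (r ℕ.+ i) (mult-interval-≥ 0 r (ℕP.m≤m+n r i)))
        (trans (*-congʳ (reflexive (≡.cong (t⁻¹ ^_) (below-interval (r ℕ.+ i) r (ℕP.m≤m+n r i))))) (*-comm _ _))))) (*-assoc _ _ _)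

   eval-dMinus : eval (generic r N) (tail-power r N) (dMinus (suc r) F) ≈ prefix r * W.family N (evN ∷ es) w
   eval-dMinus = begin
     eval (generic r N) (tail-power r N) (dMinus (suc r) F)                       ≈⟨ sym (spread-total F) ⟩
     sumTo n (λ i → spread (increment r i) F) + t ^ n * vanishing-part F         ≈⟨ +-cong (sumTo-cong n spread-summand) (trans (*-congˡ vanishing-part-0) (zeroʳ _)) ⟩
     sumTo n summand + 0#                                                         ≈⟨ trans (+-identityʳ _) sum-summand ⟩
     prefix r * W.family N (evN ∷ es) w                                           ∎

  represents-dMinus : Represents r B (evN ∷ es) (dMinus (suc r) F)
  represents-dMinus = represents-generic (ℕP.<⇒≤ r<B) eval-dMinus

 -- `run` applies the operator of the first event last. In terms of the forward list this is a
 -- recursion on the head, parallel to that of `family`.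
 backward : List Ev → Poly
 backward es = run (reverse es) 0 one

 stepEv : Ev → ℕ → Poly → Poly
 stepEv evE = ePlus
 stepEv evN = dMinus
 stepEv evM s f = tPow (+ 1) *P markedNum s f

 level : List Ev → ℕ → ℕ
 level [] s = s
 level (evE ∷ es) s = level es (suc s)
 level (evN ∷ es) s = level es (s ∸ 1)
 level (evM ∷ es) s = level es s

 run-snoc : ∀ es e s f → run (es ++ e ∷ []) s f ≡ stepEv e (level es s) (run es s f)
 run-snoc [] evE s f = ≡.refl
 run-snoc [] evN s f = ≡.refl
 run-snoc [] evM s f = ≡.refl
 run-snoc (evE ∷ es) e s f = run-snoc es e (suc s) (ePlus s f)
 run-snoc (evN ∷ es) e s f = run-snoc es e (s ∸ 1) (dMinus s f)
 run-snoc (evM ∷ es) e s f = run-snoc es e s (tPow (+ 1) *P markedNum s f)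

 level-++ : ∀ es es' s → level (es ++ es') s ≡ level es' (level es s)
 level-++ [] es' s = ≡.refl
 level-++ (evE ∷ es) es' s = level-++ es es' (suc s)
 level-++ (evN ∷ es) es' s = level-++ es es' (s ∸ 1)
 level-++ (evM ∷ es) es' s = level-++ es es' s

 level-reverse : ∀ {s es} → Valid s es → level (reverse es) 0 ≡ s
 level-reverse done = ≡.refl
 level-reverse (eastV {s} {es} v) = ≡.trans (≡.cong (λ l → level l 0) (ListP.unfold-reverse evE es)) (≡.trans (level-++ (reverse es) (evE ∷ []) 0) (≡.cong suc (level-reverse v)))
 level-reverse (northV {s} {es} v) = ≡.trans (≡.cong (λ l → level l 0) (ListP.unfold-reverse evN es)) (≡.trans (level-++ (reverse es) (evN ∷ []) 0) (≡.cong (_∸ 1) (level-reverse v)))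
 level-reverse (marked {s} {es} v) = ≡.trans (≡.cong (λ l → level l 0) (ListP.unfold-reverse evM es)) (≡.trans (level-++ (reverse es) (evM ∷ []) 0) (level-reverse v))

 backward-∷ : ∀ e {s es} → Valid s es → backward (e ∷ es) ≡ stepEv e s (backward es)
 backward-∷ e {s} {es} v = ≡.trans (≡.cong (λ l → run l 0 one) (ListP.unfold-reverse e es))
   (≡.trans (run-snoc (reverse es) e 0 one) (≡.cong (λ l → stepEv e l (backward es)) (level-reverse v)))

 -- By linearity: the operator is t times the difference of the two orders of d₊ and d₋, and each
 -- order is represented by the two steps already treated. The strict bound leaves room for the
 -- level s + 2 between them.
 represents-marked : ∀ {s B es F} → suc s < B → Represents (suc s) B es F → Represents (suc s) B (evM ∷ es) (tPow (+ 1) *P markedNum (suc s) F)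
 represents-marked {s} {B} {es} {F} s<B rep = represents λ N B≤N X hX →
   let ev = eval X (tail-power (suc s) N)
       C = prefix (suc s)
       u = W.family N (evN ∷ evE ∷ es) (interval 0 (suc s))
       v = W.family N (evE ∷ evN ∷ es) (interval 0 (suc s))
   in begin
     ev (tPow (+ 1) *P markedNum (suc s) F)                    ≈⟨ eval-* X (tail-power (suc s) N) (tPow (+ 1)) (markedNum (suc s) F) ⟩
     ev (tPow (+ 1)) * ev (markedNum (suc s) F)
       ≈⟨ *-cong (eval-scalar X (tail-power (suc s) N) 1ℚ (+ 1)) (trans (reflexive (≡.cong ev markedNum-suc)) (trans (eval-++ X (tail-power (suc s) N) NE (negP EN)) (+-congˡ (eval-neg X (tail-power (suc s) N) EN)))) ⟩
     t * (ev NE - ev EN)                                       ≈⟨ *-congˡ (+-cong (eval-≈ repNE N B≤N X hX) (-‿cong (eval-≈ repEN N B≤N X hX))) ⟩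
     t * (C * u - C * v)                                       ≈⟨ solve 4 (λ t C u v → t :* (C :* u :- C :* v) := C :* (t :* (u :- v))) refl t C u v ⟩
     C * (t * (u - v))                                         ∎
   where
   NE = dMinus (suc (suc s)) (ePlus (suc s) F)
   EN = ePlus s (dMinus (suc s) F)
   repNE : Represents (suc s) B (evN ∷ evE ∷ es) NE
   repNE = NorthStep.represents-dMinus s<B (EastStep.represents-ePlus s<B rep)
   repEN : Represents (suc s) B (evE ∷ evN ∷ es) EN
   repEN = EastStep.represents-ePlus (ℕP.<-trans (ℕP.n<1+n s) s<B) (NorthStep.represents-dMinus (ℕP.<-trans (ℕP.n<1+n s) s<B) rep)
   -- Since d₋ has lowered the level from s + 1 to s, the prescribed power of t is the one that
   -- belongs to d₊ on P(s). The case split lets the subtraction compute.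
   exponent : ∀ s → + 1 ℤ.- + suc s ≡ ℤ.- + s
   exponent zero = ≡.refl
   exponent (suc s) = ≡.refl
   markedNum-suc : markedNum (suc s) F ≡ NE -P EN
   markedNum-suc = ≡.cong (λ e → NE -P negP (tPow e *P dPlus s (dMinus (suc s) F))) (exponent s)

 -- `s + norths es` bounds every level met on the rest of the path. A marked corner counts as a
 -- north step because one of its two products passes through the next higher level.
 represents-backward : ∀ {s es B} → Valid s es → s ℕ.+ norths es ≤ B → Represents s B es (backward es)
 represents-backward done _ = represents λ N _ X _ → trans (eval-one X (tail-power 0 N)) (sym (trans (*-identityʳ _) (*-identityˡ 1#)))
 represents-backward {B = B} (eastV {s} {es} v) h = ≡.subst (Represents (suc s) B (evE ∷ es)) (≡.sym (backward-∷ evE v))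
   (EastStep.represents-ePlus (ℕP.≤-trans (ℕP.m≤m+n (suc s) (norths es)) h) (represents-backward v (ℕP.≤-trans (ℕP.n≤1+n _) h)))
 represents-backward {B = B} (northV {s} {es} v) h = ≡.subst (Represents s B (evN ∷ es)) (≡.sym (backward-∷ evN v))
   (NorthStep.represents-dMinus (ℕP.≤-trans (ℕP.m≤m+n (suc s) (norths es)) h') (represents-backward v h'))
   where
   h' : suc s ℕ.+ norths es ≤ B
   h' = ≡.subst (_≤ B) (ℕP.+-suc s (norths es)) h
 represents-backward {B = B} (marked {s} {es} v) h = ≡.subst (Represents (suc s) B (evM ∷ es)) (≡.sym (backward-∷ evM v))
   (represents-marked (ℕP.≤-trans (ℕP.m≤m+n (suc (suc s)) (norths es)) h') (represents-backward v (ℕP.≤-trans (ℕP.n≤1+n _) h')))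
   where
   h' : suc (suc s) ℕ.+ norths es ≤ B
   h' = ≡.subst (_≤ B) (ℕP.+-suc (suc s) (norths es)) h

-- The ring of polynomials

T-∧⁻ : ∀ {a b} → T (a ∧ b) → T a × T b
T-∧⁻ {true} {true} _ = _ , _

T-∧⁺ : ∀ {a b} → T a → T b → T (a ∧ b)
T-∧⁺ {true} {true} _ _ = _

T-ext : ∀ {a b} → (T a → T b) → (T b → T a) → a ≡ b
T-ext {true} {true} f g = ≡.refl
T-ext {true} {false} f g = ⊥-elim (f _)
T-ext {false} {true} f g = ⊥-elim (g _)
T-ext {false} {false} f g = ≡.refl

getE-addE : ∀ xs ys i → getE (addE xs ys) i ≡ getE xs i ℕ.+ getE ys i
getE-addE [] ys i = ≡.refl
getE-addE (x ∷ xs) [] i = ≡.sym (ℕP.+-identityʳ _)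
getE-addE (x ∷ xs) (y ∷ ys) zero = ≡.refl
getE-addE (x ∷ xs) (y ∷ ys) (suc i) = getE-addE xs ys i

addE-~ : ∀ {xs xs' ys ys'} → xs ~ xs' → ys ~ ys' → addE xs ys ~ addE xs' ys'
addE-~ {xs} {xs'} {ys} {ys'} h k i = ≡.trans (getE-addE xs ys i) (≡.trans (≡.cong₂ ℕ._+_ (h i) (k i)) (≡.sym (getE-addE xs' ys' i)))

setE-~ : ∀ {xs ys} i {u v} → xs ~ ys → u ≡ v → setE xs i u ~ setE ys i v
setE-~ {xs} {ys} i {u} h ≡.refl j with i ℕP.≟ j
... | yes ≡.refl = ≡.trans (getE-setE xs i u) (≡.sym (getE-setE ys i u))
... | no i≢j = ≡.trans (getE-setE-≢ xs u i≢j) (≡.trans (h j) (≡.sym (getE-setE-≢ ys u i≢j)))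

-- Exponent lists that differ by trailing zeros denote the same monomial, so entries are compared
-- instead of lists.
record _≈M_ (m m' : Mono) : Set where
  constructor equivalent
  field
    te-≡ : Mono.te m ≡ Mono.te m'
    xe-~ : Mono.xe m ~ Mono.xe m'
    pe-~ : Mono.pe m ~ Mono.pe m'

Functional : Set
Functional = Mono → ℚ

Respectful : Functional → Set
Respectful φ = ∀ {m m'} → m ≈M m' → φ m ≡ φ m'

lin : Functional → Poly → ℚ
lin φ [] = 0ℚ
lin φ ((c , m) ∷ F) = c ℚ.* φ m ℚ.+ lin φ F

-- Equality tested by all functionals rather than by coefficients: linear operations on
-- polynomials are then handled by transposing them.
infix 4 _≋_
record _≋_ (F G : Poly) : Set where
  constructor tested
  field
    test : ∀ φ → Respectful φ → lin φ F ≡ lin φ G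
open _≋_

module _ where
  open ≡.≡-Reasoning
  open import Algebra.Properties.CommutativeSemigroup (CommutativeRing.+-commutativeSemigroup ℚP.+-*-commutativeRing) using () renaming (interchange to +-interchange)
  open import Algebra.Properties.CommutativeSemigroup (CommutativeRing.*-commutativeSemigroup ℚP.+-*-commutativeRing) using () renaming (x∙yz≈y∙xz to *-swap)

  lin-++ : ∀ φ F G → lin φ (F ++ G) ≡ lin φ F ℚ.+ lin φ G
  lin-++ φ [] G = ≡.sym (ℚP.+-identityˡ _)
  lin-++ φ ((c , m) ∷ F) G = ≡.trans (≡.cong (c ℚ.* φ m ℚ.+_) (lin-++ φ F G)) (≡.sym (ℚP.+-assoc (c ℚ.* φ m) (lin φ F) (lin φ G)))

  lin-neg : ∀ φ F → lin φ (negP F) ≡ ℚ.- lin φ F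
  lin-neg φ [] = ≡.refl
  lin-neg φ ((c , m) ∷ F) = ≡.trans (≡.cong₂ ℚ._+_ (≡.sym (ℚP.neg-distribˡ-* c (φ m))) (lin-neg φ F)) (≡.sym (ℚP.neg-distrib-+ (c ℚ.* φ m) (lin φ F)))

  lin-cong : ∀ {φ ψ} F → (∀ m → φ m ≡ ψ m) → lin φ F ≡ lin ψ F
  lin-cong [] h = ≡.refl
  lin-cong ((c , m) ∷ F) h = ≡.cong₂ (λ u v → c ℚ.* u ℚ.+ v) (h m) (lin-cong F h)

  lin-0 : ∀ F → lin (λ _ → 0ℚ) F ≡ 0ℚ
  lin-0 [] = ≡.refl
  lin-0 ((c , m) ∷ F) = ≡.trans (≡.cong₂ ℚ._+_ (ℚP.*-zeroʳ c) (lin-0 F)) (ℚP.+-identityˡ 0ℚ)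

  lin-+ : ∀ φ ψ F → lin (λ m → φ m ℚ.+ ψ m) F ≡ lin φ F ℚ.+ lin ψ F
  lin-+ φ ψ [] = ≡.refl
  lin-+ φ ψ ((c , m) ∷ F) = ≡.trans (≡.cong₂ ℚ._+_ (ℚP.*-distribˡ-+ c (φ m) (ψ m)) (lin-+ φ ψ F)) (+-interchange (c ℚ.* φ m) (c ℚ.* ψ m) (lin φ F) (lin ψ F))

  lin-* : ∀ q φ F → lin (λ m → q ℚ.* φ m) F ≡ q ℚ.* lin φ F
  lin-* q φ [] = ≡.sym (ℚP.*-zeroʳ q)
  lin-* q φ ((c , m) ∷ F) = ≡.trans (≡.cong₂ ℚ._+_ (*-swap c q (φ m)) (lin-* q φ F)) (≡.sym (ℚP.*-distribˡ-+ q (c ℚ.* φ m) (lin φ F)))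

  -- Interchanging two finite sums is what commutativity of the product comes down to.
  lin-lin : ∀ (f : Mono → Mono → ℚ) F G → lin (λ m → lin (f m) G) F ≡ lin (λ m' → lin (λ m → f m m') F) G
  lin-lin f [] G = ≡.sym (lin-0 G)
  lin-lin f ((c , m) ∷ F) G = begin
    c ℚ.* lin (f m) G ℚ.+ lin (λ m → lin (f m) G) F                       ≡⟨ ≡.cong₂ ℚ._+_ (≡.sym (lin-* c (f m) G)) (lin-lin f F G) ⟩
    lin (λ m' → c ℚ.* f m m') G ℚ.+ lin (λ m' → lin (λ m → f m m') F) G   ≡⟨ ≡.sym (lin-+ _ _ G) ⟩
    lin (λ m' → c ℚ.* f m m' ℚ.+ lin (λ m → f m m') F) G                  ∎

  lin-monomial* : ∀ φ c m G → lin φ (map (λ { (c' , m') → (c ℚ.* c' , mulM m m') }) G) ≡ c ℚ.* lin (φ ∘ mulM m) G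
  lin-monomial* φ c m [] = ≡.sym (ℚP.*-zeroʳ c)
  lin-monomial* φ c m ((c' , m') ∷ G) = ≡.trans (≡.cong₂ ℚ._+_ (ℚP.*-assoc c c' _) (lin-monomial* φ c m G)) (≡.sym (ℚP.*-distribˡ-+ c _ _))

  lin-*P : ∀ φ F G → lin φ (F *P G) ≡ lin (λ m → lin (φ ∘ mulM m) G) F
  lin-*P φ [] G = ≡.refl
  lin-*P φ ((c , m) ∷ F) G = ≡.trans (lin-++ φ (map (λ { (c' , m') → (c ℚ.* c' , mulM m m') }) G) (F *P G)) (≡.cong₂ ℚ._+_ (lin-monomial* φ c m G) (lin-*P φ F G))

≈M-refl : ∀ {m} → m ≈M m
≈M-refl = equivalent ≡.refl (λ _ → ≡.refl) (λ _ → ≡.refl)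

mulM-cong : ∀ {m m' n n'} → m ≈M m' → n ≈M n' → mulM m n ≈M mulM m' n'
mulM-cong {mono a x p} {mono a' x' p'} {mono b y q} {mono b' y' q'} (equivalent e f g) (equivalent e' f' g') =
  equivalent (≡.cong₂ ℤ._+_ e e') (addE-~ {x} {x'} {y} {y'} f f') (addE-~ {p} {p'} {q} {q'} g g')

addE-comm : ∀ xs ys → addE xs ys ~ addE ys xs
addE-comm xs ys i = ≡.trans (getE-addE xs ys i) (≡.trans (ℕP.+-comm (getE xs i) (getE ys i)) (≡.sym (getE-addE ys xs i)))

addE-assoc : ∀ xs ys zs → addE (addE xs ys) zs ~ addE xs (addE ys zs)
addE-assoc xs ys zs i = ≡.trans (≡.trans (getE-addE (addE xs ys) zs i) (≡.cong (ℕ._+ getE zs i) (getE-addE xs ys i)))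
  (≡.trans (ℕP.+-assoc (getE xs i) (getE ys i) (getE zs i)) (≡.sym (≡.trans (getE-addE xs (addE ys zs) i) (≡.cong (getE xs i ℕ.+_) (getE-addE ys zs i)))))

mulM-comm : ∀ m n → mulM m n ≈M mulM n m
mulM-comm (mono a x p) (mono b y q) = equivalent (ℤP.+-comm a b) (addE-comm x y) (addE-comm p q)

mulM-assoc : ∀ l m n → mulM (mulM l m) n ≈M mulM l (mulM m n)
mulM-assoc (mono a x p) (mono b y q) (mono c z r) = equivalent (ℤP.+-assoc a b c) (addE-assoc x y z) (addE-assoc p q r)

mulM-identityˡ : ∀ m → mulM (mono (+ 0) [] []) m ≈M m
mulM-identityˡ (mono a x p) = equivalent (ℤP.+-identityˡ a) (λ _ → ≡.refl) (λ _ → ≡.refl)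

mulM-respectful : ∀ {φ} m → Respectful φ → Respectful (φ ∘ mulM m)
mulM-respectful m rφ e = rφ (mulM-cong (≈M-refl {m}) e)

≋-refl : ∀ {F} → F ≋ F
≋-refl = tested λ _ _ → ≡.refl

≋-sym : ∀ {F G} → F ≋ G → G ≋ F
≋-sym h = tested λ φ rφ → ≡.sym (test h φ rφ)

≋-trans : ∀ {F G K} → F ≋ G → G ≋ K → F ≋ K
≋-trans h k = tested λ φ rφ → ≡.trans (test h φ rφ) (test k φ rφ)

*P-cong : ∀ {F F' G G'} → F ≋ F' → G ≋ G' → F *P G ≋ F' *P G'
*P-cong {F} {F'} {G} {G'} h k = tested λ φ rφ → let open ≡.≡-Reasoning in begin
  lin φ (F *P G)                                ≡⟨ lin-*P φ F G ⟩
  lin (λ m → lin (φ ∘ mulM m) G) F              ≡⟨ lin-cong F (λ m → test k _ (mulM-respectful m rφ)) ⟩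
  lin (λ m → lin (φ ∘ mulM m) G') F             ≡⟨ test h _ (λ e → lin-cong G' (λ n → rφ (mulM-cong e (≈M-refl {n})))) ⟩
  lin (λ m → lin (φ ∘ mulM m) G') F'            ≡⟨ ≡.sym (lin-*P φ F' G') ⟩
  lin φ (F' *P G')                              ∎

*P-comm : ∀ F G → F *P G ≋ G *P F
*P-comm F G = tested λ φ rφ → let open ≡.≡-Reasoning in begin
  lin φ (F *P G)                                ≡⟨ lin-*P φ F G ⟩
  lin (λ m → lin (φ ∘ mulM m) G) F              ≡⟨ lin-lin (λ m n → φ (mulM m n)) F G ⟩
  lin (λ n → lin (λ m → φ (mulM m n)) F) G      ≡⟨ lin-cong G (λ n → lin-cong F (λ m → rφ (mulM-comm m n))) ⟩
  lin (λ n → lin (φ ∘ mulM n) F) G              ≡⟨ ≡.sym (lin-*P φ G F) ⟩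
  lin φ (G *P F)                                ∎

*P-assoc : ∀ F G K → (F *P G) *P K ≋ F *P (G *P K)
*P-assoc F G K = tested λ φ rφ → let open ≡.≡-Reasoning in begin
  lin φ ((F *P G) *P K)                                               ≡⟨ lin-*P φ (F *P G) K ⟩
  lin (λ m → lin (φ ∘ mulM m) K) (F *P G)                             ≡⟨ lin-*P _ F G ⟩
  lin (λ l → lin (λ m → lin (φ ∘ mulM (mulM l m)) K) G) F             ≡⟨ lin-cong F (λ l → lin-cong G (λ m → lin-cong K (λ n → rφ (mulM-assoc l m n)))) ⟩
  lin (λ l → lin (λ m → lin (λ n → φ (mulM l (mulM m n))) K) G) F     ≡⟨ lin-cong F (λ l → ≡.sym (lin-*P (φ ∘ mulM l) G K)) ⟩
  lin (λ l → lin (φ ∘ mulM l) (G *P K)) F                             ≡⟨ ≡.sym (lin-*P φ F (G *P K)) ⟩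
  lin φ (F *P (G *P K))                                               ∎

*P-identityˡ : ∀ F → one *P F ≋ F
*P-identityˡ F = tested λ φ rφ → ≡.trans (lin-*P φ one F) (≡.trans (ℚP.+-identityʳ _) (≡.trans (ℚP.*-identityˡ _) (lin-cong F (λ m → rφ (mulM-identityˡ m)))))

*P-distribʳ : ∀ K F G → (F +P G) *P K ≋ F *P K +P G *P K
*P-distribʳ K F G = tested λ φ _ → ≡.trans (lin-*P φ (F ++ G) K) (≡.trans (lin-++ _ F G)
  (≡.trans (≡.sym (≡.cong₂ ℚ._+_ (lin-*P φ F K) (lin-*P φ G K))) (≡.sym (lin-++ φ (F *P K) (G *P K)))))

+P-cong : ∀ {F F' G G'} → F ≋ F' → G ≋ G' → F +P G ≋ F' +P G'
+P-cong {F} {F'} {G} {G'} h k = tested λ φ rφ → ≡.trans (lin-++ φ F G) (≡.trans (≡.cong₂ ℚ._+_ (test h φ rφ) (test k φ rφ)) (≡.sym (lin-++ φ F' G')))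

+P-comm : ∀ F G → F +P G ≋ G +P F
+P-comm F G = tested λ φ _ → ≡.trans (lin-++ φ F G) (≡.trans (ℚP.+-comm (lin φ F) (lin φ G)) (≡.sym (lin-++ φ G F)))

negP-cong : ∀ {F G} → F ≋ G → negP F ≋ negP G
negP-cong {F} {G} h = tested λ φ rφ → ≡.trans (lin-neg φ F) (≡.trans (≡.cong ℚ.-_ (test h φ rφ)) (≡.sym (lin-neg φ G)))

negP-inverseˡ : ∀ F → negP F +P F ≋ []
negP-inverseˡ F = tested λ φ _ → ≡.trans (lin-++ φ (negP F) F) (≡.trans (≡.cong (ℚ._+ lin φ F) (lin-neg φ F)) (ℚP.+-inverseˡ (lin φ F)))

≡⇒≋ : ∀ {F G} → F ≡ G → F ≋ G
≡⇒≋ ≡.refl = ≋-refl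

polyRing : CommutativeRing 0ℓ 0ℓ
polyRing = record
  { Carrier = Poly
  ; _≈_ = _≋_
  ; _+_ = _+P_
  ; _*_ = _*P_
  ; -_ = negP
  ; 0# = []
  ; 1# = one
  ; isCommutativeRing = record
    { isRing = record
      { +-isAbelianGroup = record
        { isGroup = record
          { isMonoid = record
            { isSemigroup = record
              { isMagma = record
                { isEquivalence = record { refl = ≋-refl ; sym = ≋-sym ; trans = ≋-trans }
                ; ∙-cong = +P-cong }
              ; assoc = λ F G K → ≡⇒≋ (ListP.++-assoc F G K) }
            ; identity = (λ _ → ≋-refl) , (λ F → ≡⇒≋ (ListP.++-identityʳ F)) }
          ; inverse = negP-inverseˡ , (λ F → ≋-trans (+P-comm F (negP F)) (negP-inverseˡ F))
          ; ⁻¹-cong = negP-cong }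
        ; comm = +P-comm }
      ; *-cong = *P-cong
      ; *-assoc = *P-assoc
      ; *-identity = *P-identityˡ , (λ F → ≋-trans (*P-comm F one) (*P-identityˡ F))
      ; distrib = (λ K F G → ≋-trans (*P-comm K (F +P G)) (≋-trans (*P-distribʳ K F G) (+P-cong (*P-comm F K) (*P-comm G K)))) , *P-distribʳ }
    ; *-comm = *P-comm } }

nat-reciprocal : ∀ m → (+ 1 ℚ./ suc m) ℚ.* (+ suc m ℚ./ 1) ≡ 1ℚ
nat-reciprocal m = ℚP.toℚᵘ-injective (ℚᵘP.≃-trans (ℚP.toℚᵘ-homo-* (+ 1 ℚ./ suc m) (+ suc m ℚ./ 1))
  (ℚᵘP.≃-trans (ℚᵘP.*-cong (ℚP.toℚᵘ-fromℚᵘ (ℚᵘ.mkℚᵘ (+ 1) m)) (ℚP.toℚᵘ-fromℚᵘ (ℚᵘ.mkℚᵘ (+ suc m) 0)))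
    (ℚᵘ.*≡* (≡.cong (λ z → + suc z) (≡.trans (ℕP.*-identityʳ (m ℕ.+ 0)) (≡.trans (ℕP.+-identityʳ m) (≡.sym (≡.trans (ℕP.+-identityʳ (m ℕ.* 1)) (ℕP.*-identityʳ m)))))))))

nat-suc : ∀ n → 1ℚ ℚ.+ (+ n ℚ./ 1) ≡ + suc n ℚ./ 1
nat-suc n = ℚP.toℚᵘ-injective (ℚᵘP.≃-trans (ℚP.toℚᵘ-homo-+ 1ℚ (+ n ℚ./ 1))
  (ℚᵘP.≃-trans (ℚᵘP.+-congʳ (ℚ.toℚᵘ 1ℚ) (ℚP.toℚᵘ-fromℚᵘ (ℚᵘ.mkℚᵘ (+ n) 0)))
    (ℚᵘP.≃-trans (ℚᵘ.*≡* (≡.cong (ℤ._* + 1) (≡.cong (λ z → + 1 ℤ.+ z) (ℤP.*-identityʳ (+ n))))) (ℚᵘP.≃-sym (ℚP.toℚᵘ-fromℚᵘ (ℚᵘ.mkℚᵘ (+ suc n) 0))))))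

lin-multiple : ∀ φ n → lin φ (RawMonoid._×_ (CommutativeRing.+-rawMonoid polyRing) n one) ≡ (+ n ℚ./ 1) ℚ.* φ (mono (+ 0) [] [])
lin-multiple φ zero = ≡.sym (ℚP.*-zeroˡ (φ (mono (+ 0) [] [])))
lin-multiple φ (suc n) = ≡.trans (≡.cong (1ℚ ℚ.* φ (mono (+ 0) [] []) ℚ.+_) (lin-multiple φ n))
  (≡.trans (≡.sym (ℚP.*-distribʳ-+ (φ (mono (+ 0) [] [])) 1ℚ (+ n ℚ./ 1))) (≡.cong (ℚ._* φ (mono (+ 0) [] [])) (nat-suc n)))

polyScalars : Scalars
polyScalars = record
  { ring = polyRing
  ; κ = λ c n → (c , mono n [] []) ∷ []
  ; κ-1 = ≋-refl
  ; κ-* = λ _ _ _ _ → ≋-refl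
  ; κ-neg = λ _ _ → ≋-refl
  ; κ-reciprocal = λ m → tested λ φ rφ → ≡.trans (lin-*P φ ((+ 1 ℚ./ suc m , mono (+ 0) [] []) ∷ []) (RawMonoid._×_ (CommutativeRing.+-rawMonoid polyRing) (suc m) one))
      (≡.trans (ℚP.+-identityʳ _) (≡.trans (≡.cong ((+ 1 ℚ./ suc m) ℚ.*_) (lin-multiple (φ ∘ mulM (mono (+ 0) [] [])) (suc m)))
        (≡.trans (≡.sym (ℚP.*-assoc (+ 1 ℚ./ suc m) (+ suc m ℚ./ 1) _)) (≡.trans (≡.cong (ℚ._* φ (mono (+ 0) [] [])) (nat-reciprocal m)) (≡.sym (ℚP.+-identityʳ _))))))
  }

-- Sums over words

absL : Letter → ℕ
absL a = Letter.val a ∸ 1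

Positive : Letter → Set
Positive a = 1 ≤ Letter.val a

attacks : Letter → List Letter → ℕ
attacks a w = countB (map (colDec a) w)

firstL : List Letter → Letter
firstL [] = letter 1 false
firstL (a ∷ w) = a

walkOK : List Ev → List Letter → List Letter → Bool
walkOK [] w T = true
walkOK (evE ∷ es) w T = walkOK es (drop 1 w) T
walkOK (evN ∷ es) w [] = true
walkOK (evN ∷ es) w (a ∷ T) = walkOK es (w ++ a ∷ []) T
walkOK (evM ∷ es) w [] = true
walkOK (evM ∷ es) w (a ∷ T) = colDec a (firstL w) ∧ walkOK es (drop 1 w ++ a ∷ []) T

-- The box of a marked corner lies above the path and outside the area. Its pair, formed with the
-- first letter of the window, is a condition in `walkOK` and is left out of the count.
walkInv : List Ev → List Letter → List Letter → ℕ
walkInv [] w T = 0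
walkInv (evE ∷ es) w T = walkInv es (drop 1 w) T
walkInv (evN ∷ es) w [] = 0
walkInv (evN ∷ es) w (a ∷ T) = attacks a w ℕ.+ walkInv es (w ++ a ∷ []) T
walkInv (evM ∷ es) w [] = 0
walkInv (evM ∷ es) w (a ∷ T) = attacks a (drop 1 w) ℕ.+ walkInv es (drop 1 w ++ a ∷ []) T

flagOK : ℕ → ℕ → List Ev → List Letter → List Letter → Bool
flagOK i zero es w T = walkOK es w T
flagOK i (suc j) es w [] = true
flagOK i (suc j) es w (a ∷ T) = (code a ≤ᵇ 2 ℕ.* suc i) ∧ flagOK (suc i) j es (w ++ a ∷ []) T

flagInv : ℕ → List Ev → List Letter → List Letter → ℕ
flagInv zero es w T = walkInv es w T
flagInv (suc j) es w [] = 0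
flagInv (suc j) es w (a ∷ T) = attacks a w ℕ.+ flagInv j es (w ++ a ∷ []) T

2*-mono : ∀ {u v} → u < v → 2 ℕ.* u ℕ.+ 1 < 2 ℕ.* v
2*-mono {u} {v} u<v = ℕP.≤-trans (ℕP.≤-reflexive (≡.trans (≡.cong suc (ℕP.+-comm (2 ℕ.* u) 1)) (≡.sym (ℕP.*-suc 2 u)))) (ℕP.*-monoʳ-≤ 2 u<v)

bit : Bool → ℕ
bit n = if n then 1 else 0

bit≤1 : ∀ n → bit n ≤ 1
bit≤1 true = s≤s z≤n
bit≤1 false = z≤n

code-< : ∀ {u v} m n → u < v → 2 ℕ.* u ℕ.+ bit m < 2 ℕ.* v ℕ.+ bit n
code-< {u} {v} m n u<v = ℕP.<-≤-trans (ℕP.≤-<-trans (ℕP.+-monoʳ-≤ (2 ℕ.* u) (bit≤1 m)) (2*-mono u<v)) (ℕP.m≤m+n _ _)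

T⇒≡true : ∀ {b} → T b → b ≡ true
T⇒≡true {true} _ = ≡.refl

¬T⇒≡false : ∀ {b} → (T b → ⊥) → b ≡ false
¬T⇒≡false {true} h = ⊥-elim (h _)
¬T⇒≡false {false} h = ≡.refl

<⇒≡true : ∀ {a b} → a < b → (a <ᵇ b) ≡ true
<⇒≡true a<b = T⇒≡true (ℕP.<⇒<ᵇ a<b)

≮⇒≡false : ∀ {a b} → b ≤ a → (a <ᵇ b) ≡ false
≮⇒≡false {a} {b} b≤a = ¬T⇒≡false (λ p → ℕP.<⇒≱ (ℕP.<ᵇ⇒< a b p) b≤a)

-- Only the sign of the attacking letter matters: v lies above both letters of every smaller
-- absolute value and below its own negative, while a negative letter also attacks both letters of
-- its own absolute value. So the signs can be summed out one letter at a time, and windows need to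
-- record absolute values only.
colDec-positive : ∀ c b → Positive b → colDec (letter (suc c) false) b ≡ (absL b <ᵇ c)
colDec-positive c (letter (suc v) n) _ with v ℕP.<? c
... | yes v<c = ≡.trans (≡.cong (_∨ ((code (letter (suc c) false) ≡ᵇ code (letter (suc v) n)) ∧ false)) (<⇒≡true (code-< n false (s≤s v<c)))) (≡.sym (<⇒≡true v<c))
... | no v≮c = ≡.trans (≡.cong₂ _∨_ (≮⇒≡false {code (letter (suc v) n)} {code (letter (suc c) false)} bound) (BoolP.∧-zeroʳ (code (letter (suc c) false) ≡ᵇ code (letter (suc v) n)))) (≡.sym (≮⇒≡false (ℕP.≮⇒≥ v≮c)))
  where
  bound : code (letter (suc c) false) ≤ code (letter (suc v) n)
  bound = ℕP.+-mono-≤ (ℕP.*-monoʳ-≤ 2 (s≤s (ℕP.≮⇒≥ v≮c))) z≤n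

colDec-negative : ∀ c b → Positive b → colDec (letter (suc c) true) b ≡ (absL b <ᵇ suc c)
colDec-negative c (letter (suc v) n) _ with ℕP.<-cmp v c
... | tri< v<c _ _ = ≡.trans (≡.cong (_∨ ((code (letter (suc c) true) ≡ᵇ code (letter (suc v) n)) ∧ true)) (<⇒≡true (code-< n true (s≤s v<c)))) (≡.sym (<⇒≡true (ℕP.m<n⇒m<1+n v<c)))
... | tri> _ _ c<v = ≡.trans (≡.cong₂ _∨_ (≮⇒≡false (ℕP.<⇒≤ (code-< true n (s≤s c<v)))) (≡.cong (_∧ true) (¬T⇒≡false (λ p → ℕP.<⇒≢ (code-< true n (s≤s c<v)) (ℕP.≡ᵇ⇒≡ (code (letter (suc c) true)) (code (letter (suc v) n)) p))))) (≡.sym (≮⇒≡false c<v))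
colDec-negative c (letter (suc c) false) _ | tri≈ _ ≡.refl _ = ≡.trans (≡.cong (_∨ ((code (letter (suc c) true) ≡ᵇ code (letter (suc c) false)) ∧ true)) (<⇒≡true (ℕP.+-monoʳ-< (2 ℕ.* suc c) (s≤s z≤n)))) (≡.sym (<⇒≡true (ℕP.n<1+n c)))
colDec-negative c (letter (suc c) true) _ | tri≈ _ ≡.refl _ = ≡.trans (≡.cong₂ _∨_ (≮⇒≡false {code (letter (suc c) true)} ℕP.≤-refl) (≡.cong (_∧ true) (T⇒≡true (ℕP.≡⇒≡ᵇ (code (letter (suc c) true)) (code (letter (suc c) true)) ≡.refl)))) (≡.sym (<⇒≡true (ℕP.n<1+n c)))

attacks-positive : ∀ c w → All Positive w → attacks (letter (suc c) false) w ≡ below c (map absL w)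
attacks-positive c [] [] = ≡.refl
attacks-positive c (b ∷ w) (p ∷ ps) = ≡.cong₂ (λ u v → (if u then 1 else 0) ℕ.+ v) (colDec-positive c b p) (attacks-positive c w ps)

attacks-negative : ∀ c w → All Positive w → attacks (letter (suc c) true) w ≡ below (suc c) (map absL w)
attacks-negative c [] [] = ≡.refl
attacks-negative c (b ∷ w) (p ∷ ps) = ≡.cong₂ (λ u v → (if u then 1 else 0) ℕ.+ v) (colDec-negative c b p) (attacks-negative c w ps)

flag-positive : ∀ c i → (code (letter (suc c) false) ≤ᵇ 2 ℕ.* suc i) ≡ (c <ᵇ suc i)
flag-positive c i with c ℕP.<? suc i
... | yes c<1+i = ≡.trans (T⇒≡true (ℕP.≤⇒≤ᵇ (ℕP.≤-trans (ℕP.≤-reflexive (ℕP.+-identityʳ (2 ℕ.* suc c))) (ℕP.*-monoʳ-≤ 2 c<1+i)))) (≡.sym (<⇒≡true c<1+i))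
... | no c≮1+i = ≡.trans (¬T⇒≡false (λ p → ℕP.<⇒≱ (ℕP.≤-<-trans (ℕP.m≤m+n (2 ℕ.* suc i) 1) (ℕP.<-≤-trans (2*-mono (s≤s (ℕP.≮⇒≥ c≮1+i))) (ℕP.m≤m+n (2 ℕ.* suc c) 0))) (ℕP.≤ᵇ⇒≤ _ _ p))) (≡.sym (≮⇒≡false (ℕP.≮⇒≥ c≮1+i)))

-- A negative letter exceeds the positive letter of the same absolute value, so the flag admits its
-- own value only with positive sign. This asymmetry keeps the forced flagged letter from
-- cancelling.
flag-negative : ∀ c i → (code (letter (suc c) true) ≤ᵇ 2 ℕ.* suc i) ≡ (c <ᵇ i)
flag-negative c i with c ℕP.<? i
... | yes c<i = ≡.trans (T⇒≡true (ℕP.≤⇒≤ᵇ (ℕP.<⇒≤ (2*-mono (s≤s c<i))))) (≡.sym (<⇒≡true c<i))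
... | no c≮i = ≡.trans (¬T⇒≡false (λ p → ℕP.<⇒≱ (ℕP.≤-<-trans (ℕP.*-monoʳ-≤ 2 (s≤s (ℕP.≮⇒≥ c≮i))) (ℕP.m<m+n (2 ℕ.* suc c) {1} (s≤s z≤n))) (ℕP.≤ᵇ⇒≤ _ _ p))) (≡.sym (≮⇒≡false (ℕP.≮⇒≥ c≮i)))

-- The contribution of a word after t has been replaced by its inverse, whence the exponent m - inv.
weighted : Bool → ℕ → List Letter → Poly
weighted ok inv T = if ok then (sign (mT T) , mono (+ mT T ℤ.- + inv) (xWord T) []) ∷ [] else []

module WordSums (𝕋 : Target) where
 open Target 𝕋
 open IntegerSolver ring
 open OverRing ring
 open Evaluation scalars
 open Representation 𝕋
 open Eval var (λ _ → 0#)
 open import Algebra.Properties.Semiring.Exp semiring using (_^_; ^-homo-*; ^-congˡ)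
 open import Algebra.Properties.Ring (CommutativeRing.ring ring) using (-0#≈0#)
 open import Relation.Binary.Reasoning.Setoid setoid

 sumOver : {A : Set} → List A → (A → Carrier) → Carrier
 sumOver [] f = 0#
 sumOver (a ∷ as) f = f a + sumOver as f

 sumOver-cong : {A : Set} {f g : A → Carrier} (as : List A) → (∀ a → f a ≈ g a) → sumOver as f ≈ sumOver as g
 sumOver-cong [] h = refl
 sumOver-cong (a ∷ as) h = +-cong (h a) (sumOver-cong as h)

 sumOver-++ : {A : Set} (f : A → Carrier) (as bs : List A) → sumOver (as ++ bs) f ≈ sumOver as f + sumOver bs f
 sumOver-++ f [] bs = sym (+-identityˡ _)
 sumOver-++ f (a ∷ as) bs = trans (+-congˡ (sumOver-++ f as bs)) (sym (+-assoc _ _ _))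

 sumOver-map : {A B : Set} (f : B → Carrier) (g : A → B) (as : List A) → sumOver (map g as) f ≈ sumOver as (f ∘ g)
 sumOver-map f g [] = refl
 sumOver-map f g (a ∷ as) = +-congˡ (sumOver-map f g as)

 sumOver-concatMap : {A B : Set} (f : B → Carrier) (g : A → List B) (as : List A) → sumOver (concatMap g as) f ≈ sumOver as (λ a → sumOver (g a) f)
 sumOver-concatMap f g [] = refl
 sumOver-concatMap f g (a ∷ as) = trans (sumOver-++ f (g a) (concatMap g as)) (+-congˡ (sumOver-concatMap f g as))

 sumOver-* : {A : Set} (c : Carrier) (f : A → Carrier) (as : List A) → sumOver as (λ a → c * f a) ≈ c * sumOver as f
 sumOver-* c f [] = sym (zeroʳ c)
 sumOver-* c f (a ∷ as) = trans (+-congˡ (sumOver-* c f as)) (sym (distribˡ _ _ _))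

 sumOver-applyUpTo : {A : Set} (f : A → Carrier) (g : ℕ → A) (n : ℕ) → sumOver (applyUpTo g n) f ≈ sumTo n (f ∘ g)
 sumOver-applyUpTo f g zero = refl
 sumOver-applyUpTo f g (suc n) = trans (+-congˡ (sumOver-applyUpTo f (g ∘ suc) n)) (sym (sumTo-front n (f ∘ g)))

 select : Bool → Carrier → Carrier
 select b f = if b then f else 0#

 letterWeight : Letter → ℕ → Carrier
 letterWeight a n = κ (sign (bit (Letter.neg a))) (+ bit (Letter.neg a) ℤ.- + n) * var (absL a)

 eval-weighted-∷ : ∀ b ok n inv a T → eval (weighted (b ∧ ok) (n ℕ.+ inv) (a ∷ T)) ≈ select b (letterWeight a n) * eval (weighted ok inv T)
 eval-weighted-∷ false ok n inv a T = sym (zeroˡ _)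
 eval-weighted-∷ true false n inv a T = sym (zeroʳ _)
 eval-weighted-∷ true true n inv a@(letter v neg) T = begin
   κ (sign (bit neg ℕ.+ mT T)) (+ (bit neg ℕ.+ mT T) ℤ.- + (n ℕ.+ inv)) * (prodE var (addE (setE [] (v ∸ 1) 1) (xWord T)) * 1#) + 0#
     ≈⟨ +-congʳ (*-cong (trans (reflexive (≡.cong₂ κ (sign-+ neg) exponent)) (κ-* (sign (bit neg)) (sign (mT T)) (+ bit neg ℤ.- + n) (+ mT T ℤ.- + inv)))
          (*-congʳ (trans (prodE-addE var (setE [] (v ∸ 1) 1) (xWord T)) (*-congʳ (prodE-var var (v ∸ 1)))))) ⟩
   k * l * (var (v ∸ 1) * p * 1#) + 0#
     ≈⟨ solve 4 (λ k l x p → k :* l :* (x :* p :* con (+ 1)) :+ con (+ 0) := k :* x :* (l :* (p :* con (+ 1)) :+ con (+ 0))) refl k l (var (v ∸ 1)) p ⟩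
   k * var (v ∸ 1) * (l * (p * 1#) + 0#)  ∎
   where
   k = κ (sign (bit neg)) (+ bit neg ℤ.- + n)
   l = κ (sign (mT T)) (+ mT T ℤ.- + inv)
   p = prodE var (xWord T)
   sign-+ : ∀ neg → sign (bit neg ℕ.+ mT T) ≡ sign (bit neg) ℚ.* sign (mT T)
   sign-+ true = ≡.trans (≡.cong ℚ.-_ (≡.sym (ℚP.*-identityˡ (sign (mT T))))) (ℚP.neg-distribˡ-* 1ℚ (sign (mT T)))
   sign-+ false = ≡.sym (ℚP.*-identityˡ _)
   open import Algebra.Properties.CommutativeSemigroup ℤP.+-commutativeSemigroup using (interchange)
   exponent : + (bit neg ℕ.+ mT T) ℤ.- + (n ℕ.+ inv) ≡ (+ bit neg ℤ.- + n) ℤ.+ (+ mT T ℤ.- + inv)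
   exponent = ≡.trans (≡.cong₂ ℤ._+_ (ℤP.pos-+ (bit neg) (mT T)) (≡.trans (≡.cong ℤ.-_ (ℤP.pos-+ n inv)) (ℤP.neg-distrib-+ (+ n) (+ inv))))
     (interchange (+ bit neg) (+ mT T) (ℤ.- + n) (ℤ.- + inv))

 letterWeight-positive : ∀ c n → letterWeight (letter (suc c) false) n ≈ t⁻¹ ^ n * var c
 letterWeight-positive c n = *-congʳ (trans (reflexive (≡.cong τ (ℤP.+-identityˡ (ℤ.- + n)))) (τ-^ n))

 letterWeight-negative : ∀ c n → letterWeight (letter (suc c) true) n ≈ - (t * t⁻¹ ^ n) * var c
 letterWeight-negative c n = *-congʳ (trans (κ-neg 1ℚ (+ 1 ℤ.- + n)) (-‿cong (trans (τ-+ (+ 1) (ℤ.- + n)) (*-congˡ (τ-^ n)))))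

 module _ (N L : ℕ) (N≤L : N ≤ L) where
  y : ℕ → Carrier
  y c = if c <ᵇ N then var c else 0#

  sumTo-y : ∀ (f : ℕ → Carrier) → sumTo N (λ c → f c * var c) ≈ sumTo L (λ c → f c * y c)
  sumTo-y f = sym (trans (reflexive (≡.cong (λ n → sumTo n (λ c → f c * y c)) (≡.sym (ℕP.m+[n∸m]≡n N≤L))))
    (trans (sumTo-split N (L ∸ N) _) (trans (+-cong (sumTo-cong N (λ c c<N → *-congˡ (reflexive (if-T (ℕP.<⇒<ᵇ c<N)))))
      (sumTo-0 (L ∸ N) (λ i _ → trans (*-congˡ (reflexive (if-¬T (λ p → ℕP.m+n≮m N i (ℕP.<ᵇ⇒< (N ℕ.+ i) N p))))) (zeroʳ _)))) (+-identityʳ _))))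

  -- One summation over the first letter and its sign, shared by flagged, free and marked positions,
  -- which differ in the condition on that letter and in the letters it is compared with. `D`
  -- carries the denominators still to be cleared.
  sum-letters : ∀ n (okW : List Letter → Bool) (invW : List Letter → ℕ) (cond : Letter → Bool) (count : Letter → ℕ)
    (ok : Letter → List Letter → Bool) (inv : Letter → List Letter → ℕ) →
    (∀ a T → okW (a ∷ T) ≡ cond a ∧ ok a T) → (∀ a T → invW (a ∷ T) ≡ count a ℕ.+ inv a T) →
    (D : Carrier) (H : ℕ → Carrier) → (∀ c b → sumOver (words N n) (λ T → eval (weighted (ok (letter (suc c) b) T) (inv (letter (suc c) b) T) T)) * D ≈ H c) →
    sumOver (words N (suc n)) (λ T → eval (weighted (okW T) (invW T) T)) * D ≈
      sumTo L (λ c → (select (cond (letter (suc c) false)) (t⁻¹ ^ count (letter (suc c) false)) - select (cond (letter (suc c) true)) (t * t⁻¹ ^ count (letter (suc c) true))) * H c * y c)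
  sum-letters n okW invW cond count ok inv okW≡ invW≡ D H hyp = begin
    sumOver (words N (suc n)) (λ T → eval (weighted (okW T) (invW T) T)) * D
      ≈⟨ *-congʳ (trans (sumOver-concatMap _ (λ a → map (a ∷_) (words N n)) (lettersUpTo N)) (sumOver-cong (lettersUpTo N) perLetter)) ⟩
    sumOver (lettersUpTo N) (λ a → select (cond a) (letterWeight a (count a)) * S a) * D
      ≈⟨ *-congʳ (trans (sumOver-concatMap _ (λ v → letter (suc v) false ∷ letter (suc v) true ∷ []) (upTo N)) (sumOver-applyUpTo _ (λ c → c) N)) ⟩
    sumTo N (λ c → P c * S (pos c) + (Q c * S (neg c) + 0#)) * D
      ≈⟨ trans (*-comm _ _) (sym (sumTo-* D N _)) ⟩
    sumTo N (λ c → D * (P c * S (pos c) + (Q c * S (neg c) + 0#)))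
      ≈⟨ sumTo-cong N (λ c _ → trans (solve 5 (λ d p s q s' → d :* (p :* s :+ (q :* s' :+ con (+ 0))) := p :* (s :* d) :+ q :* (s' :* d)) refl D (P c) (S (pos c)) (Q c) (S (neg c)))
           (trans (+-cong (*-cong (selectPos c) (hyp c false)) (*-cong (selectNeg c) (hyp c true)))
             (solve 4 (λ p q x h → p :* x :* h :+ (:- q) :* x :* h := (p :- q) :* h :* x) refl (select (cond (pos c)) (t⁻¹ ^ count (pos c))) (select (cond (neg c)) (t * t⁻¹ ^ count (neg c))) (var c) (H c)))) ⟩
    sumTo N (λ c → (select (cond (pos c)) (t⁻¹ ^ count (pos c)) - select (cond (neg c)) (t * t⁻¹ ^ count (neg c))) * H c * var c)
      ≈⟨ sumTo-y _ ⟩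
    sumTo L (λ c → (select (cond (pos c)) (t⁻¹ ^ count (pos c)) - select (cond (neg c)) (t * t⁻¹ ^ count (neg c))) * H c * y c)  ∎
    where
    pos neg : ℕ → Letter
    pos c = letter (suc c) false
    neg c = letter (suc c) true
    S : Letter → Carrier
    S a = sumOver (words N n) (λ T → eval (weighted (ok a T) (inv a T) T))
    P Q : ℕ → Carrier
    P c = select (cond (pos c)) (letterWeight (pos c) (count (pos c)))
    Q c = select (cond (neg c)) (letterWeight (neg c) (count (neg c)))
    perLetter : ∀ a → sumOver (map (a ∷_) (words N n)) (λ T → eval (weighted (okW T) (invW T) T)) ≈ select (cond a) (letterWeight a (count a)) * S a
    perLetter a = trans (sumOver-map _ (a ∷_) (words N n)) (trans (sumOver-cong (words N n)
      (λ T → trans (reflexive (≡.cong₂ (λ u v → eval (weighted u v (a ∷ T))) (okW≡ a T) (invW≡ a T))) (eval-weighted-∷ (cond a) (ok a T) (count a) (inv a T) a T)))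
      (sumOver-* _ _ (words N n)))
    selectPos : ∀ c → P c ≈ select (cond (pos c)) (t⁻¹ ^ count (pos c)) * var c
    selectPos c with cond (pos c)
    ... | true = letterWeight-positive c (count (pos c))
    ... | false = sym (zeroˡ _)
    selectNeg : ∀ c → Q c ≈ - select (cond (neg c)) (t * t⁻¹ ^ count (neg c)) * var c
    selectNeg c with cond (neg c)
    ... | true = letterWeight-negative c (count (neg c))
    ... | false = sym (trans (*-congʳ -0#≈0#) (zeroˡ _))

  open Windows t t⁻¹ t*t⁻¹ y L using (Family; weight; weight-old; family; opE; opN; opM)

  posW negW : List ℕ → ℕ → Carrier
  posW w c = t⁻¹ ^ below c w
  negW w c = t * t⁻¹ ^ below (suc c) w

  weight-split : ∀ w c → weight w c ≈ posW w c - negW w c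
  weight-split w c = trans (solve 3 (λ B M t → B :* (con (+ 1) :- t :* M) := B :- t :* (B :* M)) refl (t⁻¹ ^ below c w) (t⁻¹ ^ mult c w) t)
    (+-congˡ (-‿cong (*-congˡ (sym (trans (reflexive (≡.cong (t⁻¹ ^_) (below-suc c w))) (^-homo-* t⁻¹ (below c w) (mult c w)))))))

  markedWeight : ℕ → List ℕ → ℕ → Carrier
  markedWeight b w c = select (b <ᵇ c) (posW w c) - select (b <ᵇ suc c) (negW w c)

  -- A letter b added to the window multiplies the weight of a new letter by t⁻¹ if the new letter
  -- attacks b, and leaves it alone otherwise. The difference thus selects the attackers of b, each
  -- with the factor t (t⁻¹ - 1) = 1 - t that the denominator of the marked corner removes.
  weight-marked : ∀ b w c → t * (weight (b ∷ w) c - weight w c) ≈ (1# - t) * markedWeight b w c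
  weight-marked b w c = trans (*-congˡ (+-cong (weight-split (b ∷ w) c) (-‿cong (weight-split w c))))
    (trans (solve 5 (λ t p q p' q' → t :* (p' :- q' :- (p :- q)) := t :* (p' :- p) :- t :* (q' :- q)) refl t (posW w c) (negW w c) (posW (b ∷ w) c) (negW (b ∷ w) c))
      (trans (+-cong (lemma (b <ᵇ c) (below c w)) (-‿cong negative))
        (solve 3 (λ t p q → (con (+ 1) :- t) :* p :- (con (+ 1) :- t) :* q := (con (+ 1) :- t) :* (p :- q)) refl t (select (b <ᵇ c) (posW w c)) (select (b <ᵇ suc c) (negW w c)))))
    where
    lemma : ∀ p n → t * (t⁻¹ ^ (bit p ℕ.+ n) - t⁻¹ ^ n) ≈ (1# - t) * select p (t⁻¹ ^ n)
    lemma true n = trans (solve 3 (λ t i p → t :* (i :* p :- p) := (t :* i) :* p :- t :* p) refl t t⁻¹ (t⁻¹ ^ n))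
      (trans (+-congʳ (*-congʳ t*t⁻¹)) (solve 2 (λ t p → con (+ 1) :* p :- t :* p := (con (+ 1) :- t) :* p) refl t (t⁻¹ ^ n)))
    lemma false n = trans (*-congˡ (-‿inverseʳ _)) (trans (zeroʳ t) (sym (zeroʳ _)))
    select-* : ∀ p f → t * select p f ≈ select p (t * f)
    select-* true f = refl
    select-* false f = zeroʳ t
    negative : t * (negW (b ∷ w) c - negW w c) ≈ (1# - t) * select (b <ᵇ suc c) (negW w c)
    negative = trans (solve 3 (λ t p q → t :* (t :* p :- t :* q) := t :* (t :* (p :- q))) refl t (t⁻¹ ^ below (suc c) (b ∷ w)) (t⁻¹ ^ below (suc c) w))
      (trans (*-congˡ (lemma (b <ᵇ suc c) (below (suc c) w)))
        (trans (solve 2 (λ t p → t :* ((con (+ 1) :- t) :* p) := (con (+ 1) :- t) :* (t :* p)) refl t (select (b <ᵇ suc c) (t⁻¹ ^ below (suc c) w)))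
          (*-congˡ (select-* (b <ᵇ suc c) _))))

  opM-cons : ∀ V b w → opM V (b ∷ w) ≈ sumTo L (λ c → (1# - t) * (markedWeight b w c * V (w ++ c ∷ []) * y c))
  opM-cons V b w = begin
    t * (sumTo L (λ c → weight (b ∷ w) c * y c * V (w ++ c ∷ [])) - sumTo L (λ c → weight w c * y c * V (w ++ c ∷ [])))
      ≈⟨ *-congˡ (+-congˡ (trans (solve 1 (λ f → :- f := :- con (+ 1) :* f) refl _) (sym (sumTo-* (- 1#) L _)))) ⟩
    t * (sumTo L (λ c → weight (b ∷ w) c * y c * V (w ++ c ∷ [])) + sumTo L (λ c → - 1# * (weight w c * y c * V (w ++ c ∷ []))))
      ≈⟨ trans (*-congˡ (sym (sumTo-+ L _ _))) (sym (sumTo-* t L _)) ⟩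
    sumTo L (λ c → t * (weight (b ∷ w) c * y c * V (w ++ c ∷ []) + - 1# * (weight w c * y c * V (w ++ c ∷ []))))
      ≈⟨ sumTo-cong L (λ c _ → trans (solve 5 (λ t u v x f → t :* (u :* x :* f :+ :- con (+ 1) :* (v :* x :* f)) := t :* (u :- v) :* f :* x) refl t (weight (b ∷ w) c) (weight w c) (y c) (V (w ++ c ∷ [])))
           (trans (*-congʳ (*-congʳ (weight-marked b w c))) (solve 4 (λ o m f x → o :* m :* f :* x := o :* (m :* f :* x)) refl (1# - t) (markedWeight b w c) (V (w ++ c ∷ [])) (y c)))) ⟩
    sumTo L (λ c → (1# - t) * (markedWeight b w c * V (w ++ c ∷ []) * y c))  ∎

  absL-snoc : ∀ w a → map absL (w ++ a ∷ []) ≡ map absL w ++ absL a ∷ []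
  absL-snoc w a = ListP.map-++ absL w (a ∷ [])

  -- Each marked corner consumes one factor 1 - t, the one that `weight-marked` produces.
  walk-sum : ∀ {s es} → Valid s es → ∀ w → length w ≡ s → All Positive w →
             sumOver (words N (norths es)) (λ T → eval (weighted (walkOK es w T) (walkInv es w T) T)) * (1# - t) ^ countM es ≈ family es (map absL w)
  walk-sum done w _ _ = trans (*-identityʳ _) (trans (+-identityʳ _) (trans (+-identityʳ _) (trans (*-cong κ-1 (*-identityʳ _)) (*-identityʳ _))))
  walk-sum (eastV v) (b ∷ w) |w| (p ∷ ps) = walk-sum v w (ℕP.suc-injective |w|) ps
  walk-sum (northV {s} {es} v) w |w| ps = trans
    (sum-letters (norths es) (walkOK (evN ∷ es) w) (walkInv (evN ∷ es) w) (λ _ → true) (λ a → attacks a w) (λ a → walkOK es (w ++ a ∷ [])) (λ a → walkInv es (w ++ a ∷ []))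
      (λ _ _ → ≡.refl) (λ _ _ → ≡.refl) ((1# - t) ^ countM es) (λ c → family es (map absL w ++ c ∷ []))
      (λ c b → trans (walk-sum v (w ++ letter (suc c) b ∷ []) (≡.trans (ListP.length-++ w) (≡.trans (ℕP.+-comm (length w) 1) (≡.cong suc |w|))) (AllP.++⁺ ps (s≤s z≤n ∷ [])))
        (reflexive (≡.cong (family es) (absL-snoc w (letter (suc c) b))))))
    (sumTo-cong L (λ c _ → trans (*-congʳ (*-congʳ (trans (reflexive (≡.cong₂ (λ m n → t⁻¹ ^ m - t * t⁻¹ ^ n) (attacks-positive c w ps) (attacks-negative c w ps))) (sym (weight-split (map absL w) c)))))
      (solve 3 (λ u f x → u :* f :* x := u :* x :* f) refl (weight (map absL w) c) (family es (map absL w ++ c ∷ [])) (y c))))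
  walk-sum (marked {s} {es} v) (b ∷ w) |w| (p ∷ ps) = begin
    S * ((1# - t) * (1# - t) ^ countM es)     ≈⟨ solve 3 (λ S o d → S :* (o :* d) := o :* (S :* d)) refl S (1# - t) ((1# - t) ^ countM es) ⟩
    (1# - t) * (S * (1# - t) ^ countM es)     ≈⟨ *-congˡ main ⟩
    (1# - t) * sumTo L (λ c → markedWeight (absL b) (map absL w) c * family es (map absL w ++ c ∷ []) * y c)  ≈⟨ sym (sumTo-* (1# - t) L _) ⟩
    sumTo L (λ c → (1# - t) * (markedWeight (absL b) (map absL w) c * family es (map absL w ++ c ∷ []) * y c))  ≈⟨ sym (opM-cons (family es) (absL b) (map absL w)) ⟩
    family (evM ∷ es) (map absL (b ∷ w))      ∎
    where
    S = sumOver (words N (suc (norths es))) (λ T → eval (weighted (walkOK (evM ∷ es) (b ∷ w) T) (walkInv (evM ∷ es) (b ∷ w) T) T))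
    main : S * (1# - t) ^ countM es ≈ sumTo L (λ c → markedWeight (absL b) (map absL w) c * family es (map absL w ++ c ∷ []) * y c)
    main = trans
      (sum-letters (norths es) (walkOK (evM ∷ es) (b ∷ w)) (walkInv (evM ∷ es) (b ∷ w)) (λ a → colDec a b) (λ a → attacks a w) (λ a → walkOK es (w ++ a ∷ [])) (λ a → walkInv es (w ++ a ∷ []))
        (λ _ _ → ≡.refl) (λ _ _ → ≡.refl) ((1# - t) ^ countM es) (λ c → family es (map absL w ++ c ∷ []))
        (λ c b → trans (walk-sum v (w ++ letter (suc c) b ∷ []) (≡.trans (ListP.length-++ w) (≡.trans (ℕP.+-comm (length w) 1) |w|)) (AllP.++⁺ ps (s≤s z≤n ∷ [])))
          (reflexive (≡.cong (family es) (absL-snoc w (letter (suc c) b))))))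
      (sumTo-cong L (λ c _ → *-congʳ (*-congʳ (+-cong
        (reflexive (≡.cong₂ (λ u n → select u (t⁻¹ ^ n)) (colDec-positive c b p) (attacks-positive c w ps)))
        (-‿cong (reflexive (≡.cong₂ (λ u n → select u (t * t⁻¹ ^ n)) (colDec-negative c b p) (attacks-negative c w ps))))))))

  flagged : ℕ → ℕ → Family → Family
  flagged i zero V w = V w
  flagged i (suc j) V w = sumTo L (λ c → (select (c <ᵇ suc i) (posW w c) - select (c <ᵇ i) (negW w c)) * flagged (suc i) j V (w ++ c ∷ []) * y c)

  flag-sum : ∀ {s es} → Valid s es → ∀ i j w → j ℕ.+ length w ≡ s → All Positive w →
             sumOver (words N (j ℕ.+ norths es)) (λ T → eval (weighted (flagOK i j es w T) (flagInv j es w T) T)) * (1# - t) ^ countM es ≈ flagged i j (family es) (map absL w)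
  flag-sum v i zero w |w| ps = walk-sum v w |w| ps
  flag-sum {s} {es} v i (suc j) w |w| ps = trans
    (sum-letters (j ℕ.+ norths es) (flagOK i (suc j) es w) (flagInv (suc j) es w) (λ a → code a ≤ᵇ 2 ℕ.* suc i) (λ a → attacks a w) (λ a → flagOK (suc i) j es (w ++ a ∷ [])) (λ a → flagInv j es (w ++ a ∷ []))
      (λ _ _ → ≡.refl) (λ _ _ → ≡.refl) ((1# - t) ^ countM es) (λ c → flagged (suc i) j (family es) (map absL w ++ c ∷ []))
      (λ c b → trans (flag-sum v (suc i) j (w ++ letter (suc c) b ∷ []) (≡.trans (≡.cong (j ℕ.+_) (≡.trans (ListP.length-++ w) (ℕP.+-comm (length w) 1))) (≡.trans (ℕP.+-suc j (length w)) |w|)) (AllP.++⁺ ps (s≤s z≤n ∷ [])))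
        (reflexive (≡.cong (flagged (suc i) j (family es)) (absL-snoc w (letter (suc c) b))))))
    (sumTo-cong L (λ c _ → *-congʳ (*-congʳ (+-cong
      (reflexive (≡.cong₂ (λ u n → select u (t⁻¹ ^ n)) (flag-positive c i) (attacks-positive c w ps)))
      (-‿cong (reflexive (≡.cong₂ (λ u n → select u (t * t⁻¹ ^ n)) (flag-negative c i) (attacks-negative c w ps))))))))

  -- All smaller letters are already present, so by cancellation the flagged letter number i is forced.
  flagged-step : ∀ i j V → i < L → flagged i (suc j) V (interval 0 i) ≈ t⁻¹ ^ i * y i * flagged (suc i) j V (interval 0 (suc i))
  flagged-step i j V i<L = begin
    sumTo L summand                                      ≈⟨ reflexive (≡.cong (λ n → sumTo n summand) (≡.sym (ℕP.m+[n∸m]≡n i<L))) ⟩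
    sumTo (suc i ℕ.+ (L ∸ suc i)) summand                ≈⟨ sumTo-split (suc i) (L ∸ suc i) summand ⟩
    sumTo i summand + summand i + sumTo (L ∸ suc i) (λ l → summand (suc i ℕ.+ l))
      ≈⟨ +-cong (+-cong (sumTo-0 i small) exact) (sumTo-0 (L ∸ suc i) large) ⟩
    0# + t⁻¹ ^ i * y i * flagged (suc i) j V (interval 0 (suc i)) + 0#  ≈⟨ trans (+-identityʳ _) (+-identityˡ _) ⟩
    t⁻¹ ^ i * y i * flagged (suc i) j V (interval 0 (suc i))  ∎
    where
    w = interval 0 i
    summand : ℕ → Carrier
    summand c = (select (c <ᵇ suc i) (posW w c) - select (c <ᵇ i) (negW w c)) * flagged (suc i) j V (w ++ c ∷ []) * y c
    small : ∀ c → c < i → summand c ≈ 0#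
    small c c<i = trans (*-congʳ (trans (*-congʳ (trans (reflexive (≡.cong₂ (λ p q → select p (posW w c) - select q (negW w c)) (<⇒≡true (ℕP.m<n⇒m<1+n c<i)) (<⇒≡true c<i)))
      (trans (sym (weight-split w c)) (weight-old w c (mult-interval i c<i))))) (zeroˡ _))) (zeroˡ _)
    exact : summand i ≈ t⁻¹ ^ i * y i * flagged (suc i) j V (interval 0 (suc i))
    exact = trans (*-congʳ (*-cong (trans (reflexive (≡.cong₂ (λ p q → select p (posW w i) - select q (negW w i)) (<⇒≡true (ℕP.n<1+n i)) (≮⇒≡false (ℕP.≤-refl {i}))))
        (trans (+-congˡ -0#≈0#) (trans (+-identityʳ _) (reflexive (≡.cong (t⁻¹ ^_) (below-interval i i ℕP.≤-refl))))))
        (reflexive (≡.cong (flagged (suc i) j V) (≡.sym (interval-snoc 0 i))))))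
      (solve 3 (λ u f x → u :* f :* x := u :* x :* f) refl (t⁻¹ ^ i) (flagged (suc i) j V (interval 0 (suc i))) (y i))
    large : ∀ l → l < L ∸ suc i → summand (suc i ℕ.+ l) ≈ 0#
    large l _ = trans (*-congʳ (trans (*-congʳ (trans (reflexive (≡.cong₂ (λ p q → select p (posW w (suc i ℕ.+ l)) - select q (negW w (suc i ℕ.+ l)))
      (≮⇒≡false (ℕP.m≤m+n (suc i) l)) (≮⇒≡false (ℕP.≤-trans (ℕP.n≤1+n i) (ℕP.m≤m+n (suc i) l))))) (-‿inverseʳ 0#))) (zeroˡ _))) (zeroˡ _)

  flagProduct : ℕ → ℕ → Carrier
  flagProduct i zero = 1#
  flagProduct i (suc j) = t⁻¹ ^ i * y i * flagProduct (suc i) j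

  flagged-interval : ∀ i j V → i ℕ.+ j ≤ L → flagged i j V (interval 0 i) ≈ flagProduct i j * V (interval 0 (i ℕ.+ j))
  flagged-interval i zero V _ = trans (reflexive (≡.cong (λ n → V (interval 0 n)) (≡.sym (ℕP.+-identityʳ i)))) (sym (*-identityˡ _))
  flagged-interval i (suc j) V h = trans (flagged-step i j V (ℕP.≤-trans (ℕP.m≤m+n (suc i) j) h'))
    (trans (*-congˡ (trans (flagged-interval (suc i) j V h') (reflexive (≡.cong (λ n → flagProduct (suc i) j * V (interval 0 n)) (≡.sym (ℕP.+-suc i j)))))) (sym (*-assoc _ _ _)))
    where
    h' : suc i ℕ.+ j ≤ L
    h' = ≡.subst (_≤ L) (ℕP.+-suc i j) h

-- Statistics of words along the path

-- The rest of a path from (x, y), arranged for recursion. Only an east step can cross the diagonal,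
-- so it alone carries a condition.
data Above (d : ℕ) : ℕ → ℕ → List Step → Set where
  end   : Above d d d []
  stepE : ∀ {x y ss} → suc x ≤ y → Above d (suc x) y ss → Above d x y (east ∷ ss)
  stepN : ∀ {x y ss} → Above d x (suc y) ss → Above d x y (north ∷ ss)

Dyck⇒Above : ∀ d x y ss → x ℕ.+ countE ss ≡ d → y ℕ.+ countN ss ≡ d → (∀ k → x ℕ.+ countE (take k ss) ≤ y ℕ.+ countN (take k ss)) → Above d x y ss
Dyck⇒Above d x y [] e n h = ≡.subst₂ (λ x y → Above d x y []) (≡.trans (≡.sym e) (ℕP.+-identityʳ x)) (≡.trans (≡.sym n) (ℕP.+-identityʳ y)) end
Dyck⇒Above d x y (east ∷ ss) e n h = stepE (≡.subst₂ _≤_ (ℕP.+-comm x 1) (ℕP.+-identityʳ y) (h 1))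
  (Dyck⇒Above d (suc x) y ss (≡.trans (≡.sym (ℕP.+-suc x _)) e) n (λ k → ≡.subst (_≤ y ℕ.+ countN (take k ss)) (ℕP.+-suc x _) (h (suc k))))
Dyck⇒Above d x y (north ∷ ss) e n h = stepN
  (Dyck⇒Above d x (suc y) ss e (≡.trans (≡.sym (ℕP.+-suc y _)) n) (λ k → ≡.subst (x ℕ.+ countE (take k ss) ≤_) (ℕP.+-suc y _) (h (suc k))))

above-height : ∀ {d x y ss} → Above d x y ss → y ℕ.+ countN ss ≡ d
above-height end = ℕP.+-identityʳ _
above-height (stepE _ p) = above-height p
above-height {y = y} (stepN p) = ≡.trans (ℕP.+-suc y _) (above-height p)

above-≤ : ∀ {d x y ss} → Above d x y ss → y ≤ d
above-≤ {y = y} p = ≡.subst (y ≤_) (above-height p) (ℕP.m≤m+n y _)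

≡-valid : ∀ {s s' es} → s ≡ s' → Valid s es → Valid s' es
≡-valid ≡.refl v = v

events-valid : ∀ Σ {d x y ss} → Above d x y ss → x ≤ y → Valid (y ∸ x) (events Σ x y ss)
events-valid Σ {d} end _ = ≡-valid (≡.sym (ℕP.n∸n≡0 d)) done
events-valid Σ {x = x} {y} (stepN {ss = ss} p) x≤y = northV (≡.subst (λ s → Valid s (events Σ x (suc y) ss)) (ℕP.+-∸-assoc 1 x≤y) (events-valid Σ p (ℕP.m≤n⇒m≤1+n x≤y)))
events-valid Σ {x = x} {y} (stepE {ss = []} x<y p) x≤y = ≡-valid (≡.sym (ℕP.+-∸-assoc 1 x<y)) (eastV (events-valid Σ p x<y))
events-valid Σ {x = x} {y} (stepE {ss = east ∷ ss} x<y p) x≤y = ≡-valid (≡.sym (ℕP.+-∸-assoc 1 x<y)) (eastV (events-valid Σ p x<y))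
events-valid Σ {x = x} {y} (stepE {ss = north ∷ ss} x<y (stepN p)) x≤y with memB (suc x , suc y) Σ
... | false = ≡-valid (≡.sym (ℕP.+-∸-assoc 1 x<y)) (eastV (northV (≡-valid (ℕP.+-∸-assoc 1 x<y) (events-valid Σ p (ℕP.m≤n⇒m≤1+n x<y)))))
... | true = ≡-valid (≡.sym (ℕP.+-∸-assoc 1 x<y)) (marked (≡.subst (λ s → Valid s (events Σ (suc x) (suc y) ss)) (ℕP.+-∸-assoc 1 x<y) (events-valid Σ p (ℕP.m≤n⇒m≤1+n x<y))))

norths-events : ∀ Σ x y ss → norths (events Σ x y ss) ≡ countN ss
norths-events Σ x y [] = ≡.refl
norths-events Σ x y (north ∷ ss) = ≡.cong suc (norths-events Σ x (suc y) ss)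
norths-events Σ x y (east ∷ []) = ≡.refl
norths-events Σ x y (east ∷ east ∷ ss) = norths-events Σ (suc x) y (east ∷ ss)
norths-events Σ x y (east ∷ north ∷ ss) with memB (suc x , suc y) Σ
... | true = ≡.cong suc (norths-events Σ (suc x) (suc y) ss)
... | false = ≡.cong suc (norths-events Σ (suc x) (suc y) ss)

take-snoc : ∀ i U → i < length U → take (suc i) U ≡ take i U ++ lookupL U (suc i) ∷ []
take-snoc zero (a ∷ U) _ = ≡.refl
take-snoc (suc i) (a ∷ U) (s≤s h) = ≡.cong (a ∷_) (take-snoc i U h)

drop-cons : ∀ i U → i < length U → drop i U ≡ lookupL U (suc i) ∷ drop (suc i) U
drop-cons zero (a ∷ U) _ = ≡.refl
drop-cons (suc i) (a ∷ U) (s≤s h) = drop-cons i U h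

window : ℕ → ℕ → List Letter → List Letter
window x y U = drop x (take y U)

drop-++ : ∀ x (u v : List Letter) → x ≤ length u → drop x (u ++ v) ≡ drop x u ++ v
drop-++ zero u v _ = ≡.refl
drop-++ (suc x) (a ∷ u) v (s≤s h) = drop-++ x u v h

window-snoc : ∀ {x y} U → x ≤ y → y < length U → window x (suc y) U ≡ window x y U ++ lookupL U (suc y) ∷ []
window-snoc {x} {y} U x≤y y<n = ≡.trans (≡.cong (drop x) (take-snoc y U y<n)) (drop-++ x (take y U) _
  (≡.subst (x ≤_) (≡.sym (≡.trans (ListP.length-take y U) (ℕP.m≤n⇒m⊓n≡m (ℕP.<⇒≤ y<n)))) x≤y))

window-tail : ∀ x y U → drop 1 (window x y U) ≡ window (suc x) y U
window-tail x y U = ≡.trans (ListP.drop-drop x 1 (take y U)) (≡.cong (λ z → drop z (take y U)) (ℕP.+-comm x 1))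

window-first : ∀ {x y} U → x < y → y ≤ length U → firstL (window x y U) ≡ lookupL U (suc x)
window-first {zero} {suc y} (a ∷ U) _ _ = ≡.refl
window-first {suc x} {suc y} (a ∷ U) (s≤s x<y) (s≤s h) = window-first U x<y h

total : ℕ → (ℕ → ℕ) → ℕ
total zero f = 0
total (suc n) f = f 0 ℕ.+ total n (f ∘ suc)

total-cong : ∀ n {f g} → (∀ i → i < n → f i ≡ g i) → total n f ≡ total n g
total-cong zero h = ≡.refl
total-cong (suc n) h = ≡.cong₂ ℕ._+_ (h 0 (s≤s z≤n)) (total-cong n (λ i i<n → h (suc i) (s≤s i<n)))

total-0 : ∀ n → total n (λ _ → 0) ≡ 0
total-0 zero = ≡.refl
total-0 (suc n) = total-0 n

total-+ : ∀ n f g → total n (λ i → f i ℕ.+ g i) ≡ total n f ℕ.+ total n g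
total-+ zero f g = ≡.refl
total-+ (suc n) f g = ≡.trans (≡.cong (f 0 ℕ.+ g 0 ℕ.+_) (total-+ n (f ∘ suc) (g ∘ suc))) (interchange (f 0) (g 0) _ _)
  where open import Algebra.Properties.CommutativeSemigroup ℕP.+-commutativeSemigroup using (interchange)

total-swap : ∀ m n (f : ℕ → ℕ → ℕ) → total m (λ i → total n (f i)) ≡ total n (λ j → total m (λ i → f i j))
total-swap zero n f = ≡.sym (total-0 n)
total-swap (suc m) n f = ≡.trans (≡.cong (total n (f 0) ℕ.+_) (total-swap m n (f ∘ suc))) (≡.sym (total-+ n (f 0) _))

total-split : ∀ m n f → total (m ℕ.+ n) f ≡ total m f ℕ.+ total n (λ i → f (m ℕ.+ i))
total-split zero n f = ≡.refl
total-split (suc m) n f = ≡.trans (≡.cong (f 0 ℕ.+_) (total-split m n (f ∘ suc))) (≡.sym (ℕP.+-assoc (f 0) _ _))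

countB-++ : ∀ bs cs → countB (bs ++ cs) ≡ countB bs ℕ.+ countB cs
countB-++ [] cs = ≡.refl
countB-++ (b ∷ bs) cs = ≡.trans (≡.cong (bit b ℕ.+_) (countB-++ bs cs)) (≡.sym (ℕP.+-assoc (bit b) _ _))

countB-applyUpTo : ∀ (p : ℕ → Bool) g n → countB (map p (applyUpTo g n)) ≡ total n (λ i → bit (p (g i)))
countB-applyUpTo p g zero = ≡.refl
countB-applyUpTo p g (suc n) = ≡.cong (bit (p (g 0)) ℕ.+_) (countB-applyUpTo p (g ∘ suc) n)

countB-concatMap : ∀ (p : ℕ → List Bool) g n → countB (concatMap p (applyUpTo g n)) ≡ total n (λ i → countB (p (g i)))
countB-concatMap p g zero = ≡.refl
countB-concatMap p g (suc n) = ≡.trans (countB-++ (p (g 0)) _) (≡.cong (countB (p (g 0)) ℕ.+_) (countB-concatMap p (g ∘ suc) n))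

attacks-window : ∀ a X j U → attacks a (window X j U) ≡ total (length U) (λ i → bit (((i <ᵇ j) ∧ (X <ᵇ suc i)) ∧ colDec a (lookupL U (suc i))))
attacks-window a zero zero U = ≡.sym (total-0 (length U))
attacks-window a (suc X) zero U = ≡.sym (total-0 (length U))
attacks-window a zero (suc j) [] = ≡.refl
attacks-window a (suc X) (suc j) [] = ≡.refl
attacks-window a zero (suc j) (b ∷ U) = ≡.cong (bit (colDec a b) ℕ.+_) (attacks-window a zero j U)
attacks-window a (suc X) (suc j) (b ∷ U) = attacks-window a X j U

module Rows (r d : ℕ) (π : Dyck r d) (U : List Letter) (|U| : length U ≡ d) where

  -- The area boxes of row j + 1 lie between its north step and the diagonal; their columns are the
  -- positions in the window at the moment when letter j + 1 is read.
  rowAttacks : ℕ → ℕ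
  rowAttacks j = attacks (lookupL U (suc j)) (window (Xrow r (steps π) (suc j)) j U)

  invT̃-rows : invT̃ r d π U ≡ total d rowAttacks
  invT̃-rows = ≡.trans (countB-concatMap _ (λ i → i) d) (≡.trans (total-cong d (λ i _ → countB-applyUpTo _ (λ j → j) d))
    (≡.trans (total-swap d d _) (total-cong d row)))
    where
    row : ∀ j → j < d → total d (λ i → bit (AreaB r d (steps π) (suc i) (suc j) ∧ colDec (lookupL U (suc j)) (lookupL U (suc i)))) ≡ rowAttacks j
    row j j<d = ≡.trans (≡.trans (total-cong d (λ i _ → ≡.cong (λ b → bit (b ∧ colDec (lookupL U (suc j)) (lookupL U (suc i))))
        (≡.cong (λ b → (i <ᵇ j) ∧ b ∧ (Xrow r (steps π) (suc j) <ᵇ suc i)) (<⇒≡true j<d))))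
      (≡.cong (λ n → total n (λ i → bit (((i <ᵇ j) ∧ (Xrow r (steps π) (suc j) <ᵇ suc i)) ∧ colDec (lookupL U (suc j)) (lookupL U (suc i))))) (≡.sym |U|)))
      (≡.sym (attacks-window (lookupL U (suc j)) (Xrow r (steps π) (suc j)) j U))

walkSteps : List Step → List Letter → List Letter → ℕ
walkSteps [] w U = 0
walkSteps (east ∷ ss) w U = walkSteps ss (drop 1 w) U
walkSteps (north ∷ ss) w [] = 0
walkSteps (north ∷ ss) w (a ∷ U) = attacks a w ℕ.+ walkSteps ss (w ++ a ∷ []) U

-- Merging the steps of a marked corner does not affect the count: at an unmarked corner, too, the
-- first letter is popped before the new one is compared.
walkInv-events : ∀ Σ x y ss w U → walkInv (events Σ x y ss) w U ≡ walkSteps ss w U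
walkInv-events Σ x y [] w U = ≡.refl
walkInv-events Σ x y (north ∷ ss) w [] = ≡.refl
walkInv-events Σ x y (north ∷ ss) w (a ∷ U) = ≡.cong (attacks a w ℕ.+_) (walkInv-events Σ x (suc y) ss (w ++ a ∷ []) U)
walkInv-events Σ x y (east ∷ []) w U = ≡.refl
walkInv-events Σ x y (east ∷ east ∷ ss) w U = walkInv-events Σ (suc x) y (east ∷ ss) (drop 1 w) U
walkInv-events Σ x y (east ∷ north ∷ ss) w U with memB (suc x , suc y) Σ
walkInv-events Σ x y (east ∷ north ∷ ss) w [] | true = ≡.refl
walkInv-events Σ x y (east ∷ north ∷ ss) w (a ∷ U) | true = ≡.cong (attacks a (drop 1 w) ℕ.+_) (walkInv-events Σ (suc x) (suc y) ss (drop 1 w ++ a ∷ []) U)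
walkInv-events Σ x y (east ∷ north ∷ ss) w [] | false = ≡.refl
walkInv-events Σ x y (east ∷ north ∷ ss) w (a ∷ U) | false = ≡.cong (attacks a (drop 1 w) ℕ.+_) (walkInv-events Σ (suc x) (suc y) ss (drop 1 w ++ a ∷ []) U)

≢⇒≡ᵇ-false : ∀ {a b} → a ≢ b → (a ≡ᵇ b) ≡ false
≢⇒≡ᵇ-false {a} {b} a≢b = ¬T⇒≡false (a≢b ∘ ℕP.≡ᵇ⇒≡ a b)

≡ᵇ-refl : ∀ a → (a ≡ᵇ a) ≡ true
≡ᵇ-refl a = T⇒≡true (ℕP.≡⇒≡ᵇ a a ≡.refl)

XrowGo-here : ∀ x y ss → XrowGo x y (north ∷ ss) (suc y) ≡ x
XrowGo-here x y ss = ≡.cong (λ b → if b then x else XrowGo x (suc y) ss (suc y)) (≡ᵇ-refl y)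

XrowGo-later : ∀ x y ss {j} → suc y ≢ j → XrowGo x y (north ∷ ss) j ≡ XrowGo x (suc y) ss j
XrowGo-later x y ss {j} ne = ≡.cong (λ b → if b then x else XrowGo x (suc y) ss j) (≢⇒≡ᵇ-false ne)

walkSteps-rows : ∀ {d x y ss} U → Above d x y ss → x ≤ y → d ≤ length U →
  walkSteps ss (window x y U) (drop y U) ≡ total (countN ss) (λ l → attacks (lookupL U (suc (y ℕ.+ l))) (window (XrowGo x y ss (suc (y ℕ.+ l))) (y ℕ.+ l) U))
walkSteps-rows U end _ _ = ≡.refl
walkSteps-rows {x = x} {y} U (stepE {ss = ss} x<y p) _ h = ≡.trans (≡.cong (λ w → walkSteps ss w (drop y U)) (window-tail x y U)) (walkSteps-rows U p x<y h)
walkSteps-rows {x = x} {y} U (stepN {ss = ss} p) x≤y h = begin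
  walkSteps (north ∷ ss) (window x y U) (drop y U)  ≡⟨ ≡.cong (walkSteps (north ∷ ss) (window x y U)) (drop-cons y U y<n) ⟩
  attacks a (window x y U) ℕ.+ walkSteps ss (window x y U ++ a ∷ []) (drop (suc y) U)
    ≡⟨ ≡.cong₂ ℕ._+_ first (≡.trans (≡.cong (λ w → walkSteps ss w (drop (suc y) U)) (≡.sym (window-snoc U x≤y y<n))) (walkSteps-rows U p (ℕP.m≤n⇒m≤1+n x≤y) h)) ⟩
  row 0 ℕ.+ total (countN ss) (λ l → attacks (lookupL U (suc (suc y ℕ.+ l))) (window (XrowGo x (suc y) ss (suc (suc y ℕ.+ l))) (suc y ℕ.+ l) U))
    ≡⟨ ≡.cong (row 0 ℕ.+_) (total-cong (countN ss) (λ l _ → later l)) ⟩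
  total (suc (countN ss)) row                       ∎
  where
  open ≡.≡-Reasoning
  a = lookupL U (suc y)
  y<n : y < length U
  y<n = ℕP.≤-trans (above-≤ p) h
  row : ℕ → ℕ
  row l = attacks (lookupL U (suc (y ℕ.+ l))) (window (XrowGo x y (north ∷ ss) (suc (y ℕ.+ l))) (y ℕ.+ l) U)
  first : attacks a (window x y U) ≡ row 0
  first = ≡.trans (≡.cong (λ X → attacks a (window X y U)) (≡.sym (XrowGo-here x y ss)))
    (≡.cong (λ z → attacks (lookupL U (suc z)) (window (XrowGo x y (north ∷ ss) (suc z)) z U)) (≡.sym (ℕP.+-identityʳ y)))
  later : ∀ l → attacks (lookupL U (suc (suc y ℕ.+ l))) (window (XrowGo x (suc y) ss (suc (suc y ℕ.+ l))) (suc y ℕ.+ l) U) ≡ row (suc l)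
  later l = ≡.trans (≡.cong (λ X → attacks (lookupL U (suc (suc y ℕ.+ l))) (window X (suc y ℕ.+ l) U))
      (≡.sym (XrowGo-later x y ss (λ e → ℕP.m≢1+m+n y (ℕP.suc-injective e)))))
    (≡.cong (λ z → attacks (lookupL U (suc z)) (window (XrowGo x y (north ∷ ss) (suc z)) z U)) (≡.sym (ℕP.+-suc y l)))

flagInv-rows : ∀ i j es U → i ℕ.+ j ≤ length U →
  flagInv j es (take i U) (drop i U) ≡ total j (λ l → attacks (lookupL U (suc (i ℕ.+ l))) (take (i ℕ.+ l) U)) ℕ.+ walkInv es (take (i ℕ.+ j) U) (drop (i ℕ.+ j) U)
flagInv-rows i zero es U _ = ≡.cong (λ z → walkInv es (take z U) (drop z U)) (≡.sym (ℕP.+-identityʳ i))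
flagInv-rows i (suc j) es U h = begin
  flagInv (suc j) es (take i U) (drop i U)    ≡⟨ ≡.cong (flagInv (suc j) es (take i U)) (drop-cons i U i<n) ⟩
  attacks a (take i U) ℕ.+ flagInv j es (take i U ++ a ∷ []) (drop (suc i) U)
    ≡⟨ ≡.cong₂ ℕ._+_ (≡.cong row (≡.sym (ℕP.+-identityʳ i))) (≡.trans (≡.cong (λ w → flagInv j es w (drop (suc i) U)) (≡.sym (take-snoc i U i<n))) (flagInv-rows (suc i) j es U h')) ⟩
  row (i ℕ.+ 0) ℕ.+ (total j (λ l → row (suc i ℕ.+ l)) ℕ.+ walkInv es (take (suc i ℕ.+ j) U) (drop (suc i ℕ.+ j) U))
    ≡⟨ ≡.sym (ℕP.+-assoc (row (i ℕ.+ 0)) _ _) ⟩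
  row (i ℕ.+ 0) ℕ.+ total j (λ l → row (suc i ℕ.+ l)) ℕ.+ walkInv es (take (suc i ℕ.+ j) U) (drop (suc i ℕ.+ j) U)
    ≡⟨ ≡.cong₂ ℕ._+_ (≡.cong (row (i ℕ.+ 0) ℕ.+_) (total-cong j (λ l _ → ≡.cong row (≡.sym (ℕP.+-suc i l))))) (≡.cong (λ z → walkInv es (take z U) (drop z U)) (≡.sym (ℕP.+-suc i j))) ⟩
  total (suc j) (λ l → row (i ℕ.+ l)) ℕ.+ walkInv es (take (i ℕ.+ suc j) U) (drop (i ℕ.+ suc j) U)  ∎
  where
  open ≡.≡-Reasoning
  a = lookupL U (suc i)
  row : ℕ → ℕ
  row z = attacks (lookupL U (suc z)) (take z U)
  h' : suc i ℕ.+ j ≤ length U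
  h' = ≡.subst (_≤ length U) (ℕP.+-suc i j) h
  i<n : i < length U
  i<n = ℕP.≤-trans (ℕP.m≤m+n (suc i) j) h'

flagOK-rows : ∀ i j es U (g : ℕ → ℕ) → (∀ l → g l ≡ i ℕ.+ l) → i ℕ.+ j ≤ length U →
  flagOK i j es (take i U) (drop i U) ≡ allB (λ l → code (lookupL U (suc l)) ≤ᵇ 2 ℕ.* suc l) (applyUpTo g j) ∧ walkOK es (take (i ℕ.+ j) U) (drop (i ℕ.+ j) U)
flagOK-rows i zero es U g g≡ _ = ≡.cong (λ z → walkOK es (take z U) (drop z U)) (≡.sym (ℕP.+-identityʳ i))
flagOK-rows i (suc j) es U g g≡ h = begin
  flagOK i (suc j) es (take i U) (drop i U)    ≡⟨ ≡.cong (flagOK i (suc j) es (take i U)) (drop-cons i U i<n) ⟩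
  flag i ∧ flagOK (suc i) j es (take i U ++ lookupL U (suc i) ∷ []) (drop (suc i) U)
    ≡⟨ ≡.cong₂ _∧_ (≡.cong flag (≡.sym (≡.trans (g≡ 0) (ℕP.+-identityʳ i)))) (≡.trans (≡.cong (λ w → flagOK (suc i) j es w (drop (suc i) U)) (≡.sym (take-snoc i U i<n)))
         (flagOK-rows (suc i) j es U (g ∘ suc) (λ l → ≡.trans (g≡ (suc l)) (ℕP.+-suc i l)) h')) ⟩
  flag (g 0) ∧ (allB flag (applyUpTo (g ∘ suc) j) ∧ walkOK es (take (suc i ℕ.+ j) U) (drop (suc i ℕ.+ j) U))
    ≡⟨ ≡.sym (BoolP.∧-assoc (flag (g 0)) _ _) ⟩
  (flag (g 0) ∧ allB flag (applyUpTo (g ∘ suc) j)) ∧ walkOK es (take (suc i ℕ.+ j) U) (drop (suc i ℕ.+ j) U)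
    ≡⟨ ≡.cong ((flag (g 0) ∧ allB flag (applyUpTo (g ∘ suc) j)) ∧_) (≡.cong (λ z → walkOK es (take z U) (drop z U)) (≡.sym (ℕP.+-suc i j))) ⟩
  allB flag (applyUpTo g (suc j)) ∧ walkOK es (take (i ℕ.+ suc j) U) (drop (i ℕ.+ suc j) U)  ∎
  where
  open ≡.≡-Reasoning
  flag : ℕ → Bool
  flag l = code (lookupL U (suc l)) ≤ᵇ 2 ℕ.* suc l
  h' : suc i ℕ.+ j ≤ length U
  h' = ≡.subst (_≤ length U) (ℕP.+-suc i j) h
  i<n : i < length U
  i<n = ℕP.≤-trans (ℕP.m≤m+n (suc i) j) h'

data Corner : ℕ → ℕ → List Step → ℕ → ℕ → Set where
  here   : ∀ {x y ss} → Corner x y (east ∷ north ∷ ss) (suc x) (suc y)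
  thereE : ∀ {x y ss i j} → Corner (suc x) y ss i j → Corner x y (east ∷ ss) i j
  thereN : ∀ {x y ss i j} → Corner x (suc y) ss i j → Corner x y (north ∷ ss) i j

XrowGo-≥ : ∀ {d x y ss j} → Above d x y ss → y < j → j ≤ d → x ≤ XrowGo x y ss j
XrowGo-≥ end y<j j≤d = ⊥-elim (ℕP.<⇒≱ y<j j≤d)
XrowGo-≥ (stepE _ p) y<j j≤d = ℕP.≤-trans (ℕP.n≤1+n _) (XrowGo-≥ p y<j j≤d)
XrowGo-≥ {x = x} {y} {north ∷ ss} {j} (stepN p) y<j j≤d with suc y ℕP.≟ j
... | yes ≡.refl = ℕP.≤-reflexive (≡.sym (XrowGo-here x y ss))
... | no ne = ≡.subst (x ≤_) (≡.sym (XrowGo-later x y ss ne)) (XrowGo-≥ p (ℕP.≤∧≢⇒< y<j ne) j≤d)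

-- Once the walk has reached height j - 1, row j - 1 lies behind it and `XrowGo` would return its
-- default 0. The premise for `j ≡ suc y` replaces the condition on that row: x < c says that an
-- east step is still to come before the north step of row j.
locate : ∀ {d x y ss c j} → Above d x y ss → y < j → j ≤ d → XrowGo x y ss j ≡ c → (j ≡ suc y → x < c) → (suc y < j → XrowGo x y ss (j ∸ 1) < c) → Corner x y ss c j
locate end y<j j≤d _ _ _ = ⊥-elim (ℕP.<⇒≱ y<j j≤d)
locate {x = x} {y} {north ∷ ss} {c} {j} (stepN p) y<j j≤d X≡c first below-row with suc y ℕP.≟ j
... | yes ≡.refl = ⊥-elim (ℕP.<⇒≢ (first ≡.refl) (≡.trans (≡.sym (XrowGo-here x y ss)) X≡c))
... | no ne = thereN (locate p y+1<j j≤d (≡.trans (≡.sym (XrowGo-later x y ss ne)) X≡c)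
    (λ { ≡.refl → ≡.subst (_< c) (XrowGo-here x y ss) (below-row y+1<j) })
    (λ lt → ≡.subst (_< c) (XrowGo-later x y ss (λ e → ℕP.<⇒≢ lt (≡.trans (≡.cong suc e) (ℕP.suc-pred j {{ℕ.>-nonZero (ℕP.≤-<-trans z≤n y<j)}})))) (below-row y+1<j)))
  where
  y+1<j : suc y < j
  y+1<j = ℕP.≤∧≢⇒< y<j ne
locate (stepE {ss = []} _ end) y<j j≤d _ _ _ = ⊥-elim (ℕP.<⇒≱ y<j j≤d)
locate {x = x} {y} {c = c} {j} (stepE {ss = east ∷ ss} _ p) y<j j≤d X≡c first below-row =
  thereE (locate p y<j j≤d X≡c (λ _ → ≡.subst (suc (suc x) ≤_) X≡c (XrowGo-≥ (dropE p) y<j j≤d)) below-row)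
  where
  dropE : ∀ {d x y ss} → Above d x y (east ∷ ss) → Above d (suc x) y ss
  dropE (stepE _ q) = q
locate {x = x} {y} {c = c} {j} (stepE {ss = north ∷ ss} _ p) y<j j≤d X≡c first below-row with suc y ℕP.≟ j
... | yes ≡.refl = ≡.subst (λ c → Corner x y (east ∷ north ∷ ss) c (suc y)) (≡.trans (≡.sym (XrowGo-here (suc x) y ss)) X≡c) here
... | no ne = thereE (locate p y<j j≤d X≡c (λ e → ⊥-elim (ne (≡.sym e))) below-row)

module Marks (Σ : List (ℕ × ℕ)) (d : ℕ) (U : List Letter) (|U| : length U ≡ d) where

  decreasing : ℕ → ℕ → Bool
  decreasing i j = colDec (lookupL U j) (lookupL U i)

  -- The condition is indexed by corners of the path, as the walk meets them, and not by the entries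
  -- of Σ, so repeated entries do no harm.
  Respects : ℕ → ℕ → List Step → Set
  Respects x y ss = ∀ {i j} → Corner x y ss i j → T (memB (i , j) Σ) → T (decreasing i j)

  bound : ∀ {y} → y ≤ d → y ≤ length U
  bound {y} = ≡.subst (y ≤_) (≡.sym |U|)

  ok : ℕ → ℕ → List Step → Bool
  ok x y ss = walkOK (events Σ x y ss) (window x y U) (drop y U)

  ok-north : ∀ {x y ss} → x ≤ y → y < d → ok x y (north ∷ ss) ≡ ok x (suc y) ss
  ok-north {x} {y} {ss} x≤y y<d = ≡.trans (≡.cong (walkOK (evN ∷ events Σ x (suc y) ss) (window x y U)) (drop-cons y U (bound y<d)))
    (≡.cong (λ w → walkOK (events Σ x (suc y) ss) w (drop (suc y) U)) (≡.sym (window-snoc U x≤y (bound y<d))))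

  ok-marked : ∀ {x y ss} → x < y → y < d →
    walkOK (evM ∷ events Σ (suc x) (suc y) ss) (window x y U) (drop y U) ≡ decreasing (suc x) (suc y) ∧ ok (suc x) (suc y) ss
  ok-marked {x} {y} {ss} x<y y<d = ≡.trans (≡.cong (walkOK (evM ∷ events Σ (suc x) (suc y) ss) (window x y U)) (drop-cons y U (bound y<d)))
    (≡.cong₂ (λ a w → colDec (lookupL U (suc y)) a ∧ walkOK (events Σ (suc x) (suc y) ss) w (drop (suc y) U)) (window-first U x<y (bound (ℕP.<⇒≤ y<d)))
      (≡.trans (≡.cong (_++ lookupL U (suc y) ∷ []) (window-tail x y U)) (≡.sym (window-snoc U x<y (bound y<d)))))

  ok-east : ∀ {x y} es → walkOK (evE ∷ es) (window x y U) (drop y U) ≡ walkOK es (window (suc x) y U) (drop y U)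
  ok-east {x} {y} es = ≡.cong (λ w → walkOK es w (drop y U)) (window-tail x y U)

  respects⇒ok : ∀ {x y ss} → Above d x y ss → x ≤ y → Respects x y ss → T (ok x y ss)
  respects⇒ok end _ _ = _
  respects⇒ok (stepN {ss = ss} p) x≤y h = ≡.subst T (≡.sym (ok-north {ss = ss} x≤y (above-≤ p))) (respects⇒ok p (ℕP.m≤n⇒m≤1+n x≤y) (λ c → h (thereN c)))
  respects⇒ok {x} {y} (stepE {ss = []} x<y p) _ h = _
  respects⇒ok {x} {y} (stepE {ss = east ∷ ss} x<y p) _ h = ≡.subst T (≡.sym (ok-east {x} {y} (events Σ (suc x) y (east ∷ ss)))) (respects⇒ok p x<y (λ c → h (thereE c)))
  respects⇒ok {x} {y} (stepE {ss = north ∷ ss} x<y (stepN p)) _ h with memB (suc x , suc y) Σ in eq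
  ... | true = ≡.subst T (≡.sym (ok-marked {ss = ss} x<y (above-≤ p))) (T-∧⁺ (h here (≡.subst T (≡.sym eq) _)) (respects⇒ok p (ℕP.m≤n⇒m≤1+n x<y) (λ c → h (thereE (thereN c)))))
  ... | false = ≡.subst T (≡.sym (≡.trans (ok-east {x} {y} (evN ∷ events Σ (suc x) (suc y) ss)) (ok-north {ss = ss} x<y (above-≤ p)))) (respects⇒ok p (ℕP.m≤n⇒m≤1+n x<y) (λ c → h (thereE (thereN c))))

  ok⇒respects : ∀ {x y ss} → Above d x y ss → x ≤ y → T (ok x y ss) → Respects x y ss
  ok⇒respects (stepN {ss = ss} p) x≤y h (thereN c) = ok⇒respects p (ℕP.m≤n⇒m≤1+n x≤y) (≡.subst T (ok-north {ss = ss} x≤y (above-≤ p)) h) c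
  ok⇒respects {x} {y} (stepE {ss = east ∷ ss} x<y p) _ h (thereE c) = ok⇒respects p x<y (≡.subst T (ok-east {x} {y} (events Σ (suc x) y (east ∷ ss))) h) c
  ok⇒respects {x} {y} (stepE {ss = north ∷ ss} x<y (stepN p)) _ h here m with memB (suc x , suc y) Σ in eq
  ... | true = proj₁ (T-∧⁻ (≡.subst T (ok-marked {ss = ss} x<y (above-≤ p)) h))
  ok⇒respects {x} {y} (stepE {ss = north ∷ ss} x<y (stepN p)) _ h (thereE (thereN c)) m with memB (suc x , suc y) Σ in eq
  ... | true = ok⇒respects p (ℕP.m≤n⇒m≤1+n x<y) (proj₂ (T-∧⁻ {decreasing (suc x) (suc y)} (≡.subst T (ok-marked {ss = ss} x<y (above-≤ p)) h))) c m
  ... | false = ok⇒respects p (ℕP.m≤n⇒m≤1+n x<y) (≡.subst T (≡.trans (ok-east {x} {y} (evN ∷ events Σ (suc x) (suc y) ss)) (ok-north {ss = ss} x<y (above-≤ p))) h) c m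

allB-sound : {A : Set} (f : A → Bool) → ∀ as → T (allB f as) → All (T ∘ f) as
allB-sound f [] _ = []
allB-sound f (a ∷ as) h = proj₁ (T-∧⁻ {f a} h) ∷ allB-sound f as (proj₂ (T-∧⁻ {f a} h))

allB-complete : {A : Set} (f : A → Bool) → ∀ {as} → All (T ∘ f) as → T (allB f as)
allB-complete f [] = _
allB-complete f (p ∷ ps) = T-∧⁺ p (allB-complete f ps)

pairEq-sound : ∀ {p q} → T (pairEq p q) → p ≡ q
pairEq-sound {a , b} {c , e} h = ≡.cong₂ _,_ (ℕP.≡ᵇ⇒≡ a c (proj₁ (T-∧⁻ {a ≡ᵇ c} h))) (ℕP.≡ᵇ⇒≡ b e (proj₂ (T-∧⁻ {a ≡ᵇ c} h)))

pairEq-refl : ∀ p → pairEq p p ≡ true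
pairEq-refl (a , b) = ≡.cong₂ _∧_ (≡ᵇ-refl a) (≡ᵇ-refl b)

memB-lookup : {P : ℕ × ℕ → Set} → ∀ {p Σ} → All P Σ → T (memB p Σ) → P p
memB-lookup {P} {p} {q ∷ Σ} (x ∷ xs) m with pairEq p q in eq
... | true = ≡.subst P (≡.sym (pairEq-sound {p} {q} (≡.subst T (≡.sym eq) _))) x
... | false = memB-lookup xs m

memB-members : ∀ Σ → All (λ p → T (memB p Σ)) Σ
memB-members [] = []
memB-members (p ∷ Σ) = ≡.subst (λ b → T (b ∨ memB p Σ)) (≡.sym (pairEq-refl p)) _ ∷ weaken (memB-members Σ)
  where
  weaken : ∀ {Σ'} → All (λ q → T (memB q Σ)) Σ' → All (λ q → T (memB q (p ∷ Σ))) Σ'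
  weaken [] = []
  weaken {q ∷ _} (m ∷ ms) = ≡.subst T (≡.trans (≡.cong (pairEq q p ∨_) (≡.sym (T⇒≡true m))) ≡.refl) (≡.subst T (≡.sym (BoolP.∨-zeroʳ (pairEq q p))) _) ∷ weaken ms

module WordStatistics (r d : ℕ) (π : Dyck r d) (Σ : List (ℕ × ℕ)) (corners : All (IsCorner r d π) Σ) (U : List Letter) (|U| : length U ≡ d) where
  private
    es = events Σ 0 r (steps π)
    above-π : Above d 0 r (steps π)
    above-π = Dyck⇒Above d 0 r (steps π) (endE π) (endN π) (weakly π)
    r≤|U| : r ≤ length U
    r≤|U| = ≡.subst (r ≤_) (≡.sym |U|) (above-≤ above-π)
  open Marks Σ d U |U|

  corner-on-path : ∀ {b} → IsCorner r d π b → Corner 0 r (steps π) (proj₁ b) (proj₂ b)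
  corner-on-path {c , j} (corner c-pos c-le j-pos j-le above southB eastB) with j ℕP.≤? r
  ... | yes j≤r = ⊥-elim (ℕP.<⇒≱ c-pos (≡.subst (c ≤_) (if-T (ℕP.≤⇒≤ᵇ j≤r)) above))
  ... | no j≰r = locate above-π r<j j-le (≡.trans (≡.sym go) (ℕP.≤-antisym (ℕP.≤-pred eastB) above)) (λ _ → c-pos)
      (λ lt → ≡.subst (_< c) (if-¬T (λ p → ℕP.<⇒≱ (ℕP.<⇒≤pred lt) (ℕP.≤ᵇ⇒≤ (j ∸ 1) r p))) southB)
    where
    r<j : r < j
    r<j = ℕP.≰⇒> j≰r
    go : Xrow r (steps π) j ≡ XrowGo 0 r (steps π) j
    go = if-¬T (λ p → j≰r (ℕP.≤ᵇ⇒≤ j r p))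

  isColWord-flagOK : isColWord r d π Σ U ≡ flagOK 0 r es [] U
  isColWord-flagOK = ≡.trans (≡.cong (_∧ allB (λ i → code (lookupL U (suc i)) ≤ᵇ 2 ℕ.* suc i) (upTo r)) (T-ext to from))
    (≡.trans (BoolP.∧-comm (ok 0 r (steps π)) _) (≡.sym (flagOK-rows 0 r es U (λ i → i) (λ _ → ≡.refl) r≤|U|)))
    where
    to : T (allB (λ { (i , j) → colDec (lookupL U j) (lookupL U i) }) Σ) → T (ok 0 r (steps π))
    to h = respects⇒ok above-π z≤n (λ _ m → memB-lookup {λ { (i , j) → T (decreasing i j) }} (convert (allB-sound _ Σ h)) m)
      where
      convert : ∀ {Σ'} → All (T ∘ (λ { (i , j) → colDec (lookupL U j) (lookupL U i) })) Σ' → All (λ { (i , j) → T (decreasing i j) }) Σ'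
      convert [] = []
      convert (p ∷ ps) = p ∷ convert ps
    from : T (ok 0 r (steps π)) → T (allB (λ { (i , j) → colDec (lookupL U j) (lookupL U i) }) Σ)
    from h = allB-complete _ (convert corners (memB-members Σ))
      where
      convert : ∀ {Σ'} → All (IsCorner r d π) Σ' → All (λ p → T (memB p Σ)) Σ' → All (T ∘ (λ { (i , j) → colDec (lookupL U j) (lookupL U i) })) Σ'
      convert [] [] = []
      convert (c ∷ cs) (m ∷ ms) = ok⇒respects above-π z≤n h (corner-on-path c) m ∷ convert cs ms

  invT̃-flagInv : invT̃ r d π U ≡ flagInv r es [] U
  invT̃-flagInv = begin
    invT̃ r d π U                                ≡⟨ invT̃-rows ⟩
    total d rowAttacks                          ≡⟨ ≡.cong (λ n → total n rowAttacks) (≡.sym (endN π)) ⟩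
    total (r ℕ.+ countN (steps π)) rowAttacks   ≡⟨ total-split r (countN (steps π)) rowAttacks ⟩
    total r rowAttacks ℕ.+ total (countN (steps π)) (λ l → rowAttacks (r ℕ.+ l))
      ≡⟨ ≡.cong₂ ℕ._+_ (total-cong r (λ l l<r → ≡.cong (λ X → attacks (lookupL U (suc l)) (window X l U)) (if-T (ℕP.≤⇒≤ᵇ l<r))))
           (total-cong (countN (steps π)) (λ l _ → ≡.cong (λ X → attacks (lookupL U (suc (r ℕ.+ l))) (window X (r ℕ.+ l) U)) (if-¬T (λ p → ℕP.m+n≮m r l (ℕP.≤ᵇ⇒≤ (suc (r ℕ.+ l)) r p))))) ⟩
    total r (λ l → attacks (lookupL U (suc l)) (take l U)) ℕ.+ total (countN (steps π)) (λ l → attacks (lookupL U (suc (r ℕ.+ l))) (window (XrowGo 0 r (steps π) (suc (r ℕ.+ l))) (r ℕ.+ l) U))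
      ≡⟨ ≡.cong (total r (λ l → attacks (lookupL U (suc l)) (take l U)) ℕ.+_) (≡.sym (≡.trans (walkInv-events Σ 0 r (steps π) (take r U) (drop r U)) (walkSteps-rows U above-π z≤n (ℕP.≤-reflexive (≡.sym |U|))))) ⟩
    total r (λ l → attacks (lookupL U (suc l)) (take l U)) ℕ.+ walkInv es (take r U) (drop r U)
      ≡⟨ ≡.sym (flagInv-rows 0 r es U r≤|U|) ⟩
    flagInv r es [] U                           ∎
    where
    open ≡.≡-Reasoning
    open Rows r d π U |U|

-- Restriction to the first N variables

module Truncation (𝕋 : Target) (N : ℕ) where
 open Target 𝕋
 open IntegerSolver ring
 open OverRing ring
 open Sequences ring
 open WithParameter t
 open Alphabet var
 open Evaluation scalars
 open Representation 𝕋
 open WordSums 𝕋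
 open Represents
 open import Algebra.Properties.Semiring.Exp semiring using (_^_; ^-homo-*; ^-congˡ)
 open import Relation.Binary.Reasoning.Setoid setoid

 cut : ℕ → Carrier
 cut c = if c <ᵇ N then var c else 0#

 cut-< : ∀ {c} → c < N → cut c ≈ var c
 cut-< c<N = reflexive (if-T (ℕP.<⇒<ᵇ c<N))

 cut-≥ : ∀ {c} → N ≤ c → cut c ≈ 0#
 cut-≥ {c} N≤c = reflexive (if-¬T (λ p → ℕP.<⇒≱ (ℕP.<ᵇ⇒< c N p) N≤c))

 open Substitution cut

 module _ (L : ℕ) (N≤L : N ≤ L) where

  flagProduct-snoc : ∀ i j → flagProduct N L N≤L i (suc j) ≈ flagProduct N L N≤L i j * (t⁻¹ ^ (i ℕ.+ j) * cut (i ℕ.+ j))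
  flagProduct-snoc i zero = trans (*-identityʳ _) (trans (reflexive (≡.cong (λ l → t⁻¹ ^ l * cut l) (≡.sym (ℕP.+-identityʳ i)))) (sym (*-identityˡ _)))
  flagProduct-snoc i (suc j) = trans (*-congˡ (flagProduct-snoc (suc i) j)) (trans (sym (*-assoc _ _ _))
    (*-congˡ (reflexive (≡.cong (λ l → t⁻¹ ^ l * cut l) (≡.sym (ℕP.+-suc i j))))))

  subst-prefix : ∀ r → subst cut (prefix r) ≈ flagProduct N L N≤L 0 r
  subst-prefix r = trans (*-homo _ _) (go r)
   where
   go : ∀ r → subst cut (monomial r) * subst cut (triangular r) ≈ flagProduct N L N≤L 0 r
   go zero = trans (*-cong 1#-homo 1#-homo) (*-identityˡ 1#)
   go (suc r) = begin
     subst cut (monomial r * var r) * subst cut (triangular r * t⁻¹ ^ r)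
       ≈⟨ *-cong (trans (*-homo _ _) (*-congˡ (subst-var cut r))) (trans (*-homo _ _) (*-congˡ (trans (hom-^ t⁻¹ r) (^-congˡ r (subst-κ cut _ _))))) ⟩
     subst cut (monomial r) * cut r * (subst cut (triangular r) * t⁻¹ ^ r)
       ≈⟨ solve 4 (λ m x u p → m :* x :* (u :* p) := m :* u :* (p :* x)) refl (subst cut (monomial r)) (cut r) (subst cut (triangular r)) (t⁻¹ ^ r) ⟩
     subst cut (monomial r) * subst cut (triangular r) * (t⁻¹ ^ r * cut r)  ≈⟨ *-congʳ (go r) ⟩
     flagProduct N L N≤L 0 r * (t⁻¹ ^ r * cut r)  ≈⟨ sym (flagProduct-snoc 0 r) ⟩
     flagProduct N L N≤L 0 (suc r)                ∎

  -- The powers of x_{N+1}, ..., x_L vanish. For N < r nothing survives, in agreement with the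
  -- truncated difference N ∸ r.
  subst-tail-power : ∀ r k → subst cut (tail-power r L k) ≈ powerSum r (N ∸ r) (suc k)
  subst-tail-power r k = begin
    subst cut (powerSum r (L ∸ r) (suc k))      ≈⟨ trans (hom-sumTo (L ∸ r) _) (sumTo-cong (L ∸ r) (λ i _ → trans (hom-^ _ (suc k)) (^-congˡ (suc k) (subst-var cut (r ℕ.+ i))))) ⟩
    sumTo (L ∸ r) (λ i → cut (r ℕ.+ i) ^ suc k) ≈⟨ reflexive (≡.cong (λ n → sumTo n (λ i → cut (r ℕ.+ i) ^ suc k)) (≡.sym (ℕP.m+[n∸m]≡n (ℕP.∸-monoˡ-≤ r N≤L)))) ⟩
    sumTo (n ℕ.+ (L ∸ r ∸ n)) (λ i → cut (r ℕ.+ i) ^ suc k)  ≈⟨ sumTo-split n (L ∸ r ∸ n) _ ⟩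
    sumTo n (λ i → cut (r ℕ.+ i) ^ suc k) + sumTo (L ∸ r ∸ n) (λ i → cut (r ℕ.+ (n ℕ.+ i)) ^ suc k)
      ≈⟨ +-cong (sumTo-cong n (λ i i<n → ^-congˡ (suc k) (cut-< (ℕP.≰⇒> (λ N≤r+i → ℕP.<⇒≱ i<n (ℕP.m≤n+o⇒m∸n≤o N r N≤r+i))))))
                (sumTo-0 (L ∸ r ∸ n) (λ i _ → trans (*-congʳ (cut-≥ (ℕP.≤-trans (ℕP.m≤n+m∸n N r) (ℕP.+-monoʳ-≤ r (ℕP.m≤m+n n i))))) (zeroˡ _))) ⟩
    powerSum r n (suc k) + 0#                   ≈⟨ +-identityʳ _ ⟩
    powerSum r n (suc k)                        ∎
    where n = N ∸ r

  eval-backward : ∀ {r es} → Valid r es → r ℕ.+ norths es ≤ L →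
    Eval.eval cut (λ k → powerSum r (N ∸ r) (suc k)) (backward es) ≈ flagProduct N L N≤L 0 r * Windows.family t t⁻¹ t*t⁻¹ cut L es (interval 0 r)
  eval-backward {r} {es} v h = begin
    Eval.eval cut (λ k → powerSum r (N ∸ r) (suc k)) (backward es)
      ≈⟨ sym (eval-cong (subst-var cut) (subst-tail-power r) (backward es)) ⟩
    Eval.eval (subst cut ∘ var) (subst cut ∘ tail-power r L) (backward es)  ≈⟨ sym (hom-eval var (tail-power r L) (backward es)) ⟩
    subst cut (Eval.eval var (tail-power r L) (backward es))
      ≈⟨ ⟦⟧-cong (eval-≈ (represents-backward v h) L ℕP.≤-refl var (λ _ _ → refl)) ⟩
    subst cut (prefix r * W.family L es (interval 0 r))  ≈⟨ *-homo _ _ ⟩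
    subst cut (prefix r) * subst cut (W.family L es (interval 0 r))
      ≈⟨ *-cong (subst-prefix r) (family-subst cut cut L (λ _ _ → refl) es (interval 0 r)) ⟩
    flagProduct N L N≤L 0 r * Windows.family t t⁻¹ t*t⁻¹ cut L es (interval 0 r)  ∎

 sumOver-words : ∀ n {f g : List Letter → Carrier} → (∀ U → length U ≡ n → f U ≈ g U) → sumOver (words N n) f ≈ sumOver (words N n) g
 sumOver-words zero h = +-congʳ (h [] ≡.refl)
 sumOver-words (suc n) {f} {g} h = trans (sumOver-concatMap f (λ a → map (a ∷_) (words N n)) (lettersUpTo N)) (trans
   (sumOver-cong (lettersUpTo N) (λ a → trans (sumOver-map f (a ∷_) (words N n))
     (trans (sumOver-words n (λ U e → h (a ∷ U) (≡.cong suc e))) (sym (sumOver-map g (a ∷_) (words N n))))))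
   (sym (sumOver-concatMap g (λ a → map (a ∷_) (words N n)) (lettersUpTo N))))

 open Eval var (λ _ → 0#) using (eval)

 word-sum : ∀ r d (π : Dyck r d) Σ → All (IsCorner r d π) Σ →
   sumOver (words N d) (λ U → eval (weighted (isColWord r d π Σ U) (invT̃ r d π U) U)) * (1# - t) ^ chiDen r d π Σ ≈
     Eval.eval cut (λ k → powerSum r (N ∸ r) (suc k)) (chiNum r d π Σ)
 word-sum r d π Σ corners = begin
   sumOver (words N d) (λ U → eval (weighted (isColWord r d π Σ U) (invT̃ r d π U) U)) * D
     ≈⟨ *-congʳ (sumOver-words d (λ U |U| → reflexive (≡.cong₂ (λ ok inv → eval (weighted ok inv U))
          (WordStatistics.isColWord-flagOK r d π Σ corners U |U|) (WordStatistics.invT̃-flagInv r d π Σ corners U |U|)))) ⟩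
   sumOver (words N d) (λ U → eval (weighted (flagOK 0 r es [] U) (flagInv r es [] U) U)) * D
     ≈⟨ *-congʳ (reflexive (≡.cong (λ n → sumOver (words N n) (λ U → eval (weighted (flagOK 0 r es [] U) (flagInv r es [] U) U))) d≡)) ⟩
   sumOver (words N (r ℕ.+ norths es)) (λ U → eval (weighted (flagOK 0 r es [] U) (flagInv r es [] U) U)) * D
     ≈⟨ flag-sum N L N≤L valid 0 r [] (ℕP.+-identityʳ r) [] ⟩
   flagged N L N≤L 0 r (Windows.family t t⁻¹ t*t⁻¹ cut L es) []
     ≈⟨ flagged-interval N L N≤L 0 r _ (ℕP.≤-trans (ℕP.m≤m+n r _) B≤L) ⟩
   flagProduct N L N≤L 0 r * Windows.family t t⁻¹ t*t⁻¹ cut L es (interval 0 r)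
     ≈⟨ sym (eval-backward L N≤L valid B≤L) ⟩
   Eval.eval cut (λ k → powerSum r (N ∸ r) (suc k)) (backward es)  ∎
   where
   es = events Σ 0 r (steps π)
   D = (1# - t) ^ countM es
   -- Any number above both N and the bound of `represents-backward` would serve.
   L = N ℕ.+ (r ℕ.+ norths es)
   N≤L : N ≤ L
   N≤L = ℕP.m≤m+n N _
   B≤L : r ℕ.+ norths es ≤ L
   B≤L = ℕP.m≤n+m _ N
   valid : Valid r es
   valid = events-valid Σ (Dyck⇒Above d 0 r (steps π) (endE π) (endN π) (weakly π)) z≤n
   d≡ : d ≡ r ℕ.+ norths es
   d≡ = ≡.trans (≡.sym (endN π)) (≡.cong (r ℕ.+_) (≡.sym (norths-events Σ 0 r (steps π))))

-- Polynomials as a target of evaluation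

swapE : ℕ → List ℕ → List ℕ
swapE k xe = setE (setE xe k (getE xe (suc k))) (suc k) (getE xe k)

getE-swapE : ∀ k xe j → getE (swapE k xe) j ≡ getE xe (transposition k j)
getE-swapE k xe j with position k j
... | at-k = ≡.trans (getE-setE-≢ (setE xe k _) (getE xe k) (λ ())) (≡.trans (getE-setE xe k _) (≡.cong (getE xe) (≡.sym (σ-k k))))
... | at-1+k = ≡.trans (getE-setE (setE xe k _) (suc k) (getE xe k)) (≡.cong (getE xe) (≡.sym (σ-suc k)))
... | elsewhere p q = ≡.trans (getE-setE-≢ (setE xe k _) (getE xe k) (≡.≢-sym q)) (≡.trans (getE-setE-≢ xe _ (≡.≢-sym p)) (≡.cong (getE xe) (≡.sym (σ-other k p q))))

swapE-~ : ∀ k {xs ys} → xs ~ ys → swapE k xs ~ swapE k ys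
swapE-~ k {xs} {ys} h j = ≡.trans (getE-swapE k xs j) (≡.trans (h _) (≡.sym (getE-swapE k ys j)))

swapE-addE : ∀ k xs ys → swapE k (addE xs ys) ~ addE (swapE k xs) (swapE k ys)
swapE-addE k xs ys j = ≡.trans (getE-swapE k (addE xs ys) j) (≡.trans (getE-addE xs ys _)
  (≡.sym (≡.trans (getE-addE (swapE k xs) (swapE k ys) j) (≡.cong₂ ℕ._+_ (getE-swapE k xs j) (getE-swapE k ys j)))))

swapE-involutive : ∀ k xs → swapE k (swapE k xs) ~ xs
swapE-involutive k xs j = ≡.trans (getE-swapE k (swapE k xs) j) (≡.trans (getE-swapE k xs _) (≡.cong (getE xs) (σ-involutive k j)))

swapE-[] : ∀ k → swapE k [] ~ []
swapE-[] k j = getE-swapE k [] j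

swapE-unit : ∀ k c → swapE k (setE [] c 1) ~ setE [] (transposition k c) 1
swapE-unit k c j with transposition k c ℕP.≟ j
... | yes ≡.refl = ≡.trans (getE-swapE k (setE [] c 1) _) (≡.trans (≡.cong (getE (setE [] c 1)) (σ-involutive k c)) (≡.trans (getE-setE [] c 1) (≡.sym (getE-setE [] (transposition k c) 1))))
... | no σc≢j = ≡.trans (getE-swapE k (setE [] c 1) j) (≡.trans (getE-setE-≢ [] {c} {transposition k j} 1 (λ { ≡.refl → σc≢j (σ-involutive k j) })) (≡.sym (getE-setE-≢ [] 1 σc≢j)))

swapM-cong : ∀ k {m m'} → m ≈M m' → swapM (suc k) m ≈M swapM (suc k) m'
swapM-cong k {mono a x p} {mono b y q} (equivalent e f g) = equivalent e (swapE-~ k {x} {y} f) g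

swapM-mulM : ∀ k m m' → swapM (suc k) (mulM m m') ≈M mulM (swapM (suc k) m) (swapM (suc k) m')
swapM-mulM k (mono a x p) (mono b y q) = equivalent ≡.refl (swapE-addE k x y) (λ _ → ≡.refl)

lin-sP : ∀ φ i F → lin φ (sP i F) ≡ lin (φ ∘ swapM i) F
lin-sP φ i [] = ≡.refl
lin-sP φ i ((c , m) ∷ F) = ≡.cong (c ℚ.* φ (swapM i m) ℚ.+_) (lin-sP φ i F)

monomial-≋ : ∀ {c m m'} → m ≈M m' → ((c , m) ∷ []) ≋ ((c , m') ∷ [])
monomial-≋ {c} e = tested λ φ rφ → ≡.cong (λ z → c ℚ.* z ℚ.+ 0ℚ) (rφ e)

module _ (k : ℕ) where
  private
    s : Poly → Poly
    s = sP (suc k)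

  sP-cong : ∀ {F G} → F ≋ G → s F ≋ s G
  sP-cong {F} {G} h = tested λ φ rφ → ≡.trans (lin-sP φ (suc k) F) (≡.trans (test h _ (λ e → rφ (swapM-cong k e))) (≡.sym (lin-sP φ (suc k) G)))

  sP-*P : ∀ F G → s (F *P G) ≋ s F *P s G
  sP-*P F G = tested λ φ rφ → let open ≡.≡-Reasoning in begin
    lin φ (s (F *P G))                                                          ≡⟨ ≡.trans (lin-sP φ (suc k) (F *P G)) (lin-*P _ F G) ⟩
    lin (λ m → lin (λ n → φ (swapM (suc k) (mulM m n))) G) F                    ≡⟨ lin-cong F (λ m → lin-cong G (λ n → rφ (swapM-mulM k m n))) ⟩
    lin (λ m → lin (λ n → φ (mulM (swapM (suc k) m) (swapM (suc k) n))) G) F    ≡⟨ ≡.sym (≡.trans (lin-sP _ (suc k) F) (lin-cong F (λ m → lin-sP _ (suc k) G))) ⟩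
    lin (λ m → lin (φ ∘ mulM m) (s G)) (s F)                                    ≡⟨ ≡.sym (lin-*P φ (s F) (s G)) ⟩
    lin φ (s F *P s G)                                                          ∎

  sP-isHom : RingMorphisms.IsRingHomomorphism (CommutativeRing.rawRing polyRing) (CommutativeRing.rawRing polyRing) s
  sP-isHom = record
    { isSemiringHomomorphism = record
      { isNearSemiringHomomorphism = record
        { +-isMonoidHomomorphism = record
          { isMagmaHomomorphism = record
            { isRelHomomorphism = record { cong = sP-cong }
            ; homo = λ F G → ≡⇒≋ (ListP.map-++ _ F G) }
          ; ε-homo = ≋-refl }
        ; *-homo = sP-*P }
      ; 1#-homo = monomial-≋ (equivalent ≡.refl (swapE-[] k) (λ _ → ≡.refl)) }
    ; -‿homo = λ F → tested λ φ _ → ≡.trans (lin-sP φ (suc k) (negP F)) (≡.trans (lin-neg _ F) (≡.sym (≡.trans (lin-neg φ (s F)) (≡.cong ℚ.-_ (lin-sP φ (suc k) F))))) }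

  sP-involutive : ∀ F → s (s F) ≋ F
  sP-involutive F = tested λ φ rφ → ≡.trans (lin-sP φ (suc k) (s F)) (≡.trans (lin-sP _ (suc k) F) (lin-cong F (λ { (mono a x p) → rφ (equivalent ≡.refl (swapE-involutive k x) (λ _ → ≡.refl)) })))

  sP-κ : ∀ c n → s ((c , mono n [] []) ∷ []) ≋ ((c , mono n [] []) ∷ [])
  sP-κ c n = monomial-≋ (equivalent ≡.refl (swapE-[] k) (λ _ → ≡.refl))

  sP-xVar : ∀ c → s (xVar (suc c)) ≋ xVar (suc (transposition k c))
  sP-xVar c = monomial-≋ (equivalent ≡.refl (swapE-unit k c) (λ _ → ≡.refl))

  -- ψ ↦ quotient ψ is transposed to the division by x_{k+1} - x_{k+2}.
  module Quotient (ψ : Functional) (rψ : Respectful ψ) where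
    set : List ℕ → ℕ → ℕ → List ℕ
    set xe u v = setE (setE xe k u) (suc k) v

    sums : ℤ → List ℕ → List ℕ → ℕ → ℕ → ℚ
    sums a xe pe zero v = 0ℚ
    sums a xe pe (suc u) v = ψ (mono a (set xe u v) pe) ℚ.+ sums a xe pe u (suc v)

    quotient : Functional
    quotient (mono a xe pe) = sums a xe pe (getE xe k) (getE xe (suc k))

    sums-cong : ∀ {a b xe ye pe qe} → a ≡ b → (∀ u v → set xe u v ~ set ye u v) → pe ~ qe → ∀ u v → sums a xe pe u v ≡ sums b ye qe u v
    sums-cong e f g zero v = ≡.refl
    sums-cong e f g (suc u) v = ≡.cong₂ ℚ._+_ (rψ (equivalent e (f u v) g)) (sums-cong e f g u (suc v))

    set-~ : ∀ {xe ye} → xe ~ ye → ∀ u v → set xe u v ~ set ye u v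
    set-~ {xe} {ye} h u v = setE-~ {setE xe k u} {setE ye k u} (suc k) (setE-~ {xe} {ye} k h ≡.refl) ≡.refl

    quotient-respectful : Respectful quotient
    quotient-respectful {mono a xe pe} {mono b ye qe} (equivalent e f g) =
      ≡.trans (sums-cong e (set-~ {xe} {ye} f) g (getE xe k) (getE xe (suc k))) (≡.cong₂ (sums b ye qe) (f k) (f (suc k)))

    getE-set : ∀ xe u v j → (j ≡ k → getE (set xe u v) j ≡ u) × (j ≡ suc k → getE (set xe u v) j ≡ v) × (j ≢ k → j ≢ suc k → getE (set xe u v) j ≡ getE xe j)
    getE-set xe u v j = (λ { ≡.refl → ≡.trans (getE-setE-≢ (setE xe k u) v (λ ())) (getE-setE xe k u) })
      , (λ { ≡.refl → getE-setE (setE xe k u) (suc k) v })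
      , (λ p q → ≡.trans (getE-setE-≢ (setE xe k u) v (≡.≢-sym q)) (getE-setE-≢ xe u (≡.≢-sym p)))

    set-agree : ∀ {xe ye} → (∀ j → j ≢ k → j ≢ suc k → getE xe j ≡ getE ye j) → ∀ u v → set xe u v ~ set ye u v
    set-agree {xe} {ye} h u v j with position k j
    ... | at-k = ≡.trans (proj₁ (getE-set xe u v k) ≡.refl) (≡.sym (proj₁ (getE-set ye u v k) ≡.refl))
    ... | at-1+k = ≡.trans (proj₁ (proj₂ (getE-set xe u v (suc k))) ≡.refl) (≡.sym (proj₁ (proj₂ (getE-set ye u v (suc k))) ≡.refl))
    ... | elsewhere p q = ≡.trans (proj₂ (proj₂ (getE-set xe u v j)) p q) (≡.trans (h j p q) (≡.sym (proj₂ (proj₂ (getE-set ye u v j)) p q)))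

    set-self : ∀ xe → set xe (getE xe k) (getE xe (suc k)) ~ xe
    set-self xe j with position k j
    ... | at-k = proj₁ (getE-set xe _ _ k) ≡.refl
    ... | at-1+k = proj₁ (proj₂ (getE-set xe _ _ (suc k))) ≡.refl
    ... | elsewhere p q = proj₂ (proj₂ (getE-set xe _ _ j)) p q

    unit : ℕ → Mono
    unit c = mono (+ 0) (setE [] c 1) []

    getE-unit-same : ∀ c xe → getE (addE (setE [] c 1) xe) c ≡ suc (getE xe c)
    getE-unit-same c xe = ≡.trans (getE-addE (setE [] c 1) xe c) (≡.cong (ℕ._+ getE xe c) (getE-setE [] c 1))

    getE-unit-other : ∀ {c j} xe → c ≢ j → getE (addE (setE [] c 1) xe) j ≡ getE xe j
    getE-unit-other {c} {j} xe c≢j = ≡.trans (getE-addE (setE [] c 1) xe j) (≡.cong (ℕ._+ getE xe j) (getE-setE-≢ [] 1 c≢j))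

    -- For x_k m and x_{k+1} m the sums run along the same antidiagonal of exponents, and the first
    -- has one more term, namely `ψ m`.
    quotient-unit : ∀ m → quotient (mulM (unit k) m) ≡ ψ m ℚ.+ quotient (mulM (unit (suc k)) m)
    quotient-unit (mono a xe pe) = begin
      sums (+ 0 ℤ.+ a) (addE (setE [] k 1) xe) pe (getE (addE (setE [] k 1) xe) k) (getE (addE (setE [] k 1) xe) (suc k))
        ≡⟨ ≡.cong₂ (sums (+ 0 ℤ.+ a) (addE (setE [] k 1) xe) pe) (getE-unit-same k xe) (getE-unit-other {k} {suc k} xe (λ ())) ⟩
      sums (+ 0 ℤ.+ a) (addE (setE [] k 1) xe) pe (suc A) B
        ≡⟨ sums-cong (ℤP.+-identityˡ a) (set-agree {addE (setE [] k 1) xe} {xe} (λ j p q → getE-unit-other xe (≡.≢-sym p))) (λ _ → ≡.refl) (suc A) B ⟩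
      ψ (mono a (set xe A B) pe) ℚ.+ sums a xe pe A (suc B)
        ≡⟨ ≡.cong₂ ℚ._+_ (rψ (equivalent ≡.refl (set-self xe) (λ _ → ≡.refl)))
             (≡.sym (sums-cong (ℤP.+-identityˡ a) (set-agree {addE (setE [] (suc k) 1) xe} {xe} (λ j p q → getE-unit-other xe (≡.≢-sym q))) (λ _ → ≡.refl) A (suc B))) ⟩
      ψ (mono a xe pe) ℚ.+ sums (+ 0 ℤ.+ a) (addE (setE [] (suc k) 1) xe) pe A (suc B)
        ≡⟨ ≡.cong (ψ (mono a xe pe) ℚ.+_) (≡.sym (≡.cong₂ (sums (+ 0 ℤ.+ a) (addE (setE [] (suc k) 1) xe) pe) (getE-unit-other xe (ℕP.1+n≢n)) (getE-unit-same (suc k) xe))) ⟩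
      ψ (mono a xe pe) ℚ.+ quotient (mulM (unit (suc k)) (mono a xe pe))  ∎
      where
      open ≡.≡-Reasoning
      A = getE xe k
      B = getE xe (suc k)

    lin-quotient : ∀ F → lin quotient ((xVar (suc k) -P xVar (suc (suc k))) *P F) ≡ lin ψ F
    lin-quotient F = begin
      lin quotient ((xVar (suc k) -P xVar (suc (suc k))) *P F)     ≡⟨ lin-*P quotient (xVar (suc k) -P xVar (suc (suc k))) F ⟩
      1ℚ ℚ.* U ℚ.+ ((ℚ.- 1ℚ) ℚ.* V ℚ.+ 0ℚ)                         ≡⟨ ≡.cong₂ ℚ._+_ (ℚP.*-identityˡ U) (≡.trans (ℚP.+-identityʳ _) (≡.trans (≡.sym (ℚP.neg-distribˡ-* 1ℚ V)) (≡.cong ℚ.-_ (ℚP.*-identityˡ V)))) ⟩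
      U ℚ.- V                                                      ≡⟨ ≡.cong (ℚ._- V) (≡.trans (lin-cong F quotient-unit) (lin-+ ψ _ F)) ⟩
      lin ψ F ℚ.+ V ℚ.- V                                          ≡⟨ ≡.trans (ℚP.+-assoc (lin ψ F) V (ℚ.- V)) (≡.trans (≡.cong (lin ψ F ℚ.+_) (ℚP.+-inverseʳ V)) (ℚP.+-identityʳ _)) ⟩
      lin ψ F                                                      ∎
      where
      open ≡.≡-Reasoning
      U = lin (quotient ∘ mulM (unit k)) F
      V = lin (quotient ∘ mulM (unit (suc k))) F

  -- Every functional ψ factors through multiplication by x_k - x_{k+1}, so this multiplication is
  -- injective as far as tests can tell. Neither degrees nor divisibility enter.
  cancel-difference : ∀ {F G} → (xVar (suc k) -P xVar (suc (suc k))) *P F ≋ (xVar (suc k) -P xVar (suc (suc k))) *P G → F ≋ G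
  cancel-difference {F} {G} h = tested λ ψ rψ → let open Quotient ψ (λ {m} {m'} → rψ {m} {m'}) in
    ≡.trans (≡.sym (lin-quotient F)) (≡.trans (test h quotient (λ {m} {m'} → quotient-respectful {m} {m'})) (lin-quotient G))

open Evaluation polyScalars
open Eval

lin-eval : ∀ φ X P F → lin φ (eval X P F) ≡ lin (λ { (mono a xe pe) → lin (φ ∘ mulM (mono a [] [])) (prodE X xe *P prodE P pe) }) F
lin-eval φ X P [] = ≡.refl
lin-eval φ X P ((c , mono a xe pe) ∷ F) = ≡.trans (lin-++ φ (((c , mono a [] []) ∷ []) *P (prodE X xe *P prodE P pe)) (eval X P F))
  (≡.cong₂ ℚ._+_ (≡.trans (lin-*P φ ((c , mono a [] []) ∷ []) (prodE X xe *P prodE P pe)) (ℚP.+-identityʳ (c ℚ.* lin (φ ∘ mulM (mono a [] [])) (prodE X xe *P prodE P pe)))) (lin-eval φ X P F))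

eval-≋ : ∀ X P {F G} → F ≋ G → eval X P F ≋ eval X P G
eval-≋ X P {F} {G} h = tested λ φ rφ → ≡.trans (lin-eval φ X P F) (≡.trans (test h _ λ { {mono a x p} {mono b y q} (equivalent ≡.refl f g) →
    test (*P-cong (prodE-~ X x y f) (prodE-~ P p q g)) _ (mulM-respectful (mono a [] []) rφ) }) (≡.sym (lin-eval φ X P G)))

eval-isHom : ∀ X P → RingMorphisms.IsRingHomomorphism (CommutativeRing.rawRing polyRing) (CommutativeRing.rawRing polyRing) (eval X P)
eval-isHom X P = record
  { isSemiringHomomorphism = record
    { isNearSemiringHomomorphism = record
      { +-isMonoidHomomorphism = record
        { isMagmaHomomorphism = record
          { isRelHomomorphism = record { cong = eval-≋ X P }
          ; homo = eval-++ X P }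
        ; ε-homo = ≋-refl }
      ; *-homo = eval-* X P }
    ; 1#-homo = eval-one X P }
  ; -‿homo = eval-neg X P }

polyTarget : Target
polyTarget = record
  { scalars = polyScalars
  ; var = xVar ∘ suc
  ; swap = λ k → sP (suc k)
  ; swap-κ = sP-κ
  ; swap-isTransposition = λ k → record
    { isHom = sP-isHom k
    ; s-involutive = sP-involutive k
    ; s-t = sP-κ k 1ℚ (+ 1)
    ; s-t⁻¹ = sP-κ k 1ℚ -[1+ 0 ]
    ; s-xₖ = ≋-trans (sP-xVar k k) (≡⇒≋ (≡.cong (xVar ∘ suc) (σ-k k)))
    ; s-x = λ {c} p q → ≋-trans (sP-xVar k c) (≡⇒≋ (≡.cong (xVar ∘ suc) (σ-other k p q)))
    ; cancel = cancel-difference k }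
  ; subst = λ y → eval y (pVar ∘ suc)
  ; subst-isHom = λ y → eval-isHom y (pVar ∘ suc)
  ; subst-κ = λ y → eval-scalar y (pVar ∘ suc)
  ; subst-var = λ y → eval-xVar y (pVar ∘ suc)
  }

-- Return to lists and coefficients, and conclusion

powP-^ : ∀ F n → powP F n ≡ Algebra.Properties.Semiring.Exp._^_ (CommutativeRing.semiring polyRing) F n
powP-^ F zero = ≡.refl
powP-^ F (suc n) = ≡.cong (F *P_) (powP-^ F n)

prodIdx-prodE : ∀ f i es → prodIdx f (suc i) es ≋ prodE (λ j → f (suc (i ℕ.+ j))) es
prodIdx-prodE f i [] = ≋-refl
prodIdx-prodE f i (e ∷ es) = *P-cong (≡⇒≋ (≡.trans (powP-^ (f (suc i)) e) (≡.cong (λ j → f (suc j) ^ e) (≡.sym (ℕP.+-identityʳ i))))) (≋-trans (prodIdx-prodE f (suc i) es) (prodE-cong es (λ j → ≡⇒≋ (≡.cong (λ l → f (suc l) ^ getE es j) (≡.sym (ℕP.+-suc i j))))))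
  where
  open import Algebra.Properties.Semiring.Exp (CommutativeRing.semiring polyRing) using (_^_)

substP-eval : ∀ X P F → substP X P F ≋ eval (X ∘ suc) (P ∘ suc) F
substP-eval X P [] = ≋-refl
substP-eval X P ((c , mono a xe pe) ∷ F) = +P-cong (*P-cong (≋-refl {(c , mono a [] []) ∷ []}) (*P-cong (prodIdx-prodE X 0 xe) (prodIdx-prodE P 0 pe))) (substP-eval X P F)

eqE-sound : ∀ xs ys → T (eqE xs ys) → xs ~ ys
eqE-sound [] [] _ i = ≡.refl
eqE-sound [] (b ∷ ys) h zero = ≡.sym (ℕP.≡ᵇ⇒≡ b 0 (proj₁ (T-∧⁻ h)))
eqE-sound [] (b ∷ ys) h (suc i) = eqE-sound [] ys (proj₂ (T-∧⁻ {b ≡ᵇ 0} h)) i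
eqE-sound (a ∷ xs) [] h zero = ℕP.≡ᵇ⇒≡ a 0 (proj₁ (T-∧⁻ h))
eqE-sound (a ∷ xs) [] h (suc i) = eqE-sound xs [] (proj₂ (T-∧⁻ {a ≡ᵇ 0} h)) i
eqE-sound (a ∷ xs) (b ∷ ys) h zero = ℕP.≡ᵇ⇒≡ a b (proj₁ (T-∧⁻ h))
eqE-sound (a ∷ xs) (b ∷ ys) h (suc i) = eqE-sound xs ys (proj₂ (T-∧⁻ {a ≡ᵇ b} h)) i

eqE-complete : ∀ xs ys → xs ~ ys → T (eqE xs ys)
eqE-complete [] [] h = _
eqE-complete [] (b ∷ ys) h = T-∧⁺ (ℕP.≡⇒≡ᵇ b 0 (≡.sym (h 0))) (eqE-complete [] ys (h ∘ suc))
eqE-complete (a ∷ xs) [] h = T-∧⁺ (ℕP.≡⇒≡ᵇ a 0 (h 0)) (eqE-complete xs [] (h ∘ suc))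
eqE-complete (a ∷ xs) (b ∷ ys) h = T-∧⁺ (ℕP.≡⇒≡ᵇ a b (h 0)) (eqE-complete xs ys (h ∘ suc))

eqE-~ : ∀ {xs ys} zs → xs ~ ys → eqE xs zs ≡ eqE ys zs
eqE-~ {xs} {ys} zs h = T-ext (λ p → eqE-complete ys zs (λ i → ≡.trans (≡.sym (h i)) (eqE-sound xs zs p i))) (λ p → eqE-complete xs zs (λ i → ≡.trans (h i) (eqE-sound ys zs p i)))

indicator : Mono → Functional
indicator m m' = if eqM m' m then 1ℚ else 0ℚ

indicator-respectful : ∀ m → Respectful (indicator m)
indicator-respectful (mono c z r) {mono a x p} {mono b y q} (equivalent ≡.refl f g) =
  ≡.cong₂ (λ u v → if ⌊ a ℤ.≟ c ⌋ ∧ u ∧ v then 1ℚ else 0ℚ) (eqE-~ {x} {y} z f) (eqE-~ {p} {q} r g)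

coeff-lin : ∀ F m → coeff F m ≡ lin (indicator m) F
coeff-lin [] m = ≡.refl
coeff-lin ((c , m') ∷ F) m = ≡.cong₂ ℚ._+_ scaled (coeff-lin F m)
  where
  scaled : (if eqM m' m then c else 0ℚ) ≡ c ℚ.* indicator m m'
  scaled with eqM m' m
  ... | true = ≡.sym (ℚP.*-identityʳ c)
  ... | false = ≡.sym (ℚP.*-zeroʳ c)

-- Taking a coefficient is one of the tests: `eqM` ignores trailing zeros, as a respectful
-- functional must.
≋⇒≈P : ∀ {F G} → F ≋ G → F ≈P G
≋⇒≈P {F} {G} h m = ≡.trans (coeff-lin F m) (≡.trans (test h (indicator m) (λ {n} {n'} → indicator-respectful m {n} {n'})) (≡.sym (coeff-lin G m)))

open Truncation polyTarget
open WordSums polyTarget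
open OverRing polyRing using (sumTo)
open import Algebra.Properties.Semiring.Exp (CommutativeRing.semiring polyRing) using (_^_)

concatMap-sumOver : {A : Set} (f : A → Poly) (as : List A) → concatMap f as ≡ sumOver as f
concatMap-sumOver f [] = ≡.refl
concatMap-sumOver f (a ∷ as) = ≡.cong (f a ++_) (concatMap-sumOver f as)

word-monomial : ∀ U → prodE (xVar ∘ suc) (xWord U) ≋ ((1ℚ , mono (+ 0) (xWord U) []) ∷ [])
word-monomial [] = ≋-refl
word-monomial (letter v n ∷ U) = ≋-trans (prodE-addE (xVar ∘ suc) (setE [] (v ∸ 1) 1) (xWord U)) (*P-cong (prodE-var (xVar ∘ suc) (v ∸ 1)) (word-monomial U))

-- Evaluation at the variables themselves is the identity on polynomials without power sums,
-- whatever value the power sums receive.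
eval-weighted : ∀ ok inv U → weighted ok inv U ≋ eval (xVar ∘ suc) (λ _ → []) (weighted ok inv U)
eval-weighted false inv U = ≋-refl
eval-weighted true inv U = ≋-sym (≋-trans (+P-cong (*P-cong (≋-refl {κU}) (≋-trans (*P-comm _ one) (≋-trans (*P-identityˡ _) (word-monomial U)))) (≋-refl {[]}))
  (≡⇒≋ (≡.cong₂ (λ c a → (c , mono a (xWord U) []) ∷ []) (ℚP.*-identityʳ (sign (mT U))) (ℤP.+-identityʳ _))))
  where
  κU : Poly
  κU = (sign (mT U) , mono (+ mT U ℤ.- + inv) [] []) ∷ []

invT-weighted : ∀ ok inv U → invT (if ok then (sign (mT U) , mono (+ inv ℤ.- + mT U) (xWord U) []) ∷ [] else []) ≡ weighted ok inv U
invT-weighted false inv U = ≡.refl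
invT-weighted true inv U = ≡.cong (λ a → (sign (mT U) , mono a (xWord U) []) ∷ [])
  (≡.trans (ℤP.neg-distrib-+ (+ inv) (ℤ.- + mT U)) (≡.trans (≡.cong (λ z → ℤ.- (+ inv) ℤ.+ z) (ℤP.neg-involutive (+ mT U))) (ℤP.+-comm (ℤ.- + inv) (+ mT U))))

sumP-sumTo : ∀ (f : ℕ → Poly) g n → sumP (map f (applyUpTo g n)) ≋ sumTo n (f ∘ g)
sumP-sumTo f g zero = ≋-refl
sumP-sumTo f g (suc n) = ≋-trans (+P-cong (≋-refl {f (g 0)}) (sumP-sumTo f (g ∘ suc) n)) (≋-sym (sumTo-front n (f ∘ g)))

truncP-eval : ∀ r N F → truncP r N F ≋ eval (cut N) (λ k → Sequences.WithParameter.Alphabet.powerSum polyRing (tPow (+ 1)) (xVar ∘ suc) r (N ∸ r) (suc k)) F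
truncP-eval r N F = ≋-trans (substP-eval _ _ F) (eval-cong (λ _ → ≋-refl) (λ k → ≋-trans (sumP-sumTo _ (λ i → i) (N ∸ r))
  (sumTo-cong (N ∸ r) (λ i _ → ≡⇒≋ (≡.trans (powP-^ (xVar (r ℕ.+ suc i)) (suc k)) (≡.cong (λ j → xVar j ^ suc k) (ℕP.+-suc r i)))))) F)

Gcol-sum : ∀ r d π Σ N → invT (GcolTrunc r d π Σ N) ≋ sumOver (words N d) (λ U → eval (xVar ∘ suc) (λ _ → []) (weighted (isColWord r d π Σ U) (invT̃ r d π U) U))
Gcol-sum r d π Σ N = ≋-trans (≡⇒≋ (≡.trans (ListP.map-concatMap _ _ (words N d)) (concatMap-sumOver _ (words N d))))
  (sumOver-cong (words N d) (λ U → ≋-trans (≡⇒≋ (invT-weighted (isColWord r d π Σ U) (invT̃ r d π U) U)) (eval-weighted (isColWord r d π Σ U) (invT̃ r d π U) U)))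

theorem5p19 : (r d : ℕ) (π : Dyck r d) (Σ : List (ℕ × ℕ)) →
    All (IsCorner r d π) Σ → (N : ℕ) →
    invT (GcolTrunc r d π Σ N) *P powP (one -P tPow (+ 1)) (chiDen r d π Σ)
    ≈P truncP r N (chiNum r d π Σ)
theorem5p19 r d π Σ corners N = ≋⇒≈P (≋-trans (*P-cong (Gcol-sum r d π Σ N) (≡⇒≋ (powP-^ (one -P tPow (+ 1)) (chiDen r d π Σ))))
  (≋-trans (word-sum N r d π Σ corners) (≋-sym (truncP-eval r N (chiNum r d π Σ)))))
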